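{- Let $k\ge 2$. For every $\alpha>0$ there exists $n_0=n_0(\alpha,k)$ such that for every $n\ge n_0$ the following holds. Let $\mathbf{G}=\{G_1,\ldots,G_m\}$ be a collection of graphs on a common vertex set $V$ with $|V|=n$ such that $\delta(\mathbf{G})\ge \left(1-\frac{1}{2k}+\alpha\right)n$. Then, for every edge-colouring $\chi:E(C_n^k)\to[m]$, there exists a $\chi$-coloured $k$th power of a Hamilton cycle in $\mathbf{G}$.
   Context: Graphs are finite and simple; $[m]=\{1,\ldots,m\}$. The graphs in a collection $\mathbf{G}=\{G_1,\ldots,G_m\}$ need not be distinct (it is an indexed family), and $\delta(\mathbf{G}):=\min\{\delta(G_i): i\in[m]\}$, where $\delta(G_i)$ is the minimum degree of $G_i$. $C_n$ is the cycle on $n$ vertices, and $C_n^k$, its $k$th power, is the graph obtained from $C_n$ by adding edges between all pairs of vertices $x,y$ whose distance $d(x,y)$ in $C_n$ satisfies $2\le d(x,y)\le k$. An edge-colouring $\chi:E(H)\to[m]$ is an arbitrary function (not necessarily proper). A $\chi$-coloured copy of a graph $H$ in $\mathbf{G}$ is given by an injective map $\phi:V(H)\to V$ such that $\phi(x)\phi(y)\in E(G_{\chi(xy)})$ for every edge $xy\in E(H)$. A $\chi$-coloured $k$th power of a Hamilton cycle in $\mathbf{G}$ is a $\chi$-coloured copy of $C_n^k$ (so $\phi$ is a bijection onto $V$). -}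

module Defs where

open import Data.Fin using (Fin; toℕ)
import Data.Fin.Properties as Fin
open import Data.Integer using (+_)
open import Data.List using (length; filter; map; allFin)
open import Data.List.Extrema.Nat using (min)
open import Data.Nat using (ℕ; zero; suc; NonZero; _≤_; _<_; _≤?_; s≤s)
import Data.Nat as ℕ
import Data.Nat.Properties as ℕ
open import Data.Product using (∃; _×_; _,_)
open import Data.Rational using (ℚ; 0ℚ; 1ℚ)
import Data.Rational as ℚ
open import Data.Sum using (_⊎_; inj₁; inj₂)
import Data.Sum as Sum
open import Function using (_∘_)
open import Function.Bundles using (_⇔_)
open import Function.Definitions using (Injective)
open import Relation.Binary.Definitions using (Decidable; Symmetric; Irreflexive)
open import Relation.Binary.PropositionalEquality using (_≡_; _≢_; refl; ≢-sym)
open import Relation.Nullary using (¬_; Dec)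
open import Relation.Nullary.Decidable using (_×-dec_; _⊎-dec_; ¬?; map′)

-- Real numbers as (two-sided, located) Dedekind cuts:
-- L q means q < x and U q means x < q.
record ℝ : Set₁ where
  field
    L U      : ℚ → Set
    L-inhab  : ∃ L
    U-inhab  : ∃ U
    L-round  : ∀ q → L q ⇔ (∃ λ r → q ℚ.< r × L r)
    U-round  : ∀ q → U q ⇔ (∃ λ r → r ℚ.< q × U r)
    disjoint : ∀ q → ¬ (L q × U q)
    located  : ∀ q r → q ℚ.< r → L q ⊎ U r

Positive : ℝ → Set
Positive x = ℝ.L x 0ℚ

fromℕ : ℕ → ℚ
fromℕ n = + n ℚ./ 1

-- d ≥⟨ c + α ⟩· n  is the inequality  d ≥ (c + α) n  for real α.  As α is the
-- supremum of its lower cut and n ≥ 0, it says that d ≥ (c + q) n for all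
-- rational q < α.
_≥⟨_+_⟩·_ : ℕ → ℚ → ℝ → ℕ → Set
d ≥⟨ c + α ⟩· n = ∀ q → ℝ.L α q → (c ℚ.+ q) ℚ.* fromℕ n ℚ.≤ fromℕ d

1-1/2k : (k : ℕ) .{{_ : NonZero k}} → ℚ
1-1/2k k = 1ℚ ℚ.- (ℚ._/_ (+ 1) (2 ℕ.* k) {{ℕ.m*n≢0 2 k}})

-- Finite simple graphs with vertex set Fin n.
record Graph (n : ℕ) : Set₁ where
  field
    _~_      : Fin n → Fin n → Set
    _~?_     : Decidable _~_
    ~-sym    : Symmetric _~_
    ~-irrefl : Irreflexive _≡_ _~_

Adj : ∀ {n} → Graph n → Fin n → Fin n → Set
Adj = Graph._~_

degree : ∀ {n} → Graph n → Fin n → ℕ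
degree {n} G v = length (filter (Graph._~?_ G v) (allFin n))

-- `min n xs` is the minimum of n and the entries of xs.  Every degree in a
-- graph on n vertices is less than n, so the first argument n only matters
-- when the list is empty (no vertices, respectively no graphs).
minDegree : ∀ {n} → Graph n → ℕ
minDegree {n} G = min n (map (degree G) (allFin n))

δ : ∀ {n m} → (Fin m → Graph n) → ℕ
δ {n} {m} 𝐆 = min n (map (minDegree ∘ 𝐆) (allFin m))

module _ {n : ℕ} (G : Graph n) where
  open Graph G

  Walk : ℕ → Fin n → Fin n → Set
  Walk zero    x y = x ≡ y
  Walk (suc ℓ) x y = ∃ λ z → x ~ z × Walk ℓ z y

  Distance : Fin n → Fin n → ℕ → Set
  Distance x y d = Walk d x y × (∀ {ℓ} → ℓ < d → ¬ Walk ℓ x y)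

  walk? : ∀ ℓ x y → Dec (Walk ℓ x y)
  walk? zero    x y = x Fin.≟ y
  walk? (suc ℓ) x y = Fin.any? λ z → (x ~? z) ×-dec walk? ℓ z y

  walk-snoc : ∀ ℓ {x y z} → Walk ℓ x y → y ~ z → Walk (suc ℓ) x z
  walk-snoc zero    refl         e = _ , e , refl
  walk-snoc (suc ℓ) (_ , e′ , w) e = _ , e′ , walk-snoc ℓ w e

  walk-sym : ∀ ℓ {x y} → Walk ℓ x y → Walk ℓ y x
  walk-sym zero    refl        = refl
  walk-sym (suc ℓ) (_ , e , w) = walk-snoc ℓ (walk-sym ℓ w) (~-sym e)

  distance-sym : ∀ {x y} d → Distance x y d → Distance y x d
  distance-sym d (w , min) = walk-sym d w , λ ℓ<d → min ℓ<d ∘ walk-sym _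

  distance? : ∀ x y d → Dec (Distance x y d)
  distance? x y d =
    walk? d x y ×-dec ℕ.allUpTo? (λ ℓ → ¬? (walk? ℓ x y)) d

-- The k-th power: all pairs at distance between 2 and k are added as edges.
infix 30 _^_
_^_ : ∀ {n} → Graph n → ℕ → Graph n
_^_ {n} G k = record
  { _~_      = _≈_
  ; _~?_     = λ x y → (x ~? y) ⊎-dec far? x y
  ; ~-sym    = Sum.map ~-sym λ { (d , 2≤d , d≤k , D) → d , 2≤d , d≤k , distance-sym G d D }
  ; ~-irrefl = irrefl
  }
  where
  open Graph G
  Far : Fin n → Fin n → Set
  Far x y = ∃ λ d → 2 ≤ d × d ≤ k × Distance G x y d
  _≈_ : Fin n → Fin n → Set
  x ≈ y = x ~ y ⊎ Far x y
  far? : ∀ x y → Dec (Far x y)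
  far? x y = map′
    (λ { (d , s≤s d≤k , 2≤d , D) → d , 2≤d , d≤k , D })
    (λ { (d , 2≤d , d≤k , D) → d , s≤s d≤k , 2≤d , D })
    (ℕ.anyUpTo? (λ d → (2 ≤? d) ×-dec distance? G x y d) (suc k))
  irrefl : Irreflexive _≡_ _≈_
  irrefl eq   (inj₁ e)                       = ~-irrefl eq e
  irrefl refl (inj₂ (suc d , _ , _ , _ , min)) = min (s≤s ℕ.z≤n) refl

-- y is the cyclic successor of x in 0, 1, …, n - 1.
Next : ∀ {n} → Fin n → Fin n → Set
Next {n} x y = toℕ y ≡ suc (toℕ x) ⊎ (suc (toℕ x) ≡ n × toℕ y ≡ 0)

next? : ∀ {n} → Decidable (Next {n})
next? {n} x y = (toℕ y ℕ.≟ suc (toℕ x)) ⊎-dec ((suc (toℕ x) ℕ.≟ n) ×-dec (toℕ y ℕ.≟ 0))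

-- The condition x ≢ y only excludes a loop when n = 1; the definition is the
-- usual cycle for n ≥ 3.
C : ∀ n → Graph n
C n = record
  { _~_      = λ x y → x ≢ y × (Next x y ⊎ Next y x)
  ; _~?_     = λ x y → ¬? (x Fin.≟ y) ×-dec (next? x y ⊎-dec next? y x)
  ; ~-sym    = λ { (x≢y , e) → ≢-sym x≢y , Sum.swap e }
  ; ~-irrefl = λ { eq (x≢y , _) → x≢y eq }
  }

-- Edges are unordered pairs, so a colouring is a function on adjacent ordered
-- pairs invariant under swapping; by Graph.~-sym, `symmetric` also makes the
-- colour independent of the adjacency proof.
record EdgeColouring {h : ℕ} (H : Graph h) (m : ℕ) : Set where
  field
    colour    : ∀ {x y} → Adj H x y → Fin m
    symmetric : ∀ {x y} (p : Adj H x y) (q : Adj H y x) → colour p ≡ colour q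

record ColouredCopy {h m n : ℕ} (H : Graph h) (χ : EdgeColouring H m)
                    (𝐆 : Fin m → Graph n) : Set where
  open EdgeColouring χ
  field
    φ         : Fin h → Fin n
    injective : Injective _≡_ _≡_ φ
    edges     : ∀ {x y} (e : Adj H x y) → Adj (𝐆 (colour e)) (φ x) (φ y)

{-# OPTIONS --safe #-}
module Submission where

open import Defs
open import Data.Bool using (Bool; true; false; not; _∧_; _∨_)
import Data.Bool as Bool
open import Data.Bool.Properties using (∧-conicalˡ; ∧-conicalʳ; ∧-assoc; ∧-identityʳ; ¬-not; not-injective)
open import Data.Empty using (⊥; ⊥-elim)
open import Data.Fin using (Fin; zero; suc; toℕ; fromℕ<; combine; remQuot)
open import Data.Fin.Permutation using (Permutation; _⟨$⟩ʳ_; _∘ₚ_; transpose)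
import Data.Fin.Permutation as Perm
import Data.Fin.Properties as Fin
open import Data.Integer using () renaming (+_ to pos; -[1+_] to negsuc)
import Data.Integer as ℤ
import Data.Integer.Properties as ℤ
import Data.Integer.Tactic.RingSolver as ℤ-Solver
open import Data.List using (length; filter; tabulate; allFin)
import Data.List as List
open import Data.List.Extrema.Nat using (min≤⊤; min≤xs)
open import Data.List.Membership.Propositional.Properties using (∈-map⁺; ∈-allFin)
open import Data.List.Relation.Unary.All using (lookup)
open import Data.Nat renaming (_^_ to _^ℕ_)
open import Data.Nat.Coprimality using (Coprime)
open import Data.Nat.DivMod
  using (m≡m%n+[m/n]*n; m%n<n; m/n*n≤m; /-mono-≤; /-monoˡ-≤; m*n/n≡m; m<n⇒m%n≡m; [m+n]%n≡m%n; [m+kn]%n≡m%n)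
open import Data.Nat.Properties
open import Data.Nat.Tactic.RingSolver using (solve-∀)
open import Data.Product using (∃; ∃₂; _×_; _,_; proj₁; proj₂)
open import Data.Rational using (0ℚ; mkℚ; toℚᵘ)
import Data.Rational as ℚ
import Data.Rational.Properties as ℚ
open import Data.Rational.Unnormalised using (mkℚᵘ; _≃_; *≤*)
import Data.Rational.Unnormalised as ℚᵘ
import Data.Rational.Unnormalised.Properties as ℚᵘ
open import Data.Sum using (_⊎_; inj₁; inj₂; [_,_]′; map₁; map₂)
open import Function using (_∘_)
open import Function.Bundles using (Equivalence)
open import Relation.Binary.Definitions using (tri<; tri≈; tri>)
open import Relation.Binary.PropositionalEquality hiding (J)
open import Relation.Nullary using (¬_; Dec; yes; no; does; contradiction)
open import Relation.Nullary.Decidable using (dec-true; dec-false; _×-dec_)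
open import Relation.Unary using (Decidable)
open import Algebra.Properties.Semiring.Sum +-*-semiring
  using (sum; sum-cong-≗; ∑-distrib-+; ∑-comm; *-distribˡ-sum; *-distribʳ-sum; sum-permute)

-- For some D depending on α, every vertex has at most (1 - 1/D) n / 2k
-- non-neighbours in each of the graphs, so the 2k neighbours of a position leave
-- at least n / D candidates for it, whichever colours are involved.
--
-- Absorption.  First embed linearly many gadgets, i.e. blocks of 2k + 1
-- consecutive positions, such that for every vertex v, every position p and all
-- possible images of the neighbours of p, linearly many gadgets have the property
-- that v may replace the vertex x at their centre while x may be placed at p.
-- The gadgets are chosen greedily, such that each of them serves a constant
-- proportion of the triples (v, p, images), weighted by 2 ^ (number of failures).
-- Once the number of empty positions is small enough, they can then be filled one
-- by one.
--
-- Covering.  Let R be the set of free vertices and suppose that every vertex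
-- still has at most about |R| / 2k non-neighbours in R.  A segment of L positions
-- has |R| embeddings into R such that each position receives every vertex of R
-- exactly once: the positions are treated from left to right, each by a perfect
-- matching in a bipartite graph between embeddings and vertices.  A vertex
-- conflicts with at most |R| / 2k embeddings for each of the k preceding
-- positions, so both degrees are at least |R| / 2.  On average over these
-- embeddings a set W loses the proportion L / |R| of its free vertices.  Hence one
-- can choose an embedding that controls a sum, over the sets W of non-neighbours,
-- of falling factorials of |W ∩ R|, which keeps the hypothesis on non-neighbours
-- valid until R is small enough for the absorption.

-- Sums and counting

-- Potentials kept down by averaging take the place of random choices. For covering, falling
-- factorials suit this better than powers: with `r` free vertices, the potential shrinks per
-- segment by the factor `(r - (1 + d) L) / r`, and `fall L (1 + d) r` shrinks by exactly the same
-- factor. Their quotient never increases, so no error accumulates over linearly many segments. The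
-- degree is proportional to `z`, which amplifies a constant gap between two densities to `2 ^ z`,
-- more than the `n ^ 3` sets times `n`. The gap comes from a ladder of densities of non-neighbours,
-- in units of 1/2k: 1 - 1/D by hypothesis, 1 - 1/2D among the free vertices once the gadgets are
-- placed, 1 - 1/3D as the rate in the growth estimate, and 1 - 1/4D as the bound that is
-- maintained. Leaving `k` positions empty between segments removes all edges between them, so that
-- only the `k` preceding positions of the same segment conflict with a new one. The price is a
-- leftover share of about 1/J, and J is chosen after the gadgets' parameters so that they can
-- absorb it.

𝟙 : Bool → ℕ
𝟙 true  = 1
𝟙 false = 0

count : ∀ {n} → (Fin n → Bool) → ℕ
count P = sum (𝟙 ∘ P)

infixr 6 _∩_
_∩_ : ∀ {n} → (Fin n → Bool) → (Fin n → Bool) → Fin n → Bool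
(P ∩ Q) i = P i ∧ Q i

𝟙-∧ : ∀ a b → 𝟙 (a ∧ b) ≡ 𝟙 a * 𝟙 b
𝟙-∧ true  b = sym (+-identityʳ _)
𝟙-∧ false b = refl

𝟙-mono : ∀ {a b} → (a ≡ true → b ≡ true) → 𝟙 a ≤ 𝟙 b
𝟙-mono {false} a⇒b = z≤n
𝟙-mono {true} {b} a⇒b rewrite a⇒b refl = ≤-refl

𝟙≤1 : ∀ a → 𝟙 a ≤ 1
𝟙≤1 true  = ≤-refl
𝟙≤1 false = z≤n

sum-mono : ∀ {n} {f g : Fin n → ℕ} → (∀ i → f i ≤ g i) → sum f ≤ sum g
sum-mono {zero}  f≤g = z≤n
sum-mono {suc n} f≤g = +-mono-≤ (f≤g zero) (sum-mono (f≤g ∘ suc))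

sum-mono-< : ∀ {n} {f g : Fin n → ℕ} → (∀ i → f i ≤ g i) → ∀ i → f i < g i → sum f < sum g
sum-mono-< f≤g zero    lt = +-mono-<-≤ lt (sum-mono (f≤g ∘ suc))
sum-mono-< f≤g (suc i) lt = +-mono-≤-< (f≤g zero) (sum-mono-< (f≤g ∘ suc) i lt)

sum-const : ∀ n c → sum {n} (λ _ → c) ≡ n * c
sum-const zero    c = refl
sum-const (suc n) c = cong (c +_) (sum-const n c)

term≤sum : ∀ {n} (f : Fin n → ℕ) i → f i ≤ sum f
term≤sum f zero    = m≤m+n _ _
term≤sum f (suc i) = ≤-trans (term≤sum (f ∘ suc) i) (m≤n+m _ _)

sum≤* : ∀ {n} (f : Fin n → ℕ) {c} → (∀ i → f i ≤ c) → sum f ≤ n * c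
sum≤* {n} f {c} f≤c = ≤-trans (sum-mono f≤c) (≤-reflexive (sum-const n c))

sum-differ : ∀ {n} (f g : Fin n → ℕ) i → (∀ j → j ≢ i → f j ≡ g j) → sum f + g i ≡ sum g + f i
sum-differ f g zero    eq = begin
  f zero + sum (f ∘ suc) + g zero  ≡⟨ cong (λ x → f zero + x + g zero) (sum-cong-≗ (λ j → eq (suc j) λ ())) ⟩
  f zero + sum (g ∘ suc) + g zero  ≡⟨ solve (f zero) (sum (g ∘ suc)) (g zero) ⟩
  g zero + sum (g ∘ suc) + f zero  ∎
  where
  open ≡-Reasoning
  solve : ∀ a b c → a + b + c ≡ c + b + a
  solve = solve-∀
sum-differ f g (suc i) eq = begin
  f zero + sum (f ∘ suc) + g (suc i)    ≡⟨ +-assoc (f zero) _ _ ⟩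
  f zero + (sum (f ∘ suc) + g (suc i))  ≡⟨ cong₂ _+_ (eq zero λ ()) (sum-differ (f ∘ suc) (g ∘ suc) i
                                               λ j j≢i → eq (suc j) (j≢i ∘ Fin.suc-injective)) ⟩
  g zero + (sum (g ∘ suc) + f (suc i))  ≡⟨ +-assoc (g zero) _ _ ⟨
  g zero + sum (g ∘ suc) + f (suc i)    ∎
  where open ≡-Reasoning

average-≥ : ∀ {n} (f : Fin n → ℕ) → 0 < n → ∃ λ i → sum f ≤ n * f i
average-≥ {suc zero}    f _ = zero , ≤-refl
average-≥ {suc (suc n)} f _ with average-≥ (f ∘ suc) (s≤s z≤n)
... | i , le with ≤-total (f zero) (f (suc i))
... | inj₁ f₀≤ = suc i , +-mono-≤ f₀≤ le
... | inj₂ ≤f₀ = zero , +-monoʳ-≤ (f zero) (≤-trans le (*-monoʳ-≤ (suc n) ≤f₀))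

average-≤ : ∀ {n} (R : Fin n → Bool) (f : Fin n → ℕ) {c} → 0 < count R →
            sum (λ i → 𝟙 (R i) * f i) ≤ count R * c → ∃ λ i → R i ≡ true × f i ≤ c
average-≤ R f {c} R>0 le
  with Fin.any? (λ i → (R i Bool.≟ true) ×-dec (f i ≤? c))
... | yes found = found
... | no  none  = ⊥-elim (<-irrefl refl (<-≤-trans strict le))
  where
  large : ∀ i → R i ≡ true → c < f i
  large i Ri = ≰⇒> λ fi≤c → none (i , Ri , fi≤c)
  termwise : ∀ i → 𝟙 (R i) * suc c ≤ 𝟙 (R i) * f i
  termwise i with R i in Ri
  ... | false = z≤n
  ... | true  = +-monoˡ-≤ 0 (large i Ri)
  strict : count R * c < sum (λ i → 𝟙 (R i) * f i)
  strict = begin-strict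
    count R * c                    <⟨ *-monoʳ-< (count R) {{>-nonZero R>0}} (n<1+n c) ⟩
    count R * suc c                ≡⟨ *-distribʳ-sum (suc c) (𝟙 ∘ R) ⟩
    sum (λ i → 𝟙 (R i) * suc c)    ≤⟨ sum-mono termwise ⟩
    sum (λ i → 𝟙 (R i) * f i)      ∎
    where open ≤-Reasoning

count-mono : ∀ {n} {P Q : Fin n → Bool} → (∀ i → P i ≡ true → Q i ≡ true) → count P ≤ count Q
count-mono P⇒Q = sum-mono (λ i → 𝟙-mono (P⇒Q i))

count≤n : ∀ {n} (P : Fin n → Bool) → count P ≤ n
count≤n {n} P = subst (count P ≤_) (*-identityʳ n) (sum≤* (𝟙 ∘ P) (𝟙≤1 ∘ P))

count-split : ∀ {n} (P Q : Fin n → Bool) → count (P ∩ Q) + count (P ∩ (not ∘ Q)) ≡ count P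
count-split P Q = trans (sym (∑-distrib-+ (𝟙 ∘ (P ∩ Q)) (𝟙 ∘ (P ∩ (not ∘ Q)))))
                        (sum-cong-≗ (λ i → go (P i) (Q i)))
  where
  go : ∀ a b → 𝟙 (a ∧ b) + 𝟙 (a ∧ not b) ≡ 𝟙 a
  go true  true  = refl
  go true  false = refl
  go false b     = refl

count-positive : ∀ {n} (P : Fin n → Bool) → 0 < count P → ∃ λ i → P i ≡ true
count-positive P 0<c with average-≤ P (λ _ → 0) 0<c (≤-reflexive (sym (*-distribʳ-sum 0 (𝟙 ∘ P))))
... | i , Pi , _ = i , Pi

-- Sums and conjunctions over initial segments of ℕ

∑< : ℕ → (ℕ → ℕ) → ℕ
∑< zero    f = 0
∑< (suc m) f = ∑< m f + f m

all< : ℕ → (ℕ → Bool) → Bool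
all< zero    P = true
all< (suc m) P = all< m P ∧ P m

∑<-mono : ∀ m {f g : ℕ → ℕ} → (∀ a → a < m → f a ≤ g a) → ∑< m f ≤ ∑< m g
∑<-mono zero    f≤g = z≤n
∑<-mono (suc m) f≤g = +-mono-≤ (∑<-mono m λ a a<m → f≤g a (m<n⇒m<1+n a<m)) (f≤g m ≤-refl)

∑<-cong : ∀ m {f g : ℕ → ℕ} → (∀ a → a < m → f a ≡ g a) → ∑< m f ≡ ∑< m g
∑<-cong zero    f≡g = refl
∑<-cong (suc m) f≡g = cong₂ _+_ (∑<-cong m λ a a<m → f≡g a (m<n⇒m<1+n a<m)) (f≡g m ≤-refl)

∑<-const : ∀ m c → ∑< m (λ _ → c) ≡ m * c
∑<-const zero    c = refl
∑<-const (suc m) c = trans (+-comm _ c) (cong (c +_) (∑<-const m c))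

∑<-distrib-+ : ∀ m f g → ∑< m (λ a → f a + g a) ≡ ∑< m f + ∑< m g
∑<-distrib-+ zero    f g = refl
∑<-distrib-+ (suc m) f g = trans (cong (_+ (f m + g m)) (∑<-distrib-+ m f g)) (solve (∑< m f) (∑< m g) (f m) (g m))
  where
  solve : ∀ a b c d → (a + b) + (c + d) ≡ (a + c) + (b + d)
  solve = solve-∀

sum-∑< : ∀ {n} m (f : Fin n → ℕ → ℕ) → sum (λ i → ∑< m (f i)) ≡ ∑< m (λ a → sum (λ i → f i a))
sum-∑< {n} zero    f = trans (sum-const n 0) (*-zeroʳ n)
sum-∑< (suc m) f = trans (∑-distrib-+ (λ i → ∑< m (f i)) (λ i → f i m)) (cong (_+ sum (λ i → f i m)) (sum-∑< m f))

∑<-pigeonhole : ∀ m (f f′ : ℕ → ℕ) → ∑< m f < ∑< m f′ → ∃ λ i → i < m × f i < f′ i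
∑<-pigeonhole (suc m) f f′ lt with f m <? f′ m
... | yes lt′ = m , ≤-refl , lt′
... | no  ≮   with ∑<-pigeonhole m f f′ (≰⇒> λ ge → <⇒≱ lt (+-mono-≤ ge (≮⇒≥ ≮)))
...   | i , i<m , lt″ = i , m<n⇒m<1+n i<m , lt″

𝟙-< : ∀ {a b} → 𝟙 a < 𝟙 b → a ≡ false × b ≡ true
𝟙-< {false} {true}  _ = refl , refl
𝟙-< {true}  {true}  (s≤s ())

all<-elim : ∀ m {P} → all< m P ≡ true → ∀ a → a < m → P a ≡ true
all<-elim (suc m) {P} all a a<1+m with m≤n⇒m<n∨m≡n (s≤s⁻¹ a<1+m)
... | inj₁ a<m  = all<-elim m (∧-conicalˡ (all< m P) (P m) all) a a<m
... | inj₂ refl = ∧-conicalʳ (all< m P) (P m) all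

all<-intro : ∀ m {P} → (∀ a → a < m → P a ≡ true) → all< m P ≡ true
all<-intro zero    all = refl
all<-intro (suc m) all = cong₂ _∧_ (all<-intro m λ a a<m → all a (m<n⇒m<1+n a<m)) (all m ≤-refl)

all<-cong : ∀ m {P Q : ℕ → Bool} → (∀ a → a < m → P a ≡ Q a) → all< m P ≡ all< m Q
all<-cong zero    P≡Q = refl
all<-cong (suc m) P≡Q = cong₂ _∧_ (all<-cong m λ a a<m → P≡Q a (m<n⇒m<1+n a<m)) (P≡Q m ≤-refl)

union-bound : ∀ {n} (R : Fin n → Bool) m (P : ℕ → Fin n → Bool) →
              count (R ∩ λ v → not (all< m (λ a → P a v))) ≤ ∑< m (λ a → count (R ∩ (not ∘ P a)))
union-bound {n} R zero    P = ≤-reflexive (trans (sum-cong-≗ λ v → zero′ (R v)) (trans (sum-const n 0) (*-zeroʳ n)))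
  where
  zero′ : ∀ x → 𝟙 (x ∧ false) ≡ 0
  zero′ true  = refl
  zero′ false = refl
union-bound {n} R (suc m) P = begin
  count (R ∩ λ v → not (A v ∧ P m v))               ≤⟨ sum-mono (λ v → go (R v) (A v) (P m v)) ⟩
  sum (λ v → 𝟙 (R v ∧ not (A v)) + 𝟙 (R v ∧ not (P m v))) ≡⟨ ∑-distrib-+ (𝟙 ∘ (R ∩ (not ∘ A))) (𝟙 ∘ (R ∩ (not ∘ P m))) ⟩
  count (R ∩ (not ∘ A)) + count (R ∩ (not ∘ P m))   ≤⟨ +-monoˡ-≤ _ (union-bound R m P) ⟩
  ∑< m _ + count (R ∩ (not ∘ P m))                  ∎
  where
  open ≤-Reasoning
  A : Fin n → Bool
  A v = all< m (λ a → P a v)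
  go : ∀ x y z → 𝟙 (x ∧ not (y ∧ z)) ≤ 𝟙 (x ∧ not y) + 𝟙 (x ∧ not z)
  go false y     z     = z≤n
  go true  true  z     = ≤-refl
  go true  false true  = ≤-refl
  go true  false false = s≤s z≤n

intersection-bound : ∀ {n} (R : Fin n → Bool) m (P : ℕ → Fin n → Bool) →
                     count R ≤ count (R ∩ λ v → all< m (λ a → P a v)) + ∑< m (λ a → count (R ∩ (not ∘ P a)))
intersection-bound {n} R m P = begin
  count R                              ≡⟨ count-split R A ⟨
  count (R ∩ A) + count (R ∩ (not ∘ A)) ≤⟨ +-monoʳ-≤ (count (R ∩ A)) (union-bound R m P) ⟩
  count (R ∩ A) + ∑< m _               ∎
  where
  open ≤-Reasoning
  A : Fin n → Bool
  A v = all< m (λ a → P a v)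

-- Discrete convexity

Monotone Convex : (ℕ → ℕ) → Set
Monotone f = ∀ {x y} → x ≤ y → f x ≤ f y
Convex f = ∀ x → f (1 + x) + f (1 + x) ≤ f x + f (2 + x)

-- Multiply the two convexity inequalities and apply Chebyshev's sum inequality. With `p` and `q`
-- the increments of `f` and `g` from `x` to `2 + x`, twice the right side exceeds the product by
-- exactly `p * q`, which is where monotonicity enters.
*-convex : ∀ {f g} → Monotone f → Monotone g → Convex f → Convex g → Convex (λ x → f x * g x)
*-convex {f} {g} f↑ g↑ f∪ g∪ x =
  go (f x) (f (1 + x)) (f (2 + x)) (g x) (g (1 + x)) (g (2 + x))
     (f↑ (m≤n+m x 2)) (g↑ (m≤n+m x 2)) (f∪ x) (g∪ x)
  where
  expand : ∀ a p c q → (a + (a + p)) * (c + (c + q)) + p * q ≡ 2 * (a * c + (a + p) * (c + q))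
  expand = solve-∀
  go : ∀ a₀ a₁ a₂ b₀ b₁ b₂ → a₀ ≤ a₂ → b₀ ≤ b₂ → a₁ + a₁ ≤ a₀ + a₂ → b₁ + b₁ ≤ b₀ + b₂ →
       a₁ * b₁ + a₁ * b₁ ≤ a₀ * b₀ + a₂ * b₂
  go a₀ a₁ a₂ b₀ b₁ b₂ a≤ b≤ a∪ b∪ with m≤n⇒∃[o]m+o≡n a≤ | m≤n⇒∃[o]m+o≡n b≤
  ... | p , refl | q , refl = *-cancelˡ-≤ 2 (begin
    2 * (a₁ * b₁ + a₁ * b₁)                   ≡⟨ solve a₁ b₁ ⟩
    (a₁ + a₁) * (b₁ + b₁)                     ≤⟨ *-mono-≤ a∪ b∪ ⟩
    (a₀ + (a₀ + p)) * (b₀ + (b₀ + q))         ≤⟨ m≤m+n _ _ ⟩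
    (a₀ + (a₀ + p)) * (b₀ + (b₀ + q)) + p * q ≡⟨ expand a₀ p b₀ q ⟩
    2 * (a₀ * b₀ + (a₀ + p) * (b₀ + q))       ∎)
    where
    open ≤-Reasoning
    solve : ∀ a b → 2 * (a * b + a * b) ≡ (a + a) * (b + b)
    solve = solve-∀

-- Truncation makes the function constant up to `L`. At the kink monotonicity of `f` suffices, and
-- beyond it the claim is convexity of `f` itself.
∸-convex : ∀ {f} L → Monotone f → Convex f → Convex (λ x → f (x ∸ L))
∸-convex zero    f↑ f∪ x       = f∪ x
∸-convex {f} (suc zero) f↑ f∪ zero = +-monoʳ-≤ (f 0) (f↑ z≤n)
∸-convex {f} (suc (suc L)) f↑ f∪ zero rewrite 0∸n≡0 L = +-monoʳ-≤ (f 0) (f↑ z≤n)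
∸-convex (suc L) f↑ f∪ (suc x) = ∸-convex L f↑ f∪ x

-- The line through the points of the graph at `z = y + b` and `1 + z` lies below `f` on both sides,
-- by `before` and `after`. Adding these with weights `c` and `b` cancels the slope.
chord : ∀ {f} → Convex f → ∀ y b c → (c + b) * f (y + b) ≤ c * f y + b * f (y + b + c)
chord {f} f∪ y b c = +-cancelʳ-≤ (c * (b * f₀) + b * (c * f₁)) _ _ (begin
  (c + b) * f₀ + (c * (b * f₀) + b * (c * f₁))      ≡⟨ solve₁ b c f₀ f₁ ⟩
  c * (f₀ + b * f₀) + b * (f₀ + c * f₁)             ≤⟨ +-mono-≤ (*-monoʳ-≤ c (before y b)) (*-monoʳ-≤ b (after c)) ⟩
  c * (f y + b * f₁) + b * (f (z + c) + c * f₀)     ≡⟨ solve₂ b c f₀ f₁ (f y) (f (z + c)) ⟩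
  c * f y + b * f (z + c) + (c * (b * f₀) + b * (c * f₁)) ∎)
  where
  open ≤-Reasoning
  z = y + b
  f₀ = f z
  f₁ = f (1 + z)
  solve₁ : ∀ b c f₀ f₁ → (c + b) * f₀ + (c * (b * f₀) + b * (c * f₁)) ≡ c * (f₀ + b * f₀) + b * (f₀ + c * f₁)
  solve₁ = solve-∀
  solve₂ : ∀ b c f₀ f₁ u v → c * (u + b * f₁) + b * (v + c * f₀) ≡ c * u + b * v + (c * (b * f₀) + b * (c * f₁))
  solve₂ = solve-∀
  swap₄ : ∀ p q r s → (p + q) + (r + s) ≡ (p + s) + (q + r)
  swap₄ = solve-∀
  increments : ∀ x j → f (1 + x) + f (x + j) ≤ f x + f (1 + (x + j))
  increments x zero    rewrite +-identityʳ x = ≤-reflexive (+-comm (f (1 + x)) (f x))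
  increments x (suc j) rewrite +-suc x j = +-cancelʳ-≤ (f (x + j) + f (1 + (x + j))) _ _ (begin
    (f (1 + x) + f (1 + (x + j))) + (f (x + j) + f (1 + (x + j)))
      ≡⟨ s₁ (f (1 + x)) (f (1 + (x + j))) (f (x + j)) ⟩
    (f (1 + x) + f (x + j)) + (f (1 + (x + j)) + f (1 + (x + j)))
      ≤⟨ +-mono-≤ (increments x j) (f∪ (x + j)) ⟩
    (f x + f (1 + (x + j))) + (f (x + j) + f (2 + (x + j)))
      ≡⟨ swap₄ (f x) _ _ _ ⟩
    (f x + f (2 + (x + j))) + (f (1 + (x + j)) + f (x + j))
      ≡⟨ cong (f x + f (2 + (x + j)) +_) (+-comm (f (1 + (x + j))) _) ⟩
    (f x + f (2 + (x + j))) + (f (x + j) + f (1 + (x + j))) ∎)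
    where
    s₁ : ∀ p q r → (p + q) + (r + q) ≡ (p + r) + (q + q)
    s₁ = solve-∀
  after : ∀ c → f₀ + c * f₁ ≤ f (z + c) + c * f₀
  after zero    rewrite +-identityʳ z = ≤-refl
  after (suc c) rewrite +-suc z c = +-cancelʳ-≤ (f (z + c)) _ _ (begin
    f₀ + (f₁ + c * f₁) + f (z + c)       ≡⟨ s₁ f₀ f₁ (c * f₁) (f (z + c)) ⟩
    (f₁ + f (z + c)) + (f₀ + c * f₁)     ≤⟨ +-mono-≤ (increments z c) (after c) ⟩
    (f₀ + f (1 + (z + c))) + (f (z + c) + c * f₀) ≡⟨ s₂ f₀ (f (1 + (z + c))) (f (z + c)) (c * f₀) ⟩
    f (1 + (z + c)) + (f₀ + c * f₀) + f (z + c) ∎)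
    where
    s₁ : ∀ p q r s → p + (q + r) + s ≡ (q + s) + (p + r)
    s₁ = solve-∀
    s₂ : ∀ p q r s → (p + q) + (r + s) ≡ q + (p + s) + r
    s₂ = solve-∀
  before : ∀ y b → f (y + b) + b * f (y + b) ≤ f y + b * f (1 + (y + b))
  before y zero    rewrite +-identityʳ y = ≤-refl
  before y (suc b) = +-cancelʳ-≤ (f (1 + y)) _ _ (begin
    (g + (g + b * g)) + f (1 + y)             ≡⟨ s₁ g (b * g) (f (1 + y)) ⟩
    (f (1 + y) + g) + (g + b * g)             ≤⟨ +-mono-≤ (increments y (suc b)) ih ⟩
    (f y + g₁) + (f (1 + y) + b * g₁)         ≡⟨ s₂ (f y) g₁ (f (1 + y)) (b * g₁) ⟩
    (f y + (g₁ + b * g₁)) + f (1 + y)         ∎)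
    where
    g = f (y + suc b)
    g₁ = f (1 + (y + suc b))
    ih : g + b * g ≤ f (1 + y) + b * g₁
    ih rewrite +-suc y b = before (1 + y) b
    s₁ : ∀ p q r → (p + (p + q)) + r ≡ (r + p) + (p + q)
    s₁ = solve-∀
    s₂ : ∀ p q r s → (p + q) + (r + s) ≡ (p + (q + s)) + r
    s₂ = solve-∀

-- Falling factorials with step L

-- x (x - L) ... (x - (d - 1) L), or 0 if a factor is not positive.
fall : ℕ → ℕ → ℕ → ℕ
fall L zero    x = 1
fall L (suc d) x = x * fall L d (x ∸ L)

module _ (L : ℕ) where

  fall-mono : ∀ d → Monotone (fall L d)
  fall-mono zero    x≤y = ≤-refl
  fall-mono (suc d) x≤y = *-mono-≤ x≤y (fall-mono d (∸-monoˡ-≤ L x≤y))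

  fall-convex : ∀ d → Convex (fall L d)
  fall-convex zero    x = ≤-refl
  fall-convex (suc d) = *-convex (λ x≤y → x≤y) (λ x≤y → fall-mono d (∸-monoˡ-≤ L x≤y))
    (λ x → ≤-reflexive (id-convex x)) (∸-convex L (fall-mono d) (fall-convex d))
    where
    id-convex : ∀ x → (1 + x) + (1 + x) ≡ x + (2 + x)
    id-convex = solve-∀

  -- The recursion splits off the largest factor, this equation the smallest. Comparing the two is
  -- what makes the drift of the potential telescope.
  fall-last : ∀ d x → fall L (suc d) x ≡ fall L d x * (x ∸ d * L)
  fall-last zero    x = trans (*-identityʳ x) (sym (+-identityʳ x))
  fall-last (suc d) x = begin
    x * fall L (suc d) (x ∸ L)                 ≡⟨ cong (x *_) (fall-last d (x ∸ L)) ⟩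
    x * (fall L d (x ∸ L) * (x ∸ L ∸ d * L))   ≡⟨ *-assoc x _ _ ⟨
    fall L (suc d) x * (x ∸ L ∸ d * L)         ≡⟨ cong (fall L (suc d) x *_) (∸-+-assoc x L (d * L)) ⟩
    fall L (suc d) x * (x ∸ suc d * L)         ∎
    where open ≡-Reasoning

  fall-vanishes : ∀ d x → x ≤ d * L → fall L (suc d) x ≡ 0
  fall-vanishes d x x≤dL = trans (fall-last d x) (trans (cong (fall L d x *_) (m≤n⇒m∸n≡0 x≤dL)) (*-zeroʳ (fall L d x)))

  fall≤^ : ∀ d x → fall L d x ≤ x ^ℕ d
  fall≤^ zero    x = ≤-refl
  fall≤^ (suc d) x = *-monoʳ-≤ x (≤-trans (fall≤^ d (x ∸ L)) (^-monoˡ-≤ d (m∸n≤m x L)))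

  ^≤fall : ∀ d x y → y + d * L ≤ x → y ^ℕ d ≤ fall L d x
  ^≤fall zero    x y _  = ≤-refl
  ^≤fall (suc d) x y le = *-mono-≤ (m+n≤o⇒m≤o y le) (^≤fall d (x ∸ L) y (begin
    y + d * L             ≡⟨ m+n∸n≡m (y + d * L) L ⟨
    y + d * L + L ∸ L     ≡⟨ cong (_∸ L) (solve y (d * L) L) ⟩
    y + (L + d * L) ∸ L   ≤⟨ ∸-monoˡ-≤ L le ⟩
    x ∸ L                 ∎))
    where
    open ≤-Reasoning
    solve : ∀ a b c → a + b + c ≡ a + (c + b)
    solve = solve-∀

  fall-positive : ∀ d x → d * L < x → 0 < fall L d x
  fall-positive d x dL<x = ≤-trans (≤-reflexive (sym (^-zeroˡ d))) (^≤fall d x 1 dL<x)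

  -- Factor by factor. The hypothesis survives the shift by `L` because `B ≤ A` makes `A * L` at
  -- least `B * L`.
  fall-scale : ∀ d {A B x y} → B ≤ A → A * x ≤ B * y → A ^ℕ d * fall L d x ≤ B ^ℕ d * fall L d y
  fall-scale zero    B≤A Ax≤By = ≤-refl
  fall-scale (suc d) {A} {B} {x} {y} B≤A Ax≤By = begin
    A * A ^ℕ d * (x * fall L d (x ∸ L))    ≡⟨ solve A (A ^ℕ d) x _ ⟩
    (A * x) * (A ^ℕ d * fall L d (x ∸ L))  ≤⟨ *-mono-≤ Ax≤By (fall-scale d B≤A shifted) ⟩
    (B * y) * (B ^ℕ d * fall L d (y ∸ L))  ≡⟨ solve B (B ^ℕ d) y _ ⟨
    B * B ^ℕ d * (y * fall L d (y ∸ L))    ∎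
    where
    open ≤-Reasoning
    solve : ∀ a b c e → a * b * (c * e) ≡ (a * c) * (b * e)
    solve = solve-∀
    shifted : A * (x ∸ L) ≤ B * (y ∸ L)
    shifted = begin
      A * (x ∸ L)   ≡⟨ *-distribˡ-∸ A x L ⟩
      A * x ∸ A * L ≤⟨ ∸-mono Ax≤By (*-monoˡ-≤ L B≤A) ⟩
      B * y ∸ B * L ≡⟨ *-distribˡ-∸ B y L ⟨
      B * (y ∸ L)   ∎

  -- Interpolates between x ∸ L and x; for x < L both sides vanish.
  fall-chord : ∀ d x a → a ≤ L →
    L * fall L (2 + d) (x ∸ a) ≤ a * fall L (2 + d) (x ∸ L) + (L ∸ a) * fall L (2 + d) x
  fall-chord d x a a≤L with ≤-total L x
  ... | inj₂ x≤L = ≤-trans (≤-reflexive (trans (cong (L *_) zero′) (*-zeroʳ L))) z≤n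
    where
    zero′ : fall L (2 + d) (x ∸ a) ≡ 0
    zero′ = trans (cong (λ t → (x ∸ a) * (t * fall L d (t ∸ L))) (m≤n⇒m∸n≡0 (≤-trans (m∸n≤m x a) x≤L))) (*-zeroʳ (x ∸ a))
  ... | inj₁ L≤x with m≤n⇒∃[o]m+o≡n L≤x | m≤n⇒∃[o]m+o≡n a≤L
  ... | y , refl | b , refl = begin
    (a + b) * f (a + b + y ∸ a)                          ≡⟨ cong (λ t → (a + b) * f t) (trans (cong (_∸ a) (solve₁ y b a)) (m+n∸m≡n a (y + b))) ⟩
    (a + b) * f (y + b)                                  ≤⟨ chord {f} (fall-convex (2 + d)) y b a ⟩
    a * f y + b * f (y + b + a)                          ≡⟨ cong₂ (λ s t → a * f s + b * f t) (sym (m+n∸m≡n (a + b) y)) (solve₂ y b a) ⟩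
    a * f (a + b + y ∸ (a + b)) + b * f (a + b + y)      ≡⟨ cong (λ t → a * f (a + b + y ∸ (a + b)) + t * f (a + b + y)) (m+n∸m≡n a b) ⟨
    a * f (a + b + y ∸ (a + b)) + (a + b ∸ a) * f (a + b + y) ∎
    where
    open ≤-Reasoning
    f = fall L (2 + d)
    solve₁ : ∀ y b a → a + b + y ≡ a + (y + b)
    solve₁ = solve-∀
    solve₂ : ∀ y b a → y + b + a ≡ a + b + y
    solve₂ = solve-∀

  -- x of r equally likely events lower x by L.
  fall-drift : ∀ d x r → x ≤ r →
    x * fall L (1 + d) (x ∸ L) + (r ∸ x) * fall L (1 + d) x ≤ (r ∸ d * L) * fall L (1 + d) x
  fall-drift d x r x≤r with ≤-total x (d * L)
  ... | inj₁ x≤dL = ≤-reflexive (begin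
    x * fall L (1 + d) (x ∸ L) + (r ∸ x) * fall L (1 + d) x
      ≡⟨ cong₂ (λ s t → x * s + (r ∸ x) * t) (fall-vanishes d (x ∸ L) (≤-trans (m∸n≤m x L) x≤dL)) (fall-vanishes d x x≤dL) ⟩
    x * 0 + (r ∸ x) * 0            ≡⟨ cong₂ _+_ (*-zeroʳ x) (*-zeroʳ (r ∸ x)) ⟩
    0                              ≡⟨ *-zeroʳ (r ∸ d * L) ⟨
    (r ∸ d * L) * 0                ≡⟨ cong ((r ∸ d * L) *_) (fall-vanishes d x x≤dL) ⟨
    (r ∸ d * L) * fall L (1 + d) x ∎)
    where open ≡-Reasoning
  ... | inj₂ dL≤x = begin
    x * fall L (1 + d) (x ∸ L) + (r ∸ x) * p   ≡⟨ cong (_+ (r ∸ x) * p) (fall-last (1 + d) x) ⟩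
    -- The rate `r ∸ (1 + d) * L` would be exact without truncation, but fails for `x` strictly
    -- between `d * L` and `(1 + d) * L`. Giving up one `L` covers that range.
    p * (x ∸ (1 + d) * L) + (r ∸ x) * p        ≤⟨ +-monoˡ-≤ _ (*-monoʳ-≤ p (∸-monoʳ-≤ x (m≤n+m (d * L) L))) ⟩
    p * (x ∸ d * L) + (r ∸ x) * p              ≡⟨ solve p (x ∸ d * L) (r ∸ x) ⟩
    ((r ∸ x) + (x ∸ d * L)) * p                ≡⟨ cong (_* p) (sym (+-∸-assoc (r ∸ x) dL≤x)) ⟩
    ((r ∸ x) + x ∸ d * L) * p                  ≡⟨ cong (λ t → (t ∸ d * L) * p) (m∸n+n≡m x≤r) ⟩
    (r ∸ d * L) * p                            ∎
    where
    open ≤-Reasoning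
    p = fall L (1 + d) x
    solve : ∀ p a b → p * a + b * p ≡ (b + a) * p
    solve = solve-∀

-- Exponential growth

-- Bernoulli's inequality `(1 + 1/a) ^ m ≥ 1 + m/a`, multiplied by `a ^ m * a`.
bernoulli : ∀ a m → a ^ℕ m * (a + m) ≤ suc a ^ℕ m * a
bernoulli a zero    = ≤-reflexive (cong (1 *_) (+-identityʳ a))
bernoulli a (suc m) = begin
  a * a ^ℕ m * (a + suc m)                  ≤⟨ m≤m+n _ (a ^ℕ m * m) ⟩
  a * a ^ℕ m * (a + suc m) + a ^ℕ m * m      ≡⟨ solve a (a ^ℕ m) m ⟩
  suc a * (a ^ℕ m * (a + m))                ≤⟨ *-monoʳ-≤ (suc a) (bernoulli a m) ⟩
  suc a * (suc a ^ℕ m * a)                  ≡⟨ *-assoc (suc a) (suc a ^ℕ m) a ⟨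
  suc a * suc a ^ℕ m * a                    ∎
  where
  open ≤-Reasoning
  solve : ∀ a p m → a * p * (a + suc m) + p * m ≡ suc a * (p * (a + m))
  solve = solve-∀

^-distrib-* : ∀ a b s → (a * b) ^ℕ s ≡ a ^ℕ s * b ^ℕ s
^-distrib-* a b zero    = refl
^-distrib-* a b (suc s) = trans (cong (a * b *_) (^-distrib-* a b s)) (solve a b (a ^ℕ s) (b ^ℕ s))
  where
  solve : ∀ a b c d → a * b * (c * d) ≡ a * c * (b * d)
  solve = solve-∀

-- By `bernoulli` with exponent `a`, `(1 + 1/a) ^ a ≥ 2`; this is raised to the power `s`. It turns
-- a constant gap into an exponential one, for the gadgets and for the covering alike.
doubling : ∀ a s → .{{_ : NonZero a}} → 2 ^ℕ s * a ^ℕ (a * s) ≤ suc a ^ℕ (a * s)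
doubling a s = begin
  2 ^ℕ s * a ^ℕ (a * s)    ≡⟨ cong (2 ^ℕ s *_) (^-*-assoc a a s) ⟨
  2 ^ℕ s * (a ^ℕ a) ^ℕ s    ≡⟨ ^-distrib-* 2 (a ^ℕ a) s ⟨
  (2 * a ^ℕ a) ^ℕ s        ≤⟨ ^-monoˡ-≤ s step ⟩
  (suc a ^ℕ a) ^ℕ s        ≡⟨ ^-*-assoc (suc a) a s ⟩
  suc a ^ℕ (a * s)        ∎
  where
  open ≤-Reasoning
  solve : ∀ p a → 2 * p * a ≡ p * (a + a)
  solve = solve-∀
  step : 2 * a ^ℕ a ≤ suc a ^ℕ a
  step = *-cancelʳ-≤ _ _ a (≤-trans (≤-reflexive (solve (a ^ℕ a) a)) (bernoulli a a))

n<2^n : ∀ n → n < 2 ^ℕ n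
n<2^n zero    = ≤-refl
n<2^n (suc n) = begin-strict
  suc n            ≤⟨ n<2^n n ⟩
  2 ^ℕ n            <⟨ m<m+n (2 ^ℕ n) (≤-<-trans z≤n (n<2^n n)) ⟩
  2 ^ℕ n + 2 ^ℕ n    ≡⟨ cong (2 ^ℕ n +_) (+-identityʳ (2 ^ℕ n)) ⟨
  2 * 2 ^ℕ n        ∎
  where open ≤-Reasoning

-- With `y = c + (c * c + x)`, apply `n<2^n` to both summands: the product of the bounds exceeds the
-- left side by `suc x`.
linear≤2^ : ∀ c y → c + c * c ≤ y → c * suc y ≤ 2 ^ℕ y
linear≤2^ c y le with m≤n⇒∃[o]m+o≡n le
... | x , refl = begin
  c * suc (c + c * c + x)        ≤⟨ m≤m+n _ (suc x) ⟩
  c * suc (c + c * c + x) + suc x ≡⟨ solve c x ⟩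
  suc c * suc (c * c + x)        ≤⟨ *-mono-≤ (n<2^n c) (n<2^n (c * c + x)) ⟩
  2 ^ℕ c * 2 ^ℕ (c * c + x)        ≡⟨ ^-distribˡ-+-* 2 c (c * c + x) ⟨
  2 ^ℕ (c + (c * c + x))          ≡⟨ cong (2 ^ℕ_) (+-assoc c (c * c) x) ⟨
  2 ^ℕ (c + c * c + x)            ∎
  where
  open ≤-Reasoning
  solve : ∀ c x → c * suc (c + c * c + x) + suc x ≡ suc c * suc (c * c + x)
  solve = solve-∀

-- With `y = z / e` one has `suc z ≤ e * suc y`, so it suffices that `K * e * suc y ≤ 2 ^ y`: the
-- `e`th power of this is at most `2 ^ (y * e) ≤ 2 ^ z`.
polynomial≤2^ : ∀ K e → .{{_ : NonZero e}} → ∃ λ z₀ → ∀ z → z₀ ≤ z → (K * suc z) ^ℕ e ≤ 2 ^ℕ z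
polynomial≤2^ K e = (c + c * c) * e , λ z z₀≤z →
  let y = z / e
      z<e[1+y] : suc z ≤ e * suc y
      z<e[1+y] = begin
        suc z                  ≡⟨ cong suc (m≡m%n+[m/n]*n z e) ⟩
        suc (z % e) + y * e    ≤⟨ +-monoˡ-≤ (y * e) (m%n<n z e) ⟩
        suc y * e              ≡⟨ *-comm (suc y) e ⟩
        e * suc y              ∎
      c≤y : c + c * c ≤ y
      c≤y = subst (_≤ y) (m*n/n≡m (c + c * c) e) (/-mono-≤ z₀≤z ≤-refl)
  in begin
    (K * suc z) ^ℕ e            ≤⟨ ^-monoˡ-≤ e (*-monoʳ-≤ K z<e[1+y]) ⟩
    (K * (e * suc y)) ^ℕ e      ≡⟨ cong (_^ℕ e) (*-assoc K e (suc y)) ⟨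
    (c * suc y) ^ℕ e            ≤⟨ ^-monoˡ-≤ e (linear≤2^ c y c≤y) ⟩
    (2 ^ℕ y) ^ℕ e                ≡⟨ ^-*-assoc 2 y e ⟩
    2 ^ℕ (y * e)                ≤⟨ ^-monoʳ-≤ 2 (m/n*n≤m z e) ⟩
    2 ^ℕ z                      ∎
  where
  open ≤-Reasoning
  c = K * e

-- Perfect matchings and arrays of partial embeddings

count-permute : ∀ {n} (R P : Fin n → Bool) (π : Permutation n n) → (∀ i → R (π ⟨$⟩ʳ i) ≡ R i) →
                count (R ∩ λ i → P (π ⟨$⟩ʳ i)) ≡ count (R ∩ P)
count-permute R P π R∘π = trans
  (sum-cong-≗ (λ i → cong (λ b → 𝟙 (b ∧ P (π ⟨$⟩ʳ i))) (sym (R∘π i))))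
  (sym (sum-permute (𝟙 ∘ (R ∩ P)) π))

module _ {n} (R : Fin n → Bool) (adj : Fin n → Fin n → Bool)
  (rows : ∀ i → R i ≡ true → 2 * count (R ∩ λ v → not (adj i v)) ≤ count R)
  (cols : ∀ v → R v ≡ true → 2 * count (R ∩ λ i → not (adj i v)) ≤ count R) where

  private
    Preserving : Permutation n n → Set
    Preserving π = ∀ i → R (π ⟨$⟩ʳ i) ≡ R i

    bad : Permutation n n → Fin n → Bool
    bad π = R ∩ λ i → not (adj i (π ⟨$⟩ʳ i))

  -- The rows j for which adj i (π j) fails and those for which adj j (π i) fails
  -- make up at most half of R each, and both contain i.
  switch : ∀ π → Preserving π → ∀ i → bad π i ≡ true →
           ∃ λ j → R j ≡ true × adj i (π ⟨$⟩ʳ j) ≡ true × adj j (π ⟨$⟩ʳ i) ≡ true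
  switch π pres i bi
    with Fin.any? (λ j → (R j Bool.≟ true) ×-dec ((adj i (π ⟨$⟩ʳ j) Bool.≟ true) ×-dec (adj j (π ⟨$⟩ʳ i) Bool.≟ true)))
  ... | yes found = found
  ... | no none = ⊥-elim (<-irrefl refl (begin-strict
    2 * count R                  <⟨ *-monoʳ-< 2 (sum-mono-< termwise i strictly) ⟩
    2 * sum (λ j → f j + g j)    ≡⟨ cong (2 *_) (∑-distrib-+ f g) ⟩
    2 * (sum f + sum g)          ≡⟨ *-distribˡ-+ 2 (sum f) (sum g) ⟩
    2 * sum f + 2 * sum g        ≤⟨ +-mono-≤ f≤ (cols (π ⟨$⟩ʳ i) (trans (pres i) Ri)) ⟩
    count R + count R            ≡⟨ cong (count R +_) (+-identityʳ (count R)) ⟨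
    2 * count R                  ∎))
    where
    open ≤-Reasoning
    f g : Fin n → ℕ
    f j = 𝟙 (R j ∧ not (adj i (π ⟨$⟩ʳ j)))
    g j = 𝟙 (R j ∧ not (adj j (π ⟨$⟩ʳ i)))
    Ri : R i ≡ true
    Ri = ∧-conicalˡ (R i) _ bi
    f≤ : 2 * sum f ≤ count R
    f≤ = subst (λ c → 2 * c ≤ count R) (sym (count-permute R (λ v → not (adj i v)) π pres)) (rows i Ri)
    termwise : ∀ j → 𝟙 (R j) ≤ f j + g j
    termwise j with R j in Rj | adj i (π ⟨$⟩ʳ j) in e₁ | adj j (π ⟨$⟩ʳ i) in e₂
    ... | false | _     | _     = z≤n
    ... | true  | false | _     = s≤s z≤n
    ... | true  | true  | false = ≤-refl
    ... | true  | true  | true  = ⊥-elim (none (j , Rj , e₁ , e₂))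
    strictly : 𝟙 (R i) < f i + g i
    strictly rewrite bi = s≤s (𝟙≤1 (R i))

  -- Exchanging the values of `π` at `i` and `j` repairs row `i`, leaves row `j` good and touches no
  -- other row.
  improve : ∀ π → Preserving π → ∀ i → bad π i ≡ true →
            ∃ λ π′ → Preserving π′ × count (bad π′) < count (bad π)
  improve π pres i bi with switch π pres i bi
  ... | j , Rj , aij , aji = transpose i j ∘ₚ π , pres′ , sum-mono-< termwise i strictly
    where
    Ri : R i ≡ true
    Ri = ∧-conicalˡ (R i) _ bi
    pres′ : Preserving (transpose i j ∘ₚ π)
    pres′ k with k Fin.≟ i
    ... | yes refl = trans (pres j) (trans Rj (sym Ri))
    ... | no  _ with k Fin.≟ j
    ...   | yes refl = trans (pres i) (trans Ri (sym Rj))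
    ...   | no  _    = pres k
    termwise : ∀ k → 𝟙 (bad (transpose i j ∘ₚ π) k) ≤ 𝟙 (bad π k)
    termwise k with k Fin.≟ i
    ... | yes refl rewrite Ri | aij = z≤n
    ... | no  _ with k Fin.≟ j
    ...   | yes refl rewrite Rj | aji = z≤n
    ...   | no  _    = ≤-refl
    strictly : 𝟙 (bad (transpose i j ∘ₚ π) i) < 𝟙 (bad π i)
    strictly with i Fin.≟ i
    ... | no i≢i   = contradiction refl i≢i
    ... | yes refl rewrite bi | Ri | aij = s≤s z≤n

  perfect-matching : ∃ λ (π : Permutation n n) → (∀ i → R (π ⟨$⟩ʳ i) ≡ R i) ×
                     (∀ i → R i ≡ true → adj i (π ⟨$⟩ʳ i) ≡ true)
  perfect-matching = go (count (bad Perm.id)) Perm.id (λ _ → refl) ≤-refl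
    where
    go : ∀ b π → Preserving π → count (bad π) ≤ b →
         ∃ λ (π : Permutation n n) → Preserving π × (∀ i → R i ≡ true → adj i (π ⟨$⟩ʳ i) ≡ true)
    go b π pres le with Fin.any? (λ i → bad π i Bool.≟ true)
    go b π pres le | no none = π , pres , λ i Ri → good i Ri
      where
      good : ∀ i → R i ≡ true → adj i (π ⟨$⟩ʳ i) ≡ true
      good i Ri with adj i (π ⟨$⟩ʳ i) in e
      ... | true  = refl
      ... | false = ⊥-elim (none (i , cong₂ _∧_ Ri (cong not e)))
    go b π pres le | yes (i , bi) with improve π pres i bi
    go zero    π pres le | yes (i , bi) | π′ , pres′ , lt = contradiction (<-≤-trans lt le) λ ()
    go (suc b) π pres le | yes (i , bi) | π′ , pres′ , lt = go b π′ pres′ (s≤s⁻¹ (<-≤-trans lt le))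

infixl 5 _[_≔_]
_[_≔_] : {A : Set} → (ℕ → A) → ℕ → A → ℕ → A
(f [ p ≔ v ]) x with x ≟ p
... | yes _ = v
... | no  _ = f x

module _ {A : Set} (f : ℕ → A) where

  [≔]-same : ∀ p v → (f [ p ≔ v ]) p ≡ v
  [≔]-same p v with p ≟ p
  ... | yes _  = refl
  ... | no p≢p = contradiction refl p≢p

  [≔]-other : ∀ p v {x} → x ≢ p → (f [ p ≔ v ]) x ≡ f x
  [≔]-other p v {x} x≢p with x ≟ p
  ... | yes x≡p = contradiction x≡p x≢p
  ... | no  _   = refl

module _ {n} (R : Fin n → Bool) (comp : ℕ → ℕ → Fin n → Fin n → Bool) (β : ℕ → ℕ → ℕ) where

  -- Since column a is a permutation of R, the number of rows in which v conflicts
  -- with column a is the number of vertices in R that conflict with v.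
  array : ∀ L →
    (∀ {a b} → a < b → b < L → ∀ u → count (R ∩ λ v → not (comp a b u v)) ≤ β a b) →
    (∀ {a b} → a < b → b < L → ∀ v → count (R ∩ λ u → not (comp a b u v)) ≤ β a b) →
    (∀ {b} → b < L → 2 * ∑< b (λ a → β a b) ≤ count R) →
    ∃ λ (σ : ℕ → Permutation n n) → (∀ a i → R (σ a ⟨$⟩ʳ i) ≡ R i) ×
      (∀ i → R i ≡ true → ∀ {a b} → a < b → b < L → comp a b (σ a ⟨$⟩ʳ i) (σ b ⟨$⟩ʳ i) ≡ true)
  array zero    _ _ _ = (λ _ → Perm.id) , (λ _ _ → refl) , λ _ _ _ ()
  array (suc L) right left half
    with array L (λ a<b b<L → right a<b (m<n⇒m<1+n b<L)) (λ a<b b<L → left a<b (m<n⇒m<1+n b<L)) (λ b<L → half (m<n⇒m<1+n b<L))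
  ... | σ , pres , compat = σ′ , pres′ , compat′
    where
    open ≤-Reasoning
    adj : Fin n → Fin n → Bool
    adj i v = all< L (λ a → comp a L (σ a ⟨$⟩ʳ i) v)
    degree-bound : ∀ {c} → c ≤ ∑< L (λ a → β a L) → 2 * c ≤ count R
    degree-bound c≤ = ≤-trans (*-monoʳ-≤ 2 c≤) (half ≤-refl)
    matching = perfect-matching R adj
      (λ i _ → degree-bound (≤-trans (union-bound R L (λ a v → comp a L (σ a ⟨$⟩ʳ i) v))
                 (∑<-mono L λ a a<L → right a<L ≤-refl (σ a ⟨$⟩ʳ i))))
      (λ v _ → degree-bound (≤-trans (union-bound R L (λ a i → comp a L (σ a ⟨$⟩ʳ i) v))
                 (∑<-mono L λ a a<L → subst (_≤ β a L) (sym (count-permute R (λ u → not (comp a L u v)) (σ a) (pres a)))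
                   (left a<L ≤-refl v))))
    π = proj₁ matching
    σ′ = σ [ L ≔ π ]
    pres′ : ∀ a i → R (σ′ a ⟨$⟩ʳ i) ≡ R i
    pres′ a i with a ≟ L
    ... | yes _ = proj₁ (proj₂ matching) i
    ... | no  _ = pres a i
    compat′ : ∀ i → R i ≡ true → ∀ {a b} → a < b → b < suc L → comp a b (σ′ a ⟨$⟩ʳ i) (σ′ b ⟨$⟩ʳ i) ≡ true
    compat′ i Ri {a} {b} a<b b<1+L with m≤n⇒m<n∨m≡n (s≤s⁻¹ b<1+L)
    ... | inj₁ b<L rewrite [≔]-other σ L π (<⇒≢ b<L) | [≔]-other σ L π (<⇒≢ (<-trans a<b b<L)) = compat i Ri a<b b<L
    ... | inj₂ refl rewrite [≔]-same σ L π | [≔]-other σ L π (<⇒≢ a<b) =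
      all<-elim L (proj₂ (proj₂ matching) i Ri) a a<b

-- Choosing by averaging

module _ {n} (R : Fin n → Bool) (L : ℕ) .{{_ : NonZero L}} (σ : ℕ → Permutation n n)
  (pres : ∀ a i → R (σ a ⟨$⟩ʳ i) ≡ R i) (d : ℕ) where

  private
    r = count R

  hits : (Fin n → Bool) → Fin n → ℕ
  hits W i = ∑< L (λ a → 𝟙 (W (σ a ⟨$⟩ʳ i)))

  hits≤L : ∀ W i → hits W i ≤ L
  hits≤L W i = ≤-trans (∑<-mono L (λ a _ → 𝟙≤1 (W (σ a ⟨$⟩ʳ i)))) (≤-reflexive (trans (∑<-const L 1) (*-identityʳ L)))

  -- Every column `σ a` permutes `R`, hence meets `W` in exactly `count (R ∩ W)` of the rows.
  sum-hits : ∀ W → sum (λ i → 𝟙 (R i) * hits W i) ≡ L * count (R ∩ W)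
  sum-hits W = begin
    sum (λ i → 𝟙 (R i) * hits W i)                              ≡⟨ sum-cong-≗ (λ i → distrib L (𝟙 (R i)) _) ⟩
    sum (λ i → ∑< L (λ a → 𝟙 (R i) * 𝟙 (W (σ a ⟨$⟩ʳ i))))       ≡⟨ sum-∑< L (λ i a → 𝟙 (R i) * 𝟙 (W (σ a ⟨$⟩ʳ i))) ⟩
    ∑< L (λ a → sum (λ i → 𝟙 (R i) * 𝟙 (W (σ a ⟨$⟩ʳ i))))
      ≡⟨ ∑<-cong L (λ a _ → trans (sum-cong-≗ (λ i → sym (𝟙-∧ (R i) _))) (count-permute R W (σ a) (pres a))) ⟩
    ∑< L (λ _ → count (R ∩ W))                                  ≡⟨ ∑<-const L _ ⟩
    L * count (R ∩ W)                                           ∎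
    where
    open ≡-Reasoning
    distrib : ∀ m c (f : ℕ → ℕ) → c * ∑< m f ≡ ∑< m (λ a → c * f a)
    distrib zero    c f = *-zeroʳ c
    distrib (suc m) c f = trans (*-distribˡ-+ c (∑< m f) (f m)) (cong (_+ c * f m) (distrib m c f))

  sum-misses : ∀ W → sum (λ i → 𝟙 (R i) * (L ∸ hits W i)) ≡ L * (r ∸ count (R ∩ W))
  sum-misses W = +-cancelˡ-≡ (L * count (R ∩ W)) _ _ (begin
    L * count (R ∩ W) + sum (λ i → 𝟙 (R i) * (L ∸ hits W i))  ≡⟨ cong (_+ sum (λ i → 𝟙 (R i) * (L ∸ hits W i))) (sum-hits W) ⟨
    sum (λ i → 𝟙 (R i) * hits W i) + sum (λ i → 𝟙 (R i) * (L ∸ hits W i))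
      ≡⟨ ∑-distrib-+ (λ i → 𝟙 (R i) * hits W i) (λ i → 𝟙 (R i) * (L ∸ hits W i)) ⟨
    sum (λ i → 𝟙 (R i) * hits W i + 𝟙 (R i) * (L ∸ hits W i))
      ≡⟨ sum-cong-≗ (λ i → trans (sym (*-distribˡ-+ (𝟙 (R i)) _ _)) (cong (𝟙 (R i) *_) (m+[n∸m]≡n (hits≤L W i)))) ⟩
    sum (λ i → 𝟙 (R i) * L)                                   ≡⟨ *-distribʳ-sum L (𝟙 ∘ R) ⟨
    r * L                                                     ≡⟨ *-comm r L ⟩
    L * r                                                     ≡⟨ cong (L *_) (m+[n∸m]≡n count∩≤r) ⟨
    L * (count (R ∩ W) + (r ∸ count (R ∩ W)))                 ≡⟨ *-distribˡ-+ L (count (R ∩ W)) _ ⟩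
    L * count (R ∩ W) + L * (r ∸ count (R ∩ W))               ∎)
    where
    open ≡-Reasoning
    count∩≤r : count (R ∩ W) ≤ r
    count∩≤r = count-mono {n} {R ∩ W} {R} (λ i → ∧-conicalˡ (R i) (W i))

  -- The number of hits may be anything up to `L`, but by `fall-chord` the average is at most what
  -- it would be if each row were either contained in `W` or disjoint from it. The mean number of
  -- hits is `L * x / r`, so the first case would have probability `x / r`, as in `fall-drift`.
  average-fall : ∀ W → let x = count (R ∩ W) in
    sum (λ i → 𝟙 (R i) * fall L (2 + d) (x ∸ hits W i)) ≤ (r ∸ (1 + d) * L) * fall L (2 + d) x
  average-fall W = *-cancelˡ-≤ L (begin
    L * sum (λ i → 𝟙 (R i) * fall L (2 + d) (x ∸ hits W i))    ≡⟨ *-distribˡ-sum L (λ i → 𝟙 (R i) * fall L (2 + d) (x ∸ hits W i)) ⟩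
    sum (λ i → L * (𝟙 (R i) * fall L (2 + d) (x ∸ hits W i)))  ≤⟨ sum-mono termwise ⟩
    sum (λ i → 𝟙 (R i) * hits W i * A + 𝟙 (R i) * (L ∸ hits W i) * B)
      ≡⟨ ∑-distrib-+ (λ i → 𝟙 (R i) * hits W i * A) (λ i → 𝟙 (R i) * (L ∸ hits W i) * B) ⟩
    sum (λ i → 𝟙 (R i) * hits W i * A) + sum (λ i → 𝟙 (R i) * (L ∸ hits W i) * B)
      ≡⟨ cong₂ _+_ (*-distribʳ-sum A (λ i → 𝟙 (R i) * hits W i)) (*-distribʳ-sum B (λ i → 𝟙 (R i) * (L ∸ hits W i))) ⟨
    sum (λ i → 𝟙 (R i) * hits W i) * A + sum (λ i → 𝟙 (R i) * (L ∸ hits W i)) * B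
      ≡⟨ cong₂ (λ s t → s * A + t * B) (sum-hits W) (sum-misses W) ⟩
    L * x * A + L * (r ∸ x) * B                                ≡⟨ solve L x A (r ∸ x) B ⟩
    L * (x * A + (r ∸ x) * B)                                  ≤⟨ *-monoʳ-≤ L (fall-drift L (1 + d) x r x≤r) ⟩
    L * ((r ∸ (1 + d) * L) * B)                                ∎)
    where
    open ≤-Reasoning
    x = count (R ∩ W)
    A = fall L (2 + d) (x ∸ L)
    B = fall L (2 + d) x
    x≤r : x ≤ r
    x≤r = count-mono {n} {R ∩ W} {R} (λ i → ∧-conicalˡ (R i) (W i))
    solve : ∀ a b c e f → a * b * c + a * e * f ≡ a * (b * c + e * f)
    solve = solve-∀
    solve′ : ∀ a b c → a * (b * c) ≡ b * (a * c)
    solve′ = solve-∀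
    solve″ : ∀ a b c e f → a * (b * c + e * f) ≡ a * b * c + a * e * f
    solve″ = solve-∀
    termwise : ∀ i → L * (𝟙 (R i) * fall L (2 + d) (x ∸ hits W i)) ≤ 𝟙 (R i) * hits W i * A + 𝟙 (R i) * (L ∸ hits W i) * B
    termwise i = begin
      L * (𝟙 (R i) * fall L (2 + d) (x ∸ hits W i))  ≡⟨ solve′ L (𝟙 (R i)) _ ⟩
      𝟙 (R i) * (L * fall L (2 + d) (x ∸ hits W i))  ≤⟨ *-monoʳ-≤ (𝟙 (R i)) (fall-chord L d x (hits W i) (hits≤L W i)) ⟩
      𝟙 (R i) * (hits W i * A + (L ∸ hits W i) * B)  ≡⟨ solve″ (𝟙 (R i)) (hits W i) A (L ∸ hits W i) B ⟩
      𝟙 (R i) * hits W i * A + 𝟙 (R i) * (L ∸ hits W i) * B ∎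

  -- `average-fall` has the same factor for every `W t`, so the averages add up and a single row is
  -- good for the whole sum.
  choose-row : ∀ {N} (W : Fin N → Fin n → Bool) → 0 < r → ∃ λ i → R i ≡ true ×
    r * sum (λ t → fall L (2 + d) (count (R ∩ W t) ∸ hits (W t) i)) ≤
    (r ∸ (1 + d) * L) * sum (λ t → fall L (2 + d) (count (R ∩ W t)))
  choose-row W r>0 = average-≤ R (λ i → r * sum (Φ i)) r>0 (begin
    sum (λ i → 𝟙 (R i) * (r * sum (Φ i)))       ≡⟨ sum-cong-≗ (λ i → solve (𝟙 (R i)) r (sum (Φ i))) ⟩
    sum (λ i → r * (𝟙 (R i) * sum (Φ i)))       ≡⟨ *-distribˡ-sum r (λ i → 𝟙 (R i) * sum (Φ i)) ⟨
    r * sum (λ i → 𝟙 (R i) * sum (Φ i))         ≡⟨ cong (r *_) (sum-cong-≗ (λ i → *-distribˡ-sum (𝟙 (R i)) (Φ i))) ⟩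
    r * sum (λ i → sum (λ t → 𝟙 (R i) * Φ i t)) ≡⟨ cong (r *_) (∑-comm (λ i t → 𝟙 (R i) * Φ i t)) ⟩
    r * sum (λ t → sum (λ i → 𝟙 (R i) * Φ i t)) ≤⟨ *-monoʳ-≤ r (sum-mono (λ t → average-fall (W t))) ⟩
    r * sum (λ t → (r ∸ (1 + d) * L) * fall L (2 + d) (count (R ∩ W t)))
      ≡⟨ cong (r *_) (*-distribˡ-sum (r ∸ (1 + d) * L) (λ t → fall L (2 + d) (count (R ∩ W t)))) ⟨
    r * ((r ∸ (1 + d) * L) * sum (λ t → fall L (2 + d) (count (R ∩ W t)))) ∎)
    where
    open ≤-Reasoning
    Φ : Fin n → _ → ℕ
    Φ i t = fall L (2 + d) (count (R ∩ W t) ∸ hits (W t) i)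
    solve : ∀ a b c → a * (b * c) ≡ b * (a * c)
    solve = solve-∀

-- Double counting of pairs of a test and a valid vertex that is good for it. The average runs over
-- all `n` vertices, invalid ones counting 0; since the total weight is positive, the vertex found
-- has positive value and is therefore valid.
choose-vertex : ∀ {N n} E (wt : Fin N → ℕ) (valid : Fin n → Bool) (good : Fin N → Fin n → Bool) →
  0 < n → (∀ t → n ≤ E * count (valid ∩ good t)) → 0 < sum wt →
  ∃ λ x → valid x ≡ true × sum wt ≤ E * sum (λ t → wt t * 𝟙 (good t x))
choose-vertex {N} {n} E wt valid good n>0 many wt>0 = x , valid-x (valid x) refl , S≤
  where
  open ≤-Reasoning
  G F : Fin n → ℕ
  G x = sum (λ t → wt t * 𝟙 (good t x))
  F x = 𝟙 (valid x) * G x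
  swapped : sum F ≡ sum (λ t → wt t * count (valid ∩ good t))
  swapped = trans (sum-cong-≗ (λ x → *-distribˡ-sum (𝟙 (valid x)) (λ t → wt t * 𝟙 (good t x))))
    (trans (∑-comm (λ x t → 𝟙 (valid x) * (wt t * 𝟙 (good t x))))
    (sum-cong-≗ λ t → trans (sum-cong-≗ λ x → trans (solve (𝟙 (valid x)) (wt t) _) (cong (wt t *_) (sym (𝟙-∧ (valid x) (good t x)))))
      (sym (*-distribˡ-sum (wt t) (𝟙 ∘ (valid ∩ good t))))))
    where
    solve : ∀ a b c → a * (b * c) ≡ b * (a * c)
    solve = solve-∀
  large : n * sum wt ≤ E * sum F
  large = begin
    n * sum wt                                               ≡⟨ *-distribˡ-sum n wt ⟩
    sum (λ t → n * wt t)                                     ≤⟨ sum-mono (λ t → ≤-trans (*-monoˡ-≤ (wt t) (many t))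
                                                                               (≤-reflexive (solve E _ (wt t)))) ⟩
    sum (λ t → E * (wt t * count (valid ∩ good t)))          ≡⟨ *-distribˡ-sum E (λ t → wt t * count (valid ∩ good t)) ⟨
    E * sum (λ t → wt t * count (valid ∩ good t))            ≡⟨ cong (E *_) swapped ⟨
    E * sum F                                                ∎
    where
    solve : ∀ a b c → a * b * c ≡ a * (c * b)
    solve = solve-∀
  x = proj₁ (average-≥ F n>0)
  S≤EF : sum wt ≤ E * F x
  S≤EF = *-cancelˡ-≤ n {{>-nonZero n>0}} (begin
    n * sum wt     ≤⟨ large ⟩
    E * sum F      ≤⟨ *-monoʳ-≤ E (proj₂ (average-≥ F n>0)) ⟩
    E * (n * F x)  ≡⟨ solve E n (F x) ⟩
    n * (E * F x)  ∎)
    where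
    solve : ∀ a b c → a * (b * c) ≡ b * (a * c)
    solve = solve-∀
  valid-x : ∀ b → valid x ≡ b → valid x ≡ true
  valid-x true  e = e
  valid-x false e = contradiction (<-≤-trans wt>0 S≤EF)
    (≤⇒≯ (≤-reflexive (trans (cong (λ b → E * (𝟙 b * G x)) e) (*-zeroʳ E))))
  S≤ : sum wt ≤ E * G x
  S≤ = ≤-trans S≤EF (*-monoʳ-≤ E (≤-trans (*-monoˡ-≤ (G x) (𝟙≤1 (valid x))) (≤-reflexive (*-identityˡ (G x)))))

-- Partial embeddings

infixl 6 _∖_
_∖_ : ∀ {n} → (Fin n → Bool) → Fin n → Fin n → Bool
(R ∖ v) u = R u ∧ not (does (u Fin.≟ v))

module _ {n} (R : Fin n → Bool) (v : Fin n) where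

  ∖-other : ∀ {u} → u ≢ v → (R ∖ v) u ≡ R u
  ∖-other {u} u≢v rewrite dec-false (u Fin.≟ v) u≢v with R u
  ... | true  = refl
  ... | false = refl

  ∖-same : (R ∖ v) v ≡ false
  ∖-same rewrite dec-true (v Fin.≟ v) refl with R v
  ... | true  = refl
  ... | false = refl

  ∖-⊆ : ∀ {u} → R u ≡ false → (R ∖ v) u ≡ false
  ∖-⊆ Ru rewrite Ru = refl

  count-∖ : R v ≡ true → ∀ W → count ((R ∖ v) ∩ W) + 𝟙 (W v) ≡ count (R ∩ W)
  count-∖ Rv W = begin
    count ((R ∖ v) ∩ W) + 𝟙 (W v)             ≡⟨ cong (λ b → count ((R ∖ v) ∩ W) + 𝟙 (b ∧ W v)) Rv ⟨
    count ((R ∖ v) ∩ W) + 𝟙 (R v ∧ W v)       ≡⟨ sum-differ (𝟙 ∘ ((R ∖ v) ∩ W)) (𝟙 ∘ (R ∩ W)) v (λ u u≢v → cong (λ b → 𝟙 (b ∧ W u)) (∖-other u≢v)) ⟩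
    count (R ∩ W) + 𝟙 ((R ∖ v) v ∧ W v)       ≡⟨ cong (λ b → count (R ∩ W) + 𝟙 (b ∧ W v)) ∖-same ⟩
    count (R ∩ W) + 0                         ≡⟨ +-identityʳ _ ⟩
    count (R ∩ W)                             ∎
    where open ≡-Reasoning

count-differ : ∀ {n} {P Q : Fin n → Bool} v → P v ≡ false → Q v ≡ true → (∀ u → u ≢ v → P u ≡ Q u) →
               suc (count P) ≡ count Q
count-differ {n} {P} {Q} v Pv Qv same = begin
  suc (count P)       ≡⟨ +-comm 1 (count P) ⟩
  count P + 1         ≡⟨ cong (λ b → count P + 𝟙 b) Qv ⟨
  count P + 𝟙 (Q v)   ≡⟨ sum-differ (𝟙 ∘ P) (𝟙 ∘ Q) v (λ u u≢v → cong 𝟙 (same u u≢v)) ⟩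
  count Q + 𝟙 (P v)   ≡⟨ cong (λ b → count Q + 𝟙 b) Pv ⟩
  count Q + 0         ≡⟨ +-identityʳ _ ⟩
  count Q             ∎
  where open ≡-Reasoning

-- The offsets, within a block of 2k + 1 positions, of the positions other than
-- the centre.
skip : ℕ → ℕ → ℕ
skip k s with s <? k
... | yes _ = s
... | no  _ = suc s

skip-< : ∀ {k s} → s < k → skip k s ≡ s
skip-< {k} {s} s<k with s <? k
... | yes _  = refl
... | no s≮k = contradiction s<k s≮k

skip-≥ : ∀ {k s} → k ≤ s → skip k s ≡ suc s
skip-≥ {k} {s} k≤s with s <? k
... | yes s<k = contradiction s<k (≤⇒≯ k≤s)
... | no  _   = refl

skip-surjective : ∀ {k c} → c ≢ k → c ≤ 2 * k → ∃ λ s → s < 2 * k × skip k s ≡ c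
skip-surjective {k} {c} c≢k c≤2k with <-cmp c k
... | tri< c<k _ _ = c , <-≤-trans c<k (m≤m+n k _) , skip-< c<k
... | tri≈ _ c≡k _ = contradiction c≡k c≢k
skip-surjective {k} {suc c} c≢k c≤2k | tri> _ _ k<c = c , c≤2k , skip-≥ (s≤s⁻¹ k<c)

skip≢ : ∀ k s → skip k s ≢ k
skip≢ k s with s <? k
... | yes s<k = <⇒≢ s<k
... | no  s≮k = λ 1+s≡k → s≮k (≤-reflexive 1+s≡k)

skip-suc : ∀ {k s} → suc s ≢ k → skip k (suc s) ≡ suc (skip k s)
skip-suc {k} {s} 1+s≢k with s <? k
... | yes s<k = skip-< (≤∧≢⇒< s<k 1+s≢k)
... | no  s≮k = skip-≥ (m≤n⇒m≤1+n (≮⇒≥ s≮k))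

skip-<-suc : ∀ k s → skip k s < skip k (suc s)
skip-<-suc k s with suc s ≟ k
... | yes refl rewrite skip-≥ {suc s} ≤-refl | skip-< (n<1+n s) = m≤n⇒m≤1+n ≤-refl
... | no ne rewrite skip-suc ne = ≤-refl

skip-mono : ∀ k {s s′} → s < s′ → skip k s < skip k s′
skip-mono k {s} {suc s′} s<1+s′ with m≤n⇒m<n∨m≡n (s≤s⁻¹ s<1+s′)
... | inj₁ s<s′ = <-trans (skip-mono k s<s′) (skip-<-suc k s′)
... | inj₂ refl = skip-<-suc k s

-- ok x y u v says that u may be placed at x and v at y, as far as the edge xy
-- is concerned; nb x enumerates the 2k neighbours of x, from left to right
-- unless it wraps around.
record Pattern (n k X : ℕ) : Set where
  field
    ok       : ℕ → ℕ → Fin n → Fin n → Bool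
    ok-sym   : ∀ x y u v → ok x y u v ≡ ok y x v u
    ok-refl  : ∀ x u v → ok x x u v ≡ true
    missing  : ∀ x y u → count (λ v → not (ok x y u v)) ≤ X
    nb       : ℕ → ℕ → ℕ
    near     : ∀ {x y u v} → ok x y u v ≡ false → ∃ λ s → s < 2 * k × nb x s ≡ y
    nb-left  : ∀ {x s} → k ≤ x → x < n → s < k → nb x s ≡ x ∸ k + s
    nb-right : ∀ {x j} → j < k → x + suc j < n → nb x (k + j) ≡ x + suc j

module Core {n k X : ℕ} (𝒫 : Pattern n k X) where

  open Pattern 𝒫

  V : Set
  V = Fin n

  missing-on : ∀ R x y u → count (R ∩ λ v → not (ok x y u v)) ≤ X
  missing-on R x y u = ≤-trans (count-mono {n} {R ∩ λ v → not (ok x y u v)} (λ v → ∧-conicalʳ (R v) _)) (missing x y u)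

  missing-onˡ : ∀ R x y v → count (R ∩ λ u → not (ok x y u v)) ≤ X
  missing-onˡ R x y v = subst (_≤ X) (sum-cong-≗ (λ u → cong (λ b → 𝟙 (R u ∧ not b)) (ok-sym y x v u))) (missing-on R y x v)

  -- `F` marks the filled positions and `R` the free vertices; `φ` is arbitrary at empty positions.
  -- By `balance`, an empty position exists as long as a vertex is free, and every position is
  -- filled once none is.
  record Partial : Set where
    field
      φ       : ℕ → V
      F       : ℕ → Bool
      R       : V → Bool
      used    : ∀ {x} → F x ≡ true → R (φ x) ≡ false
      inj     : ∀ {x y} → F x ≡ true → F y ≡ true → φ x ≡ φ y → x ≡ y
      compat  : ∀ {x y} → F x ≡ true → F y ≡ true → ok x y (φ x) (φ y) ≡ true
      balance : count {n} (λ p → not (F (toℕ p))) ≡ count R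

  open Partial

  _⊑_ : Partial → Partial → Set
  S ⊑ S′ = ∀ y → F S y ≡ true → F S′ y ≡ true × φ S′ y ≡ φ S y

  ⊑-trans : ∀ {S₁ S₂ S₃} → S₁ ⊑ S₂ → S₂ ⊑ S₃ → S₁ ⊑ S₃
  ⊑-trans e₁ e₂ y Fy with e₁ y Fy
  ... | Fy′ , φ≡ with e₂ y Fy′
  ... | Fy″ , φ≡′ = Fy″ , trans φ≡′ φ≡

  empty : V → Partial
  empty v = record
    { φ = λ _ → v ; F = λ _ → false ; R = λ _ → true
    ; used = λ () ; inj = λ () ; compat = λ () ; balance = refl }

  filled-∖ : ∀ (F : ℕ → Bool) {p} → p < n → F p ≡ false →
             suc (count {n} (λ x → not ((F [ p ≔ true ]) (toℕ x)))) ≡ count {n} (λ x → not (F (toℕ x)))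
  filled-∖ F {p} p<n Fp = count-differ (fromℕ< p<n)
    (cong not (trans (cong (F [ p ≔ true ]) (Fin.toℕ-fromℕ< p<n)) ([≔]-same F p true)))
    (cong not (trans (cong F (Fin.toℕ-fromℕ< p<n)) Fp))
    (λ u u≢ → cong not ([≔]-other F p true (λ e → u≢ (Fin.toℕ-injective (trans e (sym (Fin.toℕ-fromℕ< p<n)))))))

  module _ (S : Partial) {p : ℕ} {v : V} (p<n : p < n) (Fp : F S p ≡ false) (Rv : R S v ≡ true)
    (fit : ∀ y → F S y ≡ true → ok p y v (φ S y) ≡ true) where

    private
      F′ = F S [ p ≔ true ]
      φ′ = φ S [ p ≔ v ]

      v-new : ∀ {x} → F S x ≡ true → φ S x ≢ v
      v-new Fx e = contradiction (trans (sym Rv) (trans (cong (R S) (sym e)) (used S Fx))) λ ()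

    extend : Partial
    extend = record
      { φ = φ′ ; F = F′ ; R = R S ∖ v
      ; used = λ {x} → used′ {x} ; inj = inj′ ; compat = compat′
      ; balance = suc-injective (trans (filled-∖ (F S) p<n Fp) (trans (balance S) (sym count-R))) }
      where
      count-R : suc (count (R S ∖ v)) ≡ count (R S)
      count-R = count-differ v (∖-same (R S) v) Rv (λ u → ∖-other (R S) v)
      used′ : ∀ {x} → F′ x ≡ true → (R S ∖ v) (φ′ x) ≡ false
      used′ {x} F′x with x ≟ p
      ... | yes refl = ∖-same (R S) v
      ... | no  x≢p  = ∖-⊆ (R S) v (used S F′x)
      inj′ : ∀ {x y} → F′ x ≡ true → F′ y ≡ true → φ′ x ≡ φ′ y → x ≡ y
      inj′ {x} {y} F′x F′y e with x ≟ p | y ≟ p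
      ... | yes refl | yes refl = refl
      ... | yes refl | no  _    = contradiction (sym e) (v-new F′y)
      ... | no  _    | yes refl = contradiction e (v-new F′x)
      ... | no  _    | no  _    = inj S F′x F′y e
      compat′ : ∀ {x y} → F′ x ≡ true → F′ y ≡ true → ok x y (φ′ x) (φ′ y) ≡ true
      compat′ {x} {y} F′x F′y with x ≟ p | y ≟ p
      ... | yes refl | yes refl = ok-refl x v v
      ... | yes refl | no  _    = fit y F′y
      ... | no  _    | yes refl = trans (ok-sym x y (φ S x) v) (fit x F′x)
      ... | no  _    | no  _    = compat S F′x F′y

    extend-⊑ : S ⊑ extend
    extend-⊑ y Fy with y ≟ p
    ... | yes refl = contradiction (trans (sym Fp) Fy) λ ()
    ... | no  _    = Fy , refl

    extend-at : F extend p ≡ true × φ extend p ≡ v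
    extend-at = [≔]-same (F S) p true , [≔]-same (φ S) p v

    extend-filled : ∀ {y} → F extend y ≡ true → y ≡ p ⊎ F S y ≡ true
    extend-filled {y} Fy with y ≟ p
    ... | yes y≡p = inj₁ y≡p
    ... | no  _   = inj₂ Fy

    extend-count : ∀ W → count (R extend ∩ W) + 𝟙 (W v) ≡ count (R S ∩ W)
    extend-count = count-∖ (R S) v Rv

    extend-size : suc (count (R extend)) ≡ count (R S)
    extend-size = count-differ v (∖-same (R S) v) Rv (λ u → ∖-other (R S) v)

  -- Tests: a vertex to be placed, a position to be filled, and the images of
  -- the neighbours of that position.

  tests : ℕ
  tests = n * (n * n ^ℕ (2 * k))

  -- The base `n` digits of an index; `v` is only the default beyond the `m` entries.
  tuple : V → ∀ m → Fin (n ^ℕ m) → ℕ → V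
  tuple v zero    t s       = v
  tuple v (suc m) t zero    = proj₁ (remQuot (n ^ℕ m) t)
  tuple v (suc m) t (suc s) = tuple v m (proj₂ (remQuot {n} (n ^ℕ m) t)) s

  tuple-surjective : ∀ v m (f : ℕ → V) → ∃ λ t → ∀ s → s < m → tuple v m t s ≡ f s
  tuple-surjective v zero    f = zero , λ s ()
  tuple-surjective v (suc m) f with tuple-surjective v m (f ∘ suc)
  ... | t , t≗f = combine (f 0) t , λ
    { zero    _    → cong proj₁ (Fin.remQuot-combine (f 0) t)
    ; (suc s) s<m → trans (cong (λ q → tuple v m (proj₂ q) s) (Fin.remQuot-combine (f 0) t)) (t≗f s (s≤s⁻¹ s<m)) }

  vertex : Fin tests → V
  vertex t = proj₁ (remQuot {n} (n * n ^ℕ (2 * k)) t)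

  position : Fin tests → ℕ
  position t = toℕ (proj₁ (remQuot {n} (n ^ℕ (2 * k)) (proj₂ (remQuot {n} (n * n ^ℕ (2 * k)) t))))

  images : Fin tests → ℕ → V
  images t = tuple (vertex t) (2 * k) (proj₂ (remQuot {n} (n ^ℕ (2 * k)) (proj₂ (remQuot {n} (n * n ^ℕ (2 * k)) t))))

  tests-surjective : ∀ v p (f : ℕ → V) → p < n →
    ∃ λ t → vertex t ≡ v × position t ≡ p × (∀ s → s < 2 * k → images t s ≡ f s)
  tests-surjective v p f p<n with tuple-surjective v (2 * k) f
  ... | t , t≗f = combine v (combine (fromℕ< p<n) t)
      , cong proj₁ e₁
      , trans (cong (λ q → toℕ (proj₁ (remQuot {n} (n ^ℕ (2 * k)) (proj₂ q)))) e₁)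
          (trans (cong (toℕ ∘ proj₁) e₂) (Fin.toℕ-fromℕ< p<n))
      , λ s s<2k → trans (cong (λ q → tuple (proj₁ q) (2 * k) (proj₂ (remQuot {n} (n ^ℕ (2 * k)) (proj₂ q))) s) e₁)
          (trans (cong (λ q → tuple v (2 * k) (proj₂ q) s) e₂) (t≗f s s<2k))
    where
    e₁ = Fin.remQuot-combine {n} v (combine (fromℕ< p<n) t)
    e₂ = Fin.remQuot-combine {n} (fromℕ< p<n) t

  fits : ℕ → (ℕ → V) → V → Bool
  fits p ψ x = all< (2 * k) λ s → ok p (nb p s) x (ψ s)

  -- By `near`, a position that is not among the `2 * k` neighbours imposes no constraint, so the
  -- finite conjunction controls every `y`.
  fits-compat : ∀ {p ψ x} → fits p ψ x ≡ true → ∀ (f : ℕ → V) → (∀ s → s < 2 * k → ψ s ≡ f (nb p s)) →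
                ∀ y → ok p y x (f y) ≡ true
  fits-compat {p} {ψ} {x} fit f ψ≗f y with ok p y x (f y) in e
  ... | true  = refl
  ... | false with near e
  ... | s , s<2k , refl = trans (sym e) (subst (λ u → ok p (nb p s) x u ≡ true) (ψ≗f s s<2k)
                            (all<-elim (2 * k) fit s s<2k))

-- Greedy construction of the absorbing gadgets

module Absorbers {n k X : ℕ} (𝒫 : Pattern n k X) (2≤k : 2 ≤ k) (0<n : 0 < n) (D : ℕ)
  (dense : D * (2 * k * X) + n ≤ D * n) (g : ℕ) (room : 2 * D * (g * suc (2 * k)) ≤ n) (gw<n : g * suc (2 * k) < n) where

  open Pattern 𝒫
  open Core 𝒫
  open Partial

  w : ℕ
  w = suc (2 * k)

  -- By `dense`, `2 * k` constraints exclude at most `(1 - 1/D) n` vertices, and by `room` at most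
  -- `n / 2D` are used. Hence `n / 2D` candidates remain.
  enough : ∀ c u → n ≤ c + 2 * k * X + u → u ≤ g * w → n ≤ 2 * D * c
  enough c u n≤ u≤ = +-cancelʳ-≤ (2 * (D * n) + n) _ _ (begin
    n + (2 * (D * n) + n)                       ≡⟨ solve₁ n D ⟩
    2 * D * n + 2 * n                           ≤⟨ +-monoˡ-≤ (2 * n) (*-monoʳ-≤ (2 * D) n≤) ⟩
    2 * D * (c + 2 * k * X + u) + 2 * n         ≡⟨ solve₂ D c (2 * k * X) u n ⟩
    2 * D * c + (2 * D * u + 2 * (D * (2 * k * X) + n))
      ≤⟨ +-monoʳ-≤ (2 * D * c) (+-mono-≤ (≤-trans (*-monoʳ-≤ (2 * D) u≤) room) (*-monoʳ-≤ 2 dense)) ⟩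
    2 * D * c + (n + 2 * (D * n))               ≡⟨ cong (2 * D * c +_) (+-comm n _) ⟩
    2 * D * c + (2 * (D * n) + n)               ∎)
    where
    open ≤-Reasoning
    solve₁ : ∀ n D → n + (2 * (D * n) + n) ≡ 2 * D * n + 2 * n
    solve₁ = solve-∀
    solve₂ : ∀ D c A u n → 2 * D * (c + A + u) + 2 * n ≡ 2 * D * c + (2 * D * u + 2 * (D * A + n))
    solve₂ = solve-∀

  record Step (S : Partial) (p : ℕ) (S′ : Partial) : Set where
    field
      extends : S ⊑ S′
      at      : F S′ p ≡ true
      filled  : ∀ {y} → F S′ y ≡ true → y ≡ p ⊎ F S y ≡ true
      size    : suc (count (R S′)) ≡ count (R S)

  valid : Partial → ℕ → V → Bool
  valid S p x = R S x ∧ all< (2 * k) λ s → not (F S (nb p s)) ∨ ok p (nb p s) x (φ S (nb p s))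

  place : ∀ {N} S p → p < n → F S p ≡ false → (wt : Fin N → ℕ) (good : Fin N → V → Bool) →
    (∀ t → n ≤ 2 * D * count (valid S p ∩ good t)) → 0 < sum wt →
    ∃ λ S′ → Step S p S′ × sum wt ≤ 2 * D * sum (λ t → wt t * 𝟙 (good t (φ S′ p)))
  place S p p<n Fp wt good many wt>0 with choose-vertex (2 * D) wt (valid S p) good 0<n many wt>0
  ... | x , valid-x , le = S′ , step , subst (λ u → sum wt ≤ 2 * D * sum (λ t → wt t * 𝟙 (good t u))) (sym (proj₂ at′)) le
    where
    Rx : R S x ≡ true
    Rx = ∧-conicalˡ (R S x) _ valid-x
    fit : ∀ y → F S y ≡ true → ok p y x (φ S y) ≡ true
    fit y Fy with ok p y x (φ S y) in e
    ... | true  = refl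
    ... | false with near e
    ... | s , s<2k , refl = trans (sym e) (subst (λ b → not b ∨ ok p (nb p s) x (φ S (nb p s)) ≡ true) Fy
                              (all<-elim (2 * k) (∧-conicalʳ (R S x) _ valid-x) s s<2k))
    S′ = extend S p<n Fp Rx fit
    at′ = extend-at S p<n Fp Rx fit
    step : Step S p S′
    step = record { extends = extend-⊑ S p<n Fp Rx fit ; at = proj₁ at′
                  ; filled = extend-filled S p<n Fp Rx fit ; size = extend-size S p<n Fp Rx fit }

  -- Some neighbour of p being empty, there is room for the additional
  -- constraint imposed by a vertex v that might be placed at q.
  many-neighbours : ∀ S p s* q v → s* < 2 * k → F S (nb p s*) ≡ false →
    ∀ u → count (R S) + u ≡ n → u ≤ g * w →
    n ≤ 2 * D * count (valid S p ∩ λ x → ok q p v x)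
  many-neighbours S p s* q v s*<2k F* u size u≤ = enough _ u (begin
    n                                          ≡⟨ size ⟨
    count (R S) + u                            ≤⟨ +-monoˡ-≤ u (intersection-bound (R S) (2 * k) P) ⟩
    count (R S ∩ λ x → all< (2 * k) (λ s → P s x)) + ∑< (2 * k) (λ s → count (R S ∩ (not ∘ P s))) + u
      ≤⟨ +-monoˡ-≤ u (+-mono-≤ (count-mono {n} {R S ∩ λ x → all< (2 * k) (λ s → P s x)} imply)
           (≤-trans (∑<-mono (2 * k) few) (≤-reflexive (∑<-const (2 * k) X)))) ⟩
    count (valid S p ∩ λ x → ok q p v x) + 2 * k * X + u ∎) u≤
    where
    open ≤-Reasoning
    -- The slot of the empty neighbour `s*` carries the additional constraint, so that the union
    -- bound still has `2 * k` terms.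
    P : ℕ → V → Bool
    P s x with s ≟ s*
    ... | yes _ = ok q p v x
    ... | no  _ = ok p (nb p s) x (φ S (nb p s))
    few : ∀ s → s < 2 * k → count (R S ∩ (not ∘ P s)) ≤ X
    few s _ with s ≟ s*
    ... | yes _ = missing-on (R S) q p v
    ... | no  _ = missing-onˡ (R S) p (nb p s) (φ S (nb p s))
    imply : ∀ x → (R S ∩ λ x → all< (2 * k) (λ s → P s x)) x ≡ true → (valid S p ∩ λ x → ok q p v x) x ≡ true
    imply x e = cong₂ _∧_ (cong₂ _∧_ (∧-conicalˡ (R S x) _ e) (all<-intro (2 * k) each)) last
      where
      all : all< (2 * k) (λ s → P s x) ≡ true
      all = ∧-conicalʳ (R S x) _ e
      each : ∀ s → s < 2 * k → not (F S (nb p s)) ∨ ok p (nb p s) x (φ S (nb p s)) ≡ true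
      each s s<2k with s ≟ s* | all<-elim (2 * k) all s s<2k
      ... | yes refl | _ = cong (λ b → not b ∨ ok p (nb p s) x (φ S (nb p s))) F*
      ... | no _     | o rewrite o with F S (nb p s)
      ...   | true  = refl
      ...   | false = refl
      last : ok q p v x ≡ true
      last with s* ≟ s* | all<-elim (2 * k) all s* s*<2k
      ... | yes _  | o = o
      ... | no s≢s | _ = contradiction refl s≢s

  -- For the centre of a gadget. It is placed while all its neighbours are empty, so the only
  -- `2 * k` constraints are those of the test.
  many-fitting : ∀ S p t → (∀ s → s < 2 * k → F S (nb p s) ≡ false) →
    ∀ u → count (R S) + u ≡ n → u ≤ g * w →
    n ≤ 2 * D * count (valid S p ∩ fits (position t) (images t))
  many-fitting S p t free u size u≤ = enough _ u (begin
    n                                          ≡⟨ size ⟨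
    count (R S) + u                            ≤⟨ +-monoˡ-≤ u (intersection-bound (R S) (2 * k) P) ⟩
    count (R S ∩ fits (position t) (images t)) + ∑< (2 * k) (λ s → count (R S ∩ (not ∘ P s))) + u
      ≤⟨ +-monoˡ-≤ u (+-mono-≤ (count-mono {n} {R S ∩ fits (position t) (images t)} imply)
           (≤-trans (∑<-mono (2 * k) (λ s _ → missing-onˡ (R S) (position t) (nb (position t) s) (images t s))) (≤-reflexive (∑<-const (2 * k) X)))) ⟩
    count (valid S p ∩ fits (position t) (images t)) + 2 * k * X + u ∎) u≤
    where
    open ≤-Reasoning
    P : ℕ → V → Bool
    P s x = ok (position t) (nb (position t) s) x (images t s)
    imply : ∀ x → (R S ∩ fits (position t) (images t)) x ≡ true → (valid S p ∩ fits (position t) (images t)) x ≡ true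
    imply x e = cong₂ _∧_ (cong₂ _∧_ (∧-conicalˡ (R S x) _ e)
      (all<-intro (2 * k) λ s s<2k → cong (λ b → not b ∨ ok p (nb p s) x (φ S (nb p s))) (free s s<2k))) (∧-conicalʳ (R S x) _ e)

  skip-end : skip k (2 * k) ≡ w
  skip-end = skip-≥ (m≤m+n k _)

  -- Only the first `s` offsets around the centre are compared, which allows the weight of the tests
  -- not yet failed to be followed while the block grows.
  hitAt : (ℕ → V) → ℕ → ℕ → Fin tests → Bool
  hitAt f base s t = fits (position t) (images t) (f (base + k)) ∧
    all< s λ s′ → ok (base + k) (base + skip k s′) (vertex t) (f (base + skip k s′))

  hit : (ℕ → V) → ℕ → Fin tests → Bool
  hit f i = hitAt f (i * w) (2 * k)

  hitAt-cong : ∀ {f f′} base s t → f (base + k) ≡ f′ (base + k) →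
    (∀ s′ → s′ < s → f (base + skip k s′) ≡ f′ (base + skip k s′)) → hitAt f base s t ≡ hitAt f′ base s t
  hitAt-cong base s t e es = cong₂ _∧_ (cong (fits (position t) (images t)) e)
    (all<-cong s λ s′ s′<s → cong (ok (base + k) (base + skip k s′) (vertex t)) (es s′ s′<s))

  hit-cong : ∀ {f f′} i t → (∀ y → y < suc i * w → f y ≡ f′ y) → hit f i t ≡ hit f′ i t
  hit-cong {f} {f′} i t agree = hitAt-cong {f} {f′} (i * w) (2 * k) t (agree _ (inside (m≤m+n k _)))
    λ s′ s′<2k → agree _ (inside (s≤s⁻¹ (<-≤-trans (skip-mono k s′<2k) (≤-reflexive skip-end))))
    where
    inside : ∀ {j} → j ≤ 2 * k → i * w + j < suc i * w
    inside {j} j≤ = <-≤-trans (+-monoʳ-< (i * w) (s≤s j≤)) (≤-reflexive (+-comm (i * w) w))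

  -- The centre comes first, then the offsets from left to right; hence `suc s` filled positions in
  -- `size` and a loss of `2 * D` in weight for each of them.
  record Block (S₀ : Partial) (base : ℕ) (wt : Fin tests → ℕ) (s : ℕ) (S : Partial) : Set where
    field
      extends : S₀ ⊑ S
      below   : ∀ {y} → F S y ≡ true → y < base + skip k s ⊎ y ≡ base + k
      filled  : ∀ {y} → y < base + skip k s → F S y ≡ true
      centre  : F S (base + k) ≡ true
      size    : count (R S) + (base + suc s) ≡ n
      weight  : sum wt ≤ (2 * D) ^ℕ suc s * sum (λ t → wt t * 𝟙 (hitAt (φ S) base s t))

  module _ (S₀ : Partial) (base : ℕ) (inside : base + w ≤ g * w) (wt : Fin tests → ℕ) (wt>0 : 0 < sum wt)
    (below₀ : ∀ {y} → F S₀ y ≡ true → y < base) (filled₀ : ∀ {y} → y < base → F S₀ y ≡ true)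
    (size₀ : count (R S₀) + base ≡ n) where

    private
      within : ∀ {j} → j ≤ w → base + j < n
      within j≤ = ≤-<-trans (≤-trans (+-monoʳ-≤ base j≤) inside) gw<n

      offset≤ : ∀ {j} → j ≤ w → base + j ≤ g * w
      offset≤ j≤ = ≤-trans (+-monoʳ-≤ base j≤) inside

    block-start : ∃ λ S → Block S₀ base wt 0 S
    block-start = S , record
      { extends = step.extends
      ; below   = below
      ; filled  = filled
      ; centre  = step.at
      ; size    = trans (cong (count (R S) +_) (+-comm base 1)) (trans (+-suc (count (R S)) base) (trans (cong (_+ base) step.size) size₀))
      ; weight  = ≤-trans (proj₂ (proj₂ placed)) (≤-reflexive (cong₂ _*_ (sym (*-identityʳ (2 * D)))
                    (sum-cong-≗ λ t → cong (λ b → wt t * 𝟙 b) (sym (∧-identityʳ _))))) }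
      where
      F-centre : F S₀ (base + k) ≡ false
      F-centre = ¬-not λ Fc → <⇒≱ (below₀ Fc) (m≤m+n base k)
      empty-around : ∀ s → s < 2 * k → F S₀ (nb (base + k) s) ≡ false
      empty-around s s<2k = ¬-not λ Fs → <⇒≱ (below₀ Fs) (low (s <? k))
        where
        low : Dec (s < k) → base ≤ nb (base + k) s
        low (yes s<k) rewrite nb-left {base + k} (m≤n+m k base) (within (m≤n⇒m≤1+n (m≤m+n k _))) s<k | m+n∸n≡m base k = m≤m+n base s
        low (no s≮k) with m≤n⇒∃[o]m+o≡n (≮⇒≥ s≮k)
        ... | j , refl = subst (base ≤_) (sym (nb-right j<k (subst (_< n) (sym (+-assoc base k (suc j))) (within k+1+j≤))))
                           (≤-trans (m≤m+n base k) (m≤m+n _ _))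
          where
          j<k : j < k
          j<k = +-cancelˡ-< k j k (subst (k + j <_) (cong (k +_) (+-identityʳ k)) s<2k)
          k+1+j≤ : k + suc j ≤ w
          k+1+j≤ = subst (_≤ w) (sym (+-suc k j)) (s≤s (<⇒≤ s<2k))
      placed = place S₀ (base + k) (within (m≤n⇒m≤1+n (m≤m+n k _))) F-centre wt (λ t → fits (position t) (images t))
        (λ t → many-fitting S₀ (base + k) t empty-around base size₀ (≤-trans (m≤m+n base w) inside)) wt>0
      S = proj₁ placed
      module step = Step (proj₁ (proj₂ placed))
      skip0 : skip k 0 ≡ 0
      skip0 = skip-< (≤-trans (s≤s z≤n) 2≤k)
      below : ∀ {y} → F S y ≡ true → y < base + skip k 0 ⊎ y ≡ base + k
      below Fy = [ inj₂ , (λ F₀ → inj₁ (<-≤-trans (below₀ F₀) (m≤m+n base _))) ]′ (step.filled Fy)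
      filled : ∀ {y} → y < base + skip k 0 → F S y ≡ true
      filled {y} y< = proj₁ (step.extends y (filled₀ (subst (y <_) (trans (cong (base +_) skip0) (+-identityʳ base)) y<)))

    block-step : ∀ {s S} → s < 2 * k → Block S₀ base wt s S → ∃ λ S′ → Block S₀ base wt (suc s) S′
    block-step {s} {S} s<2k B = S′ , record
      { extends = ⊑-trans {S₀} {S} {S′} B.extends step.extends
      ; below   = below
      ; filled  = filled
      ; centre  = proj₁ (step.extends _ B.centre)
      ; size    = trans (cong (count (R S′) +_) (+-suc base (suc s))) (trans (+-suc (count (R S′)) (base + suc s))
                    (trans (cong (_+ (base + suc s)) step.size) B.size))
      ; weight  = weight }
      where
      module B = Block B
      p = base + skip k s
      skip≤ : skip k s ≤ 2 * k
      skip≤ = s≤s⁻¹ (<-≤-trans (skip-mono k s<2k) (≤-reflexive skip-end))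
      Fp : F S p ≡ false
      Fp = ¬-not λ Fp → case′ (B.below Fp)
        where
        case′ : p < p ⊎ p ≡ base + k → ⊥
        case′ (inj₁ p<p) = <-irrefl refl p<p
        case′ (inj₂ e)   = skip≢ k s (+-cancelˡ-≡ base _ _ e)
      -- The position to the right of `p` is empty unless it is the centre. In that case the one
      -- after it is empty, and it is a neighbour of `p` because `k ≥ 2`.
      empty-neighbour : ∃ λ s* → s* < 2 * k × F S (nb p s*) ≡ false
      empty-neighbour with suc s ≟ k
      ... | no 1+s≢k = k + 0 , +-monoʳ-< k (subst (0 <_) (sym (+-identityʳ k)) (≤-trans (s≤s z≤n) 2≤k)) ,
        trans (cong (F S) (nb-right {p} {0} (≤-trans (s≤s z≤n) 2≤k) (subst (_< n) (sym (+-assoc base (skip k s) 1))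
                                              (within (subst (_≤ w) (+-comm 1 (skip k s)) (s≤s skip≤))))))
          (¬-not λ Fy → case′ (B.below Fy))
        where
        case′ : p + 1 < p ⊎ p + 1 ≡ base + k → ⊥
        case′ (inj₁ lt) = <⇒≱ lt (m≤m+n p 1)
        case′ (inj₂ e)  = skip≢ k (suc s) (trans (skip-suc 1+s≢k) (+-cancelˡ-≡ base _ _
          (trans (cong (base +_) (+-comm 1 (skip k s))) (trans (sym (+-assoc base (skip k s) 1)) e))))
      ... | yes refl = k + 1 , +-monoʳ-< k (subst (1 <_) (sym (+-identityʳ k)) 2≤k) ,
        trans (cong (F S) (nb-right {p} {1} 2≤k (subst (_< n) (sym (+-assoc base (skip k s) 2)) (within in-block))))
          (¬-not λ Fy → case′ (B.below Fy))
        where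
        e₀ : skip k s + 2 ≡ suc k
        e₀ = trans (cong (_+ 2) (skip-< ≤-refl)) (+-comm s 2)
        in-block : skip k s + 2 ≤ w
        in-block = subst (_≤ w) (sym e₀) (s≤s (m≤m+n k _))
        case′ : p + 2 < p ⊎ p + 2 ≡ base + k → ⊥
        case′ (inj₁ lt) = <⇒≱ lt (m≤m+n p 2)
        case′ (inj₂ e)  = 1+n≢n (trans (sym e₀) (+-cancelˡ-≡ base _ _ (trans (sym (+-assoc base (skip k s) 2)) e)))
      -- Tests that have already failed in this block lose their weight, so the next vertex is
      -- chosen for the remaining ones.
      wt′ : Fin tests → ℕ
      wt′ t = wt t * 𝟙 (hitAt (φ S) base s t)
      wt′>0 : 0 < sum wt′
      wt′>0 = n≢0⇒n>0 λ e → <⇒≱ wt>0 (≤-trans B.weight (≤-reflexive (trans (cong ((2 * D) ^ℕ suc s *_) e) (*-zeroʳ ((2 * D) ^ℕ suc s)))))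
      placed = place S p (within (m≤n⇒m≤1+n skip≤)) Fp wt′ (λ t → ok (base + k) p (vertex t))
        (λ t → many-neighbours S p (proj₁ empty-neighbour) (base + k) (vertex t) (proj₁ (proj₂ empty-neighbour)) (proj₂ (proj₂ empty-neighbour))
                 (base + suc s) B.size (offset≤ (s≤s (<⇒≤ s<2k)))) wt′>0
      S′ = proj₁ placed
      module step = Step (proj₁ (proj₂ placed))
      below : ∀ {y} → F S′ y ≡ true → y < base + skip k (suc s) ⊎ y ≡ base + k
      below {y} Fy = [ (λ y≡p → inj₁ (subst (_< base + skip k (suc s)) (sym y≡p) (+-monoʳ-< base (skip-<-suc k s))))
                     , (λ Fy′ → map₁ (λ y< → <-trans y< (+-monoʳ-< base (skip-<-suc k s))) (B.below Fy′)) ]′ (step.filled Fy)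
      filled≤p : ∀ {y} → y ≤ p → F S′ y ≡ true
      filled≤p y≤p with m≤n⇒m<n∨m≡n y≤p
      ... | inj₁ y<p  = proj₁ (step.extends _ (B.filled y<p))
      ... | inj₂ refl = step.at
      filled : ∀ {y} → y < base + skip k (suc s) → F S′ y ≡ true
      filled {y} y< with suc s ≟ k
      ... | no 1+s≢k = filled≤p (s≤s⁻¹ (subst (y <_) (trans (cong (base +_) (skip-suc 1+s≢k)) (+-suc base (skip k s))) y<))
      ... | yes refl with m≤n⇒m<n∨m≡n (s≤s⁻¹ (subst (y <_) (trans (cong (base +_) (skip-≥ ≤-refl)) (+-suc base k)) y<))
      ...   | inj₂ refl = proj₁ (step.extends _ B.centre)
      ...   | inj₁ y<   = filled≤p (s≤s⁻¹ (subst (y <_) (trans (+-suc base s) (cong (λ j → suc (base + j)) (sym (skip-< ≤-refl)))) y<))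
      combine-hit : ∀ t → wt′ t * 𝟙 (ok (base + k) p (vertex t) (φ S′ p)) ≡ wt t * 𝟙 (hitAt (φ S′) base (suc s) t)
      combine-hit t = begin
        wt t * 𝟙 (hitAt (φ S) base s t) * 𝟙 o    ≡⟨ *-assoc (wt t) _ _ ⟩
        wt t * (𝟙 (hitAt (φ S) base s t) * 𝟙 o)  ≡⟨ cong (λ b → wt t * (𝟙 b * 𝟙 o)) (hitAt-cong {φ S} {φ S′} base s t (sym (proj₂ (step.extends _ B.centre)))
                                                      λ s′ s′<s → sym (proj₂ (step.extends _ (B.filled (+-monoʳ-< base (skip-mono k s′<s)))))) ⟩
        wt t * (𝟙 (hitAt (φ S′) base s t) * 𝟙 o) ≡⟨ cong (wt t *_) (𝟙-∧ (hitAt (φ S′) base s t) o) ⟨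
        wt t * 𝟙 (hitAt (φ S′) base s t ∧ o)     ≡⟨ cong (λ b → wt t * 𝟙 b) (∧-assoc (fits (position t) (images t) (φ S′ (base + k))) _ o) ⟩
        wt t * 𝟙 (hitAt (φ S′) base (suc s) t)   ∎
        where
        open ≡-Reasoning
        o = ok (base + k) p (vertex t) (φ S′ p)
      weight : sum wt ≤ (2 * D) ^ℕ suc (suc s) * sum (λ t → wt t * 𝟙 (hitAt (φ S′) base (suc s) t))
      weight = begin
        sum wt                                           ≤⟨ B.weight ⟩
        (2 * D) ^ℕ suc s * sum wt′                        ≤⟨ *-monoʳ-≤ ((2 * D) ^ℕ suc s) (proj₂ (proj₂ placed)) ⟩
        (2 * D) ^ℕ suc s * (2 * D * sum (λ t → wt′ t * 𝟙 (ok (base + k) p (vertex t) (φ S′ p))))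
          ≡⟨ cong (λ u → (2 * D) ^ℕ suc s * (2 * D * u)) (sum-cong-≗ combine-hit) ⟩
        (2 * D) ^ℕ suc s * (2 * D * sum (λ t → wt t * 𝟙 (hitAt (φ S′) base (suc s) t)))
          ≡⟨ solve ((2 * D) ^ℕ suc s) (2 * D) _ ⟩
        (2 * D) ^ℕ suc (suc s) * sum (λ t → wt t * 𝟙 (hitAt (φ S′) base (suc s) t)) ∎
        where
        open ≤-Reasoning
        solve : ∀ a b c → a * (b * c) ≡ b * a * c
        solve = solve-∀

    block : ∀ s → s ≤ 2 * k → ∃ λ S → Block S₀ base wt s S
    block zero    _ = block-start
    block (suc s) s<2k = block-step s<2k (proj₂ (block s (<⇒≤ s<2k)))

  misses : (ℕ → V) → ℕ → Fin tests → ℕ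
  misses f i t = ∑< i λ j → 𝟙 (not (hit f j t))

  M : ℕ
  M = (2 * D) ^ℕ w

  -- Each gadget hits at least a 1/M share of the weight, so that the total weight
  -- is at most doubled and multiplied by 1 - 1/2M.
  record Gadgets (a i : ℕ) (S : Partial) : Set where
    field
      below  : ∀ {y} → F S y ≡ true → y < i * w
      filled : ∀ {y} → y < i * w → F S y ≡ true
      size   : count (R S) + i * w ≡ n
      weight : M ^ℕ i * sum (λ t → 2 ^ℕ misses (φ S) i t) ≤ a ^ℕ i * tests

  gadgets : ∀ a → suc a ≡ 2 * M → ∀ i → i ≤ g → ∃ λ S → Gadgets a i S
  gadgets a 1+a≡2M zero    _   = empty (fromℕ< 0<n) , record
    { below  = λ ()
    ; filled = λ ()
    ; size   = trans (+-identityʳ _) (trans (sum-const n 1) (*-identityʳ n))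
    ; weight = ≤-reflexive (cong (1 *_) (trans (sum-const tests 1) (*-identityʳ tests))) }
  gadgets a 1+a≡2M (suc i) i<g with gadgets a 1+a≡2M i (<⇒≤ i<g)
  ... | S , G with block S (i * w) (subst (_≤ g * w) (+-comm w (i * w)) (*-monoˡ-≤ w i<g)) wt wt>0 G.below G.filled G.size (2 * k) ≤-refl
    where
    module G = Gadgets G
    wt : Fin tests → ℕ
    wt t = 2 ^ℕ misses (φ S) i t
    wt>0 : 0 < sum wt
    wt>0 = <-≤-trans (m^n>0 2 (misses (φ S) i t)) (term≤sum wt t)
      where t = proj₁ (tests-surjective (fromℕ< 0<n) 0 (λ _ → fromℕ< 0<n) 0<n)
  ... | S′ , B = S′ , record
    { below  = below
    ; filled = λ {y} y< → B.filled (subst (y <_) (sym end) y<)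
    ; size   = trans (cong (count (R S′) +_) (+-comm w (i * w))) B.size
    ; weight = begin
        M * M ^ℕ i * sum (λ t → 2 ^ℕ misses (φ S′) (suc i) t)   ≡⟨ solve M (M ^ℕ i) _ ⟩
        M ^ℕ i * (M * sum (λ t → 2 ^ℕ misses (φ S′) (suc i) t)) ≤⟨ *-monoʳ-≤ (M ^ℕ i) decrease ⟩
        M ^ℕ i * (a * sum wt)                                  ≡⟨ solve′ (M ^ℕ i) a (sum wt) ⟩
        a * (M ^ℕ i * sum wt)                                  ≤⟨ *-monoʳ-≤ a G.weight ⟩
        a * (a ^ℕ i * tests)                                   ≡⟨ *-assoc a (a ^ℕ i) tests ⟨
        a * a ^ℕ i * tests                                     ∎ }
    where
    open ≤-Reasoning
    module G = Gadgets G
    module B = Block B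
    solve : ∀ a b c → a * b * c ≡ b * (a * c)
    solve = solve-∀
    solve′ : ∀ a b c → a * (b * c) ≡ b * (a * c)
    solve′ = solve-∀
    end : i * w + skip k (2 * k) ≡ suc i * w
    end = trans (cong (i * w +_) skip-end) (+-comm (i * w) w)
    below : ∀ {y} → F S′ y ≡ true → y < suc i * w
    below {y} Fy with B.below Fy
    ... | inj₁ y<   = subst (y <_) end y<
    ... | inj₂ refl = <-≤-trans (+-monoʳ-< (i * w) (s≤s (m≤m+n k _))) (≤-reflexive (+-comm (i * w) w))
    wt : Fin tests → ℕ
    wt t = 2 ^ℕ misses (φ S) i t
    hits′ : Fin tests → ℕ
    hits′ t = wt t * 𝟙 (hit (φ S′) i t)
    -- A hit leaves the weight of a test unchanged, a miss doubles it.
    balance′ : ∀ t → 2 ^ℕ misses (φ S′) (suc i) t + hits′ t ≡ 2 * wt t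
    balance′ t = trans (cong (λ m → 2 ^ℕ (m + 𝟙 (not (hit (φ S′) i t))) + hits′ t) same) (go (misses (φ S) i t) (hit (φ S′) i t))
      where
      same : misses (φ S′) i t ≡ misses (φ S) i t
      same = ∑<-cong i λ j j<i → cong (𝟙 ∘ not) (hit-cong {φ S′} {φ S} j t λ y y< →
        proj₂ (B.extends y (G.filled (<-≤-trans y< (*-monoˡ-≤ w j<i)))))
      e₁ : ∀ c → c + c * 1 ≡ 2 * c
      e₁ = solve-∀
      e₂ : ∀ c → 2 * c + c * 0 ≡ 2 * c
      e₂ = solve-∀
      go : ∀ m b → 2 ^ℕ (m + 𝟙 (not b)) + 2 ^ℕ m * 𝟙 b ≡ 2 * 2 ^ℕ m
      go m true  = trans (cong (λ u → 2 ^ℕ u + 2 ^ℕ m * 1) (+-identityʳ m)) (e₁ (2 ^ℕ m))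
      go m false = trans (cong (λ u → 2 ^ℕ u + 2 ^ℕ m * 0) (+-comm m 1)) (e₂ (2 ^ℕ m))
    decrease : M * sum (λ t → 2 ^ℕ misses (φ S′) (suc i) t) ≤ a * sum wt
    decrease = +-cancelʳ-≤ (sum wt) _ _ (begin
      M * sum (λ t → 2 ^ℕ misses (φ S′) (suc i) t) + sum wt          ≤⟨ +-monoʳ-≤ _ B.weight ⟩
      M * sum (λ t → 2 ^ℕ misses (φ S′) (suc i) t) + M * sum hits′   ≡⟨ *-distribˡ-+ M _ (sum hits′) ⟨
      M * (sum (λ t → 2 ^ℕ misses (φ S′) (suc i) t) + sum hits′)     ≡⟨ cong (M *_) (∑-distrib-+ (λ t → 2 ^ℕ misses (φ S′) (suc i) t) hits′) ⟨
      M * sum (λ t → 2 ^ℕ misses (φ S′) (suc i) t + hits′ t)         ≡⟨ cong (M *_) (sum-cong-≗ balance′) ⟩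
      M * sum (λ t → 2 * wt t)                                      ≡⟨ cong (M *_) (*-distribˡ-sum 2 wt) ⟨
      M * (2 * sum wt)                                              ≡⟨ solve₂ M (sum wt) ⟩
      2 * M * sum wt                                                ≡⟨ cong (_* sum wt) 1+a≡2M ⟨
      sum wt + a * sum wt                                           ≡⟨ +-comm (sum wt) _ ⟩
      a * sum wt + sum wt                                           ∎)
      where
      solve₂ : ∀ M x → M * (2 * x) ≡ 2 * M * x
      solve₂ = solve-∀

  -- A test with `m` misses contributes `2 ^ m` to the final weight, which is at most
  -- `(a / M) ^ g * tests`. As `2 * M = suc a` and `g = a * (2 * h)`, `doubling` bounds this by
  -- `2 ^ (g - 2 h) * 2 ^ h`, so that `m ≤ g - h`.
  many-hits : ∀ a h → .{{_ : NonZero a}} → suc a ≡ 2 * M → g ≡ a * (2 * h) → tests ≤ 2 ^ℕ h →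
    ∀ {S} → Gadgets a g S → ∀ t → h ≤ ∑< g (λ i → 𝟙 (hit (φ S) i t))
  many-hits a h 1+a≡2M g≡ N≤ {S} G t = +-cancelʳ-≤ m h H (≤-trans h+m≤g (≤-reflexive (sym H+m≡g)))
    where
    open ≤-Reasoning
    module G = Gadgets G
    m = misses (φ S) g t
    H = ∑< g (λ i → 𝟙 (hit (φ S) i t))
    H+m≡g : H + m ≡ g
    H+m≡g = trans (sym (∑<-distrib-+ g _ _)) (trans (∑<-cong g λ i _ → go (hit (φ S) i t)) (trans (∑<-const g 1) (*-identityʳ g)))
      where
      go : ∀ b → 𝟙 b + 𝟙 (not b) ≡ 1
      go true  = refl
      go false = refl
    bound : a ^ℕ g * 2 ^ℕ (2 * h + m) ≤ a ^ℕ g * 2 ^ℕ (g + h)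
    bound = begin
      a ^ℕ g * 2 ^ℕ (2 * h + m)              ≡⟨ cong (a ^ℕ g *_) (^-distribˡ-+-* 2 (2 * h) m) ⟩
      a ^ℕ g * (2 ^ℕ (2 * h) * 2 ^ℕ m)        ≡⟨ s₁ (a ^ℕ g) (2 ^ℕ (2 * h)) (2 ^ℕ m) ⟩
      2 ^ℕ (2 * h) * a ^ℕ g * 2 ^ℕ m          ≡⟨ cong (λ e → 2 ^ℕ (2 * h) * a ^ℕ e * 2 ^ℕ m) g≡ ⟩
      2 ^ℕ (2 * h) * a ^ℕ (a * (2 * h)) * 2 ^ℕ m ≤⟨ *-monoˡ-≤ (2 ^ℕ m) (doubling a (2 * h)) ⟩
      suc a ^ℕ (a * (2 * h)) * 2 ^ℕ m        ≡⟨ cong₂ (λ b e → b ^ℕ e * 2 ^ℕ m) 1+a≡2M (sym g≡) ⟩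
      (2 * M) ^ℕ g * 2 ^ℕ m                  ≡⟨ cong (_* 2 ^ℕ m) (^-distrib-* 2 M g) ⟩
      2 ^ℕ g * M ^ℕ g * 2 ^ℕ m                ≡⟨ *-assoc (2 ^ℕ g) (M ^ℕ g) (2 ^ℕ m) ⟩
      2 ^ℕ g * (M ^ℕ g * 2 ^ℕ m)              ≤⟨ *-monoʳ-≤ (2 ^ℕ g) (*-monoʳ-≤ (M ^ℕ g) (term≤sum (λ t → 2 ^ℕ misses (φ S) g t) t)) ⟩
      2 ^ℕ g * (M ^ℕ g * sum (λ t → 2 ^ℕ misses (φ S) g t)) ≤⟨ *-monoʳ-≤ (2 ^ℕ g) G.weight ⟩
      2 ^ℕ g * (a ^ℕ g * tests)              ≤⟨ *-monoʳ-≤ (2 ^ℕ g) (*-monoʳ-≤ (a ^ℕ g) N≤) ⟩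
      2 ^ℕ g * (a ^ℕ g * 2 ^ℕ h)              ≡⟨ s₂ (2 ^ℕ g) (a ^ℕ g) (2 ^ℕ h) ⟩
      a ^ℕ g * (2 ^ℕ g * 2 ^ℕ h)              ≡⟨ cong (a ^ℕ g *_) (^-distribˡ-+-* 2 g h) ⟨
      a ^ℕ g * 2 ^ℕ (g + h)                  ∎
      where
      s₁ : ∀ a b c → a * (b * c) ≡ b * a * c
      s₁ = solve-∀
      s₂ : ∀ a b c → a * (b * c) ≡ b * (a * c)
      s₂ = solve-∀
    exponents : 2 * h + m ≤ g + h
    exponents = ≮⇒≥ λ lt → <⇒≱ (^-monoʳ-< 2 (s≤s (s≤s z≤n)) lt) (*-cancelˡ-≤ (a ^ℕ g) {{m^n≢0 a g}} bound)
    h+m≤g : h + m ≤ g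
    h+m≤g = +-cancelʳ-≤ h (h + m) g (≤-trans (≤-reflexive (s₃ h m)) exponents)
      where
      s₃ : ∀ h m → h + m + h ≡ 2 * h + m
      s₃ = solve-∀

-- Filling the last empty positions by means of the gadgets

module Absorption {n k X : ℕ} (𝒫 : Pattern n k X) (2≤k : 2 ≤ k) (0<n : 0 < n) (D : ℕ)
  (dense : D * (2 * k * X) + n ≤ D * n) (g : ℕ) (room : 2 * D * (g * suc (2 * k)) ≤ n) (gw<n : g * suc (2 * k) < n) where

  open Pattern 𝒫
  open Core 𝒫
  open Partial
  open Absorbers 𝒫 2≤k 0<n D dense g room gw<n

  -- Moving the occupant of q to the empty position p frees q for v.
  module _ (S : Partial) {p q : ℕ} {v : V} (p<n : p < n) (Fp : F S p ≡ false) (Fq : F S q ≡ true) (Rv : R S v ≡ true)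
    (fit-p : ∀ y → ok p y (φ S q) (φ S y) ≡ true) (fit-q : ∀ y → ok q y v (φ S y) ≡ true)
    (apart : ∀ u u′ → ok p q u u′ ≡ true) where

    private
      φ′ = (φ S [ q ≔ v ]) [ p ≔ φ S q ]
      F′ = F S [ p ≔ true ]

      data Role (y : ℕ) : Set where
        hole   : y ≡ p → φ′ y ≡ φ S q → Role y
        moved  : y ≡ q → φ′ y ≡ v → Role y
        intact : y ≢ q → F S y ≡ true → φ′ y ≡ φ S y → Role y

      role : ∀ {y} → F′ y ≡ true → Role y
      role {y} Fy with y ≟ p
      ... | yes y≡p = hole y≡p ([≔]-at y≡p)
        where
        [≔]-at : y ≡ p → φ′ y ≡ φ S q
        [≔]-at refl = [≔]-same (φ S [ q ≔ v ]) p (φ S q)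
      ... | no  y≢p with y ≟ q
      ...   | yes refl = moved refl (trans ([≔]-other (φ S [ q ≔ v ]) p (φ S q) y≢p) ([≔]-same (φ S) q v))
      ...   | no  y≢q  = intact y≢q Fy (trans ([≔]-other (φ S [ q ≔ v ]) p (φ S q) y≢p) ([≔]-other (φ S) q v y≢q))

      v-new : ∀ {x} → F S x ≡ true → v ≢ φ S x
      v-new Fx e = contradiction (trans (sym Rv) (trans (cong (R S) e) (used S Fx))) λ ()

    move : Partial
    move = record
      { φ = φ′ ; F = F′ ; R = R S ∖ v
      ; used = λ {x} → used′ {x} ; inj = λ {x} → inj′ {x} ; compat = λ {x} → compat′ {x}
      ; balance = suc-injective (trans (filled-∖ (F S) p<n Fp) (trans (balance S) (sym count-R))) }
      where
      count-R : suc (count (R S ∖ v)) ≡ count (R S)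
      count-R = count-differ v (∖-same (R S) v) Rv (λ u → ∖-other (R S) v)
      used′ : ∀ {x} → F′ x ≡ true → (R S ∖ v) (φ′ x) ≡ false
      used′ {x} Fx with role {x} Fx
      ... | hole _ e     = trans (cong (R S ∖ v) e) (∖-⊆ (R S) v (used S Fq))
      ... | moved _ e    = trans (cong (R S ∖ v) e) (∖-same (R S) v)
      ... | intact _ F e = trans (cong (R S ∖ v) e) (∖-⊆ (R S) v (used S F))
      inj′ : ∀ {x y} → F′ x ≡ true → F′ y ≡ true → φ′ x ≡ φ′ y → x ≡ y
      inj′ {x} {y} Fx Fy e with role {x} Fx | role {y} Fy
      ... | hole x≡ _    | hole y≡ _    = trans x≡ (sym y≡)
      ... | moved x≡ _   | moved y≡ _   = trans x≡ (sym y≡)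
      ... | hole _ e₁    | moved _ e₂   = contradiction (trans (sym e₂) (trans (sym e) e₁)) (v-new Fq)
      ... | moved _ e₁   | hole _ e₂    = contradiction (trans (sym e₁) (trans e e₂)) (v-new Fq)
      ... | hole _ e₁    | intact y≢q F e₂ = contradiction (inj S F Fq (trans (sym e₂) (trans (sym e) e₁))) y≢q
      ... | intact x≢q F e₁ | hole _ e₂ = contradiction (inj S F Fq (trans (sym e₁) (trans e e₂))) x≢q
      ... | moved _ e₁   | intact _ F e₂ = contradiction (trans (sym e₁) (trans e e₂)) (v-new F)
      ... | intact _ F e₁ | moved _ e₂  = contradiction (trans (sym e₂) (trans (sym e) e₁)) (v-new F)
      ... | intact _ F e₁ | intact _ F₂ e₂ = inj S F F₂ (trans (sym e₁) (trans e e₂))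
      compat′ : ∀ {x y} → F′ x ≡ true → F′ y ≡ true → ok x y (φ′ x) (φ′ y) ≡ true
      compat′ {x} {y} Fx Fy with role {x} Fx | role {y} Fy
      ... | hole refl _   | hole refl _   = ok-refl p _ _
      ... | moved refl _  | moved refl _  = ok-refl q _ _
      ... | hole refl _   | moved refl _  = apart _ _
      ... | moved refl _  | hole refl _   = trans (ok-sym q p _ _) (apart _ _)
      ... | hole refl e₁  | intact _ _ e₂ = trans (cong₂ (ok p y) e₁ e₂) (fit-p y)
      ... | intact _ _ e₁ | hole refl e₂  = trans (ok-sym x p _ _) (trans (cong₂ (ok p x) e₂ e₁) (fit-p x))
      ... | moved refl e₁ | intact _ _ e₂ = trans (cong₂ (ok q y) e₁ e₂) (fit-q y)
      ... | intact _ _ e₁ | moved refl e₂ = trans (ok-sym x q _ _) (trans (cong₂ (ok q x) e₂ e₁) (fit-q x))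
      ... | intact _ F e₁ | intact _ F₂ e₂ = trans (cong₂ (ok x y) e₁ e₂) (compat S F F₂)

    move-filled : ∀ {y} → F S y ≡ true → F move y ≡ true
    move-filled {y} Fy with y ≟ p
    ... | yes _ = refl
    ... | no  _ = Fy

    move-other : ∀ {y} → F S y ≡ true → y ≢ q → φ move y ≡ φ S y
    move-other {y} Fy y≢q = trans ([≔]-other (φ S [ q ≔ v ]) p (φ S q) y≢p) ([≔]-other (φ S) q v y≢q)
      where
      y≢p : y ≢ p
      y≢p refl = contradiction (trans (sym Fp) Fy) λ ()

    move-size : suc (count (R move)) ≡ count (R S)
    move-size = count-differ v (∖-same (R S) v) Rv (λ u → ∖-other (R S) v)

  centre : ℕ → ℕ
  centre i = i * w + k

  in-block : ∀ {i j} → i < g → j ≤ 2 * k → i * w + j < g * w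
  in-block {i} {j} i<g j≤ = <-≤-trans (+-monoʳ-< (i * w) (s≤s j≤)) (≤-trans (≤-reflexive (+-comm (i * w) w)) (*-monoˡ-≤ w i<g))

  skip≤ : ∀ {s} → s < 2 * k → skip k s ≤ 2 * k
  skip≤ s<2k = s≤s⁻¹ (<-≤-trans (skip-mono k s<2k) (≤-reflexive skip-end))

  nb-centre : ∀ {i} → i < g → ∀ s → s < 2 * k → nb (centre i) s ≡ i * w + skip k s
  nb-centre {i} i<g s s<2k with s <? k
  ... | yes s<k = trans (nb-left (m≤n+m k (i * w)) (<-trans (in-block i<g (m≤m+n k _)) gw<n) s<k) (cong (_+ s) (m+n∸n≡m (i * w) k))
  ... | no  s≮k with m≤n⇒∃[o]m+o≡n (≮⇒≥ s≮k)
  ...   | j , refl = trans (nb-right j<k (subst (_< n) (sym eq) (<-trans (in-block i<g s<2k) gw<n))) eq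
    where
    j<k : j < k
    j<k = +-cancelˡ-< k j k (subst (k + j <_) (cong (k +_) (+-identityʳ k)) s<2k)
    eq : centre i + suc j ≡ i * w + suc (k + j)
    eq = trans (+-assoc (i * w) k (suc j)) (cong (i * w +_) (+-suc k j))

  transfer : ∀ {a a′ c c′ h} → a′ ≡ suc a → suc c′ ≡ c → a + c ≤ h → a′ + c′ ≤ h
  transfer {a} {c′ = c′} refl refl le = ≤-trans (≤-reflexive (sym (+-suc a c′))) le

  -- Hits were counted for the map `f₀` before absorption. They stay meaningful because only the
  -- centres of the gadgets in `U` have changed since. Each absorption uses one gadget and one free
  -- vertex, so `budget` is preserved.
  record Absorbing (f₀ : ℕ → V) (U : ℕ → Bool) (h : ℕ) (S : Partial) : Set where
    field
      filled     : ∀ {y} → y < g * w → F S y ≡ true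
      neighbours : ∀ {i s} → i < g → s < 2 * k → φ S (i * w + skip k s) ≡ f₀ (i * w + skip k s)
      unused     : ∀ {i} → i < g → U i ≡ false → φ S (centre i) ≡ f₀ (centre i)
      budget     : ∑< g (𝟙 ∘ U) + count (R S) ≤ h

  module _ (f₀ : ℕ → V) (h : ℕ) (U : ℕ → Bool) (S : Partial) (A : Absorbing f₀ U h S)
    {v : V} {p : ℕ} {t : Fin tests} {i : ℕ} (Rv : R S v ≡ true) (p<n : p < n) (Fp : F S p ≡ false)
    (vertex≡ : vertex t ≡ v) (position≡ : position t ≡ p) (images≡ : ∀ s → s < 2 * k → images t s ≡ φ S (nb p s))
    (i<g : i < g) (free : U i ≡ false) (hit-i : hit f₀ i t ≡ true) where

    private module A = Absorbing A

    q = centre i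
    Fq : F S q ≡ true
    Fq = A.filled (in-block i<g (m≤m+n k _))
    fit-p : ∀ y → ok p y (φ S q) (φ S y) ≡ true
    fit-p = fits-compat {p} {images t}
      (subst₂ (λ x p → fits p (images t) x ≡ true) (sym (A.unused i<g free)) position≡
        (∧-conicalˡ (fits (position t) (images t) (f₀ q)) _ hit-i))
      (φ S) images≡
    fit-q : ∀ y → ok q y v (φ S y) ≡ true
    fit-q = fits-compat {q} {λ s → φ S (nb q s)} (all<-intro (2 * k) λ s s<2k → begin
      ok q (nb q s) v (φ S (nb q s))                               ≡⟨ cong (λ y → ok q y v (φ S y)) (nb-centre i<g s s<2k) ⟩
      ok q (i * w + skip k s) v (φ S (i * w + skip k s))               ≡⟨ cong₂ (ok q (i * w + skip k s)) (sym vertex≡) (A.neighbours i<g s<2k) ⟩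
      ok q (i * w + skip k s) (vertex t) (f₀ (i * w + skip k s))       ≡⟨ all<-elim (2 * k) (∧-conicalʳ (fits (position t) (images t) (f₀ q)) _ hit-i) s s<2k ⟩
      true                                                         ∎) (φ S) (λ _ _ → refl)
      where open ≡-Reasoning
    -- The position `p` is empty, whereas all neighbours of the centre `q` lie in its block and are
    -- filled. So `p` and `q` are not adjacent, and the two replacements do not interfere.
    apart : ∀ u u′ → ok p q u u′ ≡ true
    apart u u′ = trans (ok-sym p q u u′) (¬-not λ bad → far (near bad))
      where
      far : ¬ ∃ λ s → s < 2 * k × nb q s ≡ p
      far (s , s<2k , nb≡p) = contradiction
        (trans (sym Fp) (trans (cong (F S) (sym nb≡p)) (trans (cong (F S) (nb-centre i<g s s<2k)) (A.filled (in-block i<g (skip≤ s<2k))))))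
        λ ()
    S′ = move S p<n Fp Fq Rv fit-p fit-q apart
    size : suc (count (R S′)) ≡ count (R S)
    size = move-size S p<n Fp Fq Rv fit-p fit-q apart
    U′ = U [ i ≔ true ]
    off-centre : ∀ j s → s < 2 * k → j * w + skip k s ≢ q
    off-centre j s s<2k e with <-cmp j i
    ... | tri≈ _ refl _ = skip≢ k s (+-cancelˡ-≡ (i * w) _ _ e)
    ... | tri< j<i _ _ = <⇒≱ (<-≤-trans (+-monoʳ-< (j * w) (s≤s (skip≤ s<2k))) (≤-trans (≤-reflexive (+-comm (j * w) w)) (*-monoˡ-≤ w j<i)))
                             (≤-trans (m≤m+n (i * w) k) (≤-reflexive (sym e)))
    ... | tri> _ _ i<j = <⇒≱ (<-≤-trans (+-monoʳ-< (i * w) (s≤s (m≤m+n k _))) (≤-trans (≤-reflexive (+-comm (i * w) w)) (*-monoˡ-≤ w i<j)))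
                             (≤-trans (m≤m+n (j * w) (skip k s)) (≤-reflexive e))
    centre-injective : ∀ {j} → centre j ≡ q → j ≡ i
    centre-injective {j} e = *-cancelʳ-≡ j i w (+-cancelʳ-≡ k _ _ e)
    unused′ : ∀ {j} → j < g → U′ j ≡ false → φ S′ (centre j) ≡ f₀ (centre j)
    unused′ {j} j<g Uj = go (j ≟ i)
      where
      go : Dec (j ≡ i) → φ S′ (centre j) ≡ f₀ (centre j)
      go (yes j≡i) = contradiction (trans (sym Uj) (trans (cong U′ j≡i) ([≔]-same U i true))) λ ()
      go (no  j≢i) = trans (move-other S p<n Fp Fq Rv fit-p fit-q apart (A.filled (in-block j<g (m≤m+n k _))) (j≢i ∘ centre-injective))
                       (A.unused j<g (trans (sym ([≔]-other U i true j≢i)) Uj))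
    ∑<-update : ∀ {m} → i < m → ∑< m (𝟙 ∘ U′) ≡ suc (∑< m (𝟙 ∘ U))
    ∑<-update {suc m} i<1+m = go (m≤n⇒m<n∨m≡n (s≤s⁻¹ i<1+m))
      where
      go : i < m ⊎ i ≡ m → ∑< (suc m) (𝟙 ∘ U′) ≡ suc (∑< (suc m) (𝟙 ∘ U))
      go (inj₁ i<m) = cong₂ _+_ (∑<-update i<m) (cong 𝟙 ([≔]-other U i true (≢-sym (<⇒≢ i<m))))
      go (inj₂ i≡m) = trans
        (cong₂ _+_ (∑<-cong m λ j j<m → cong 𝟙 ([≔]-other U i true (<⇒≢ (subst (j <_) (sym i≡m) j<m))))
                   (trans (cong (𝟙 ∘ U′) (sym i≡m)) (cong 𝟙 ([≔]-same U i true))))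
        (trans (+-comm _ 1) (cong suc (sym (trans (cong (∑< m (𝟙 ∘ U) +_) (trans (cong (𝟙 ∘ U) (sym i≡m)) (cong 𝟙 free))) (+-identityʳ _)))))

    absorb-test : ∃₂ λ U′ S′ → Absorbing f₀ U′ h S′ × suc (count (R S′)) ≡ count (R S)
    absorb-test = U′ , S′ , record
      { filled     = λ y< → move-filled S p<n Fp Fq Rv fit-p fit-q apart (A.filled y<)
      ; neighbours = λ {j} {s} j<g s<2k → trans
          (move-other S p<n Fp Fq Rv fit-p fit-q apart (A.filled (in-block j<g (skip≤ s<2k))) (off-centre j s s<2k))
          (A.neighbours j<g s<2k)
      ; unused     = unused′
      ; budget     = transfer (∑<-update i<g) size A.budget
      } , size

  absorb-one : ∀ f₀ h → (∀ t → h ≤ ∑< g (λ i → 𝟙 (hit f₀ i t))) → ∀ U S → Absorbing f₀ U h S → 0 < count (R S) →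
    ∃₂ λ U′ S′ → Absorbing f₀ U′ h S′ × suc (count (R S′)) ≡ count (R S)
  absorb-one f₀ h many U S A R>0 =
    let v , Rv = count-positive (R S) R>0
        p , Fp = count-positive (λ p → not (F S (toℕ p))) (subst (0 <_) (sym (balance S)) R>0)
        t , v≡ , p≡ , ψ≡ = tests-surjective v (toℕ p) (λ s → φ S (nb (toℕ p) s)) (Fin.toℕ<n p)
        i , i<g , lt = ∑<-pigeonhole g (𝟙 ∘ U) (λ i → 𝟙 (hit f₀ i t))
          (<-≤-trans (m<m+n (∑< g (𝟙 ∘ U)) R>0) (≤-trans (Absorbing.budget A) (many t)))
        free , hit-i = 𝟙-< lt
    in absorb-test f₀ h U S A Rv (Fin.toℕ<n p) (not-injective Fp) v≡ p≡ ψ≡ i<g free hit-i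

  Embedding : Set
  Embedding = ∃ λ (f : ℕ → V) → (∀ {x y} → x < n → y < n → f x ≡ f y → x ≡ y) × (∀ {x y} → x < n → y < n → ok x y (f x) (f y) ≡ true)

  absorb : ∀ f₀ h → (∀ t → h ≤ ∑< g (λ i → 𝟙 (hit f₀ i t))) → ∀ m U S → Absorbing f₀ U h S → count (R S) ≡ m → Embedding
  absorb f₀ h many zero U S A none =
    φ S , (λ x<n y<n → inj S (full x<n) (full y<n)) , λ x<n y<n → compat S (full x<n) (full y<n)
    where
    full : ∀ {x} → x < n → F S x ≡ true
    full {x} x<n = ¬-not λ Fx → <⇒≱ (subst (0 <_) (cong (𝟙 ∘ not) (sym (trans (cong (F S) (Fin.toℕ-fromℕ< x<n)) Fx))) (s≤s z≤n))
      (≤-trans (term≤sum (λ p → 𝟙 (not (F S (toℕ p)))) (fromℕ< x<n)) (≤-reflexive (trans (balance S) none)))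
  absorb f₀ h many (suc m) U S A e =
    let U′ , S′ , A′ , size = absorb-one f₀ h many U S A (subst (0 <_) (sym e) (s≤s z≤n))
    in absorb f₀ h many m U′ S′ A′ (suc-injective (trans size e))

-- Embedding one segment of consecutive positions

count-singleton : ∀ {n} (u : Fin n) → count (λ v → does (v Fin.≟ u)) ≡ 1
count-singleton {n} u = trans
  (sym (count-differ {n} {λ _ → false} u refl (dec-true (u Fin.≟ u) refl) λ v v≢u → sym (dec-false (v Fin.≟ u) v≢u)))
  (cong suc (trans (sum-const n 0) (*-zeroʳ n)))

module Segments {n k X : ℕ} (𝒫 : Pattern n k X) (0<k : 0 < k) where

  open Pattern 𝒫
  open Core 𝒫
  open Partial

  triples : ℕ
  triples = n * (n * n)

  -- Each set of vertices that a single placement can exclude from a position is indexed by one of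
  -- `n ^ 3` triples, so the potential can watch all of them at once, whatever is chosen later.
  avoided : Fin triples → V → Bool
  avoided t v =
    let x , yu = remQuot {n} (n * n) t
        y , u  = remQuot {n} n yu
    in not (ok (toℕ x) (toℕ y) u v)

  avoided-surjective : ∀ {x y} → x < n → y < n → ∀ u → ∃ λ t → ∀ v → avoided t v ≡ not (ok x y u v)
  avoided-surjective x<n y<n u = combine x′ (combine y′ u) , λ v → cong not (begin
    ok (toℕ (X₁ t₁)) (toℕ (Y t₁)) (U t₁) v    ≡⟨ cong (λ q → ok (toℕ (proj₁ q)) (toℕ (proj₁ (remQuot {n} n (proj₂ q)))) (proj₂ (remQuot {n} n (proj₂ q))) v)
                                                    (Fin.remQuot-combine {n} x′ (combine y′ u)) ⟩
    ok (toℕ x′) (toℕ (proj₁ (remQuot {n} n (combine y′ u)))) (proj₂ (remQuot {n} n (combine y′ u))) v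
      ≡⟨ cong (λ q → ok (toℕ x′) (toℕ (proj₁ q)) (proj₂ q) v) (Fin.remQuot-combine {n} y′ u) ⟩
    ok (toℕ x′) (toℕ y′) u v                  ≡⟨ cong₂ (λ x y → ok x y u v) (Fin.toℕ-fromℕ< x<n) (Fin.toℕ-fromℕ< y<n) ⟩
    ok _ _ u v                                ∎)
    where
    open ≡-Reasoning
    x′ = fromℕ< x<n
    y′ = fromℕ< y<n
    t₁ = combine x′ (combine y′ u)
    X₁ Y : Fin triples → V
    X₁ t = proj₁ (remQuot {n} (n * n) t)
    Y t = proj₁ (remQuot {n} n (proj₂ (remQuot {n} (n * n) t)))
    U : Fin triples → V
    U t = proj₂ (remQuot {n} n (proj₂ (remQuot {n} (n * n) t)))

  -- Away from both ends, `nb-left` and `nb-right` together describe all neighbours, and none of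
  -- them wraps around.
  window : ∀ {p y u v} → k ≤ p → p + k < n → ok p y u v ≡ false → p ≤ y + k × y ≤ p + k
  window {p} {y} k≤p p+k<n bad = go (near bad)
    where
    go : (∃ λ s → s < 2 * k × nb p s ≡ y) → p ≤ y + k × y ≤ p + k
    go (s , s<2k , nb≡y) with s <? k
    ... | yes s<k = lower , upper
      where
      y≡ : p ∸ k + s ≡ y
      y≡ = trans (sym (nb-left k≤p (≤-<-trans (m≤m+n p k) p+k<n) s<k)) nb≡y
      lower : p ≤ y + k
      lower = subst (_≤ y + k) (m∸n+n≡m k≤p) (+-monoˡ-≤ k (subst (p ∸ k ≤_) y≡ (m≤m+n (p ∸ k) s)))
      upper : y ≤ p + k
      upper = subst (_≤ p + k) y≡ (+-mono-≤ (m∸n≤m p k) (<⇒≤ s<k))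
    ... | no s≮k with m≤n⇒∃[o]m+o≡n (≮⇒≥ s≮k)
    ...   | j , refl = ≤-trans (subst (p ≤_) y≡ (m≤m+n p (suc j))) (m≤m+n y k) , subst (_≤ p + k) y≡ (+-monoʳ-≤ p j<k)
      where
      j<k : j < k
      j<k = +-cancelˡ-< k j k (subst (k + j <_) (cong (k +_) (+-identityʳ k)) s<2k)
      y≡ : p + suc j ≡ y
      y≡ = trans (sym (nb-right j<k (≤-<-trans (+-monoʳ-≤ p j<k) p+k<n))) nb≡y

  module _ (origin : ℕ) where

    -- Distinctness is imposed separately, because `ok` alone does not force the vertices of a row
    -- to be distinct.
    pairing : ℕ → ℕ → V → V → Bool
    pairing a b u v = ok (origin + a) (origin + b) u v ∧ not (does (v Fin.≟ u))

    β : ℕ → ℕ → ℕ → ℕ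
    β X′ a b with a + k <? b
    ... | yes _ = 1
    ... | no  _ = X′ + 1

    -- Stated for an initial segment of the columns to permit induction on `c`. Only columns with
    -- `a + k ≥ b` cost `X′`, at most `(c + k) ∸ b` of them, which is `k` when `c = b`; every column
    -- costs 1 for equality.
    ∑<-β : ∀ X′ b c → c ≤ b → ∑< c (λ a → β X′ a b) ≤ ((c + k) ∸ b) * X′ + c
    ∑<-β X′ b zero    _   = z≤n
    ∑<-β X′ b (suc c) c<b with c + k <? b
    ... | yes _ = begin
      ∑< c (λ a → β X′ a b) + 1                    ≤⟨ +-monoˡ-≤ 1 (∑<-β X′ b c (<⇒≤ c<b)) ⟩
      ((c + k) ∸ b) * X′ + c + 1                   ≡⟨ +-assoc (((c + k) ∸ b) * X′) c 1 ⟩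
      ((c + k) ∸ b) * X′ + (c + 1)                 ≤⟨ +-mono-≤ (*-monoˡ-≤ X′ (∸-monoˡ-≤ b (n≤1+n (c + k)))) (≤-reflexive (+-comm c 1)) ⟩
      ((suc c + k) ∸ b) * X′ + suc c               ∎
      where open ≤-Reasoning
    ... | no ≮b = begin
      ∑< c (λ a → β X′ a b) + (X′ + 1)             ≤⟨ +-monoˡ-≤ (X′ + 1) (∑<-β X′ b c (<⇒≤ c<b)) ⟩
      ((c + k) ∸ b) * X′ + c + (X′ + 1)            ≡⟨ solve ((c + k) ∸ b) X′ c ⟩
      suc ((c + k) ∸ b) * X′ + suc c               ≡⟨ cong (λ m → m * X′ + suc c) (+-∸-assoc 1 (≮⇒≥ ≮b)) ⟨
      ((suc c + k) ∸ b) * X′ + suc c               ∎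
      where
      open ≤-Reasoning
      solve : ∀ m X c → m * X + c + (X + 1) ≡ suc m * X + suc c
      solve = solve-∀

    rows : ∀ (R : V → Bool) L → k ≤ origin → origin + L + k ≤ n → ∀ X′ →
      (∀ {x y} → x < n → y < n → ∀ u → count (R ∩ λ v → not (ok x y u v)) ≤ X′) → 2 * (k * X′ + L) ≤ count R →
      ∃ λ (σ : ℕ → Permutation n n) → (∀ a i → R (σ a ⟨$⟩ʳ i) ≡ R i) ×
        (∀ i → R i ≡ true → ∀ {a b} → a < b → b < L → pairing a b (σ a ⟨$⟩ʳ i) (σ b ⟨$⟩ʳ i) ≡ true)
    rows R L k≤origin end X′ sparse size = array R pairing (β X′) L right left half
      where
      open ≤-Reasoning
      before-end : ∀ {b} → b < L → origin + b + k < n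
      before-end b<L = <-≤-trans (+-monoˡ-< k (+-monoʳ-< origin b<L)) end
      in-range : ∀ {b} → b < L → origin + b < n
      in-range b<L = ≤-<-trans (m≤m+n _ k) (before-end b<L)
      far : ∀ {a b} → a + k < b → b < L → ∀ u v → ok (origin + a) (origin + b) u v ≡ true
      far {a} {b} a+k<b b<L u v = ¬-not λ bad → <⇒≱ (+-monoʳ-< origin a+k<b)
        (≤-trans (proj₂ (window (≤-trans k≤origin (m≤m+n origin a)) (before-end (<-trans (≤-<-trans (m≤m+n a k) a+k<b) b<L)) bad))
                 (≤-reflexive (+-assoc origin a k)))
      conflict : ∀ (P Q : V → Bool) {c} → count Q ≡ 1 → count (R ∩ (not ∘ P)) ≤ c → count (R ∩ λ v → not (P v ∧ not (Q v))) ≤ c + 1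
      conflict P Q {c} one few = begin
        count (R ∩ λ v → not (P v ∧ not (Q v)))           ≤⟨ sum-mono (λ v → go (R v) (P v) (Q v)) ⟩
        sum (λ v → 𝟙 (R v ∧ not (P v)) + 𝟙 (Q v))         ≡⟨ ∑-distrib-+ (𝟙 ∘ (R ∩ (not ∘ P))) (𝟙 ∘ Q) ⟩
        count (R ∩ (not ∘ P)) + count Q                   ≤⟨ +-mono-≤ few (≤-reflexive one) ⟩
        c + 1                                             ∎
        where
        go : ∀ x y z → 𝟙 (x ∧ not (y ∧ not z)) ≤ 𝟙 (x ∧ not y) + 𝟙 z
        go false y     z     = z≤n
        go true  false z     = s≤s z≤n
        go true  true  false = z≤n
        go true  true  true  = ≤-refl
      bound : ∀ {a b} (P Q : V → Bool) → b < L → count Q ≡ 1 → (a + k < b → ∀ v → P v ≡ true) → count (R ∩ (not ∘ P)) ≤ X′ →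
              count (R ∩ λ v → not (P v ∧ not (Q v))) ≤ β X′ a b
      bound {a} {b} P Q b<L one all few with a + k <? b
      ... | no  _   = conflict P Q one few
      ... | yes lt = conflict P Q one (≤-reflexive (trans (sum-cong-≗ λ v → trans (cong (λ c → 𝟙 (R v ∧ not c)) (all lt v)) (zero′ (R v)))
                                        (trans (sum-const n 0) (*-zeroʳ n))))
        where
        zero′ : ∀ x → 𝟙 (x ∧ false) ≡ 0
        zero′ true  = refl
        zero′ false = refl
      right : ∀ {a b} → a < b → b < L → ∀ u → count (R ∩ λ v → not (pairing a b u v)) ≤ β X′ a b
      right {a} {b} a<b b<L u = bound (ok (origin + a) (origin + b) u) (λ v → does (v Fin.≟ u)) b<L (count-singleton u)
        (λ lt v → far lt b<L u v) (sparse (in-range (<-trans a<b b<L)) (in-range b<L) u)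
      left : ∀ {a b} → a < b → b < L → ∀ v → count (R ∩ λ u → not (pairing a b u v)) ≤ β X′ a b
      left {a} {b} a<b b<L v = bound (λ u → ok (origin + a) (origin + b) u v) (λ u → does (v Fin.≟ u)) b<L
        (trans (sum-cong-≗ λ u → cong 𝟙 (does-sym v u)) (count-singleton v))
        (λ lt u → far lt b<L u v)
        (subst (_≤ X′) (sum-cong-≗ λ u → cong (λ c → 𝟙 (R u ∧ not c)) (ok-sym (origin + b) (origin + a) v u))
          (sparse (in-range b<L) (in-range (<-trans a<b b<L)) v))
        where
        does-sym : ∀ (v u : V) → does (v Fin.≟ u) ≡ does (u Fin.≟ v)
        does-sym v u with v Fin.≟ u
        ... | yes v≡u = sym (dec-true (u Fin.≟ v) (sym v≡u))
        ... | no  v≢u = sym (dec-false (u Fin.≟ v) (v≢u ∘ sym))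
      half : ∀ {b} → b < L → 2 * ∑< b (λ a → β X′ a b) ≤ count R
      half {b} b<L = begin
        2 * ∑< b (λ a → β X′ a b)       ≤⟨ *-monoʳ-≤ 2 (∑<-β X′ b b ≤-refl) ⟩
        2 * (((b + k) ∸ b) * X′ + b)    ≡⟨ cong (λ m → 2 * (m * X′ + b)) (m+n∸m≡n b k) ⟩
        2 * (k * X′ + b)                ≤⟨ *-monoʳ-≤ 2 (+-monoʳ-≤ (k * X′) (<⇒≤ b<L)) ⟩
        2 * (k * X′ + L)                ≤⟨ size ⟩
        count R                         ∎

    module _ (S : Partial) (P′ L : ℕ) (below₀ : ∀ {y} → F S y ≡ true → y < P′) (gap : P′ + k ≤ origin) (end : origin + L + k ≤ n)
      (x : ℕ → V) (free₀ : ∀ a → R S (x a) ≡ true) (row : ∀ {a b} → a < b → b < L → pairing a b (x a) (x b) ≡ true) where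

      -- As `origin` is at least `k` beyond `P′`, earlier positions impose nothing on the row, and
      -- all constraints come from within it. The exact form of `counts`, for every `W`, is what the
      -- potential needs.
      record Row (j : ℕ) (S′ : Partial) : Set where
        field
          extends : S ⊑ S′
          below   : ∀ {y} → F S′ y ≡ true → y < P′ ⊎ ∃ λ a → a < j × y ≡ origin + a
          at      : ∀ {a} → a < j → φ S′ (origin + a) ≡ x a
          counts  : ∀ W → count (R S′ ∩ W) + ∑< j (λ a → 𝟙 (W (x a))) ≡ count (R S ∩ W)
          free    : ∀ {v} → R S v ≡ true → (∀ a → a < j → x a ≢ v) → R S′ v ≡ true

      row-step : ∀ {j} → j < L → ∀ S′ → Row j S′ → ∃ λ S″ → Row (suc j) S″
      row-step {j} j<L S′ ρ = S″ , record
        { extends = ⊑-trans {S} {S′} {S″} ρ.extends (extend-⊑ S′ p<n Fp Rx fit)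
        ; below   = λ Fy → [ (λ y≡p → inj₂ (j , ≤-refl , y≡p))
                           , (λ Fy′ → map₂ (λ { (a , a<j , y≡) → a , m<n⇒m<1+n a<j , y≡ }) (ρ.below Fy′)) ]′
                           (extend-filled S′ p<n Fp Rx fit Fy)
        ; at      = at
        ; counts  = λ W → trans (sym (+-assoc (count (R S″ ∩ W)) _ _)) (trans (rearrange (count (R S″ ∩ W)) _ _)
                      (trans (cong (_+ ∑< j (λ a → 𝟙 (W (x a)))) (extend-count S′ p<n Fp Rx fit W)) (ρ.counts W)))
        ; free    = λ {v} Rv new → trans (∖-other (R S′) (x j) (≢-sym (new j ≤-refl))) (ρ.free Rv λ a a<j → new a (m<n⇒m<1+n a<j)) }
        where
        module ρ = Row ρ
        rearrange : ∀ a b c → a + b + c ≡ a + c + b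
        rearrange = solve-∀
        p = origin + j
        p+k<n : p + k < n
        p+k<n = <-≤-trans (+-monoˡ-< k (+-monoʳ-< origin j<L)) end
        p<n : p < n
        p<n = ≤-<-trans (m≤m+n p k) p+k<n
        k≤p : k ≤ p
        k≤p = ≤-trans (m≤n+m k P′) (≤-trans gap (m≤m+n origin j))
        Fp : F S′ p ≡ false
        Fp = ¬-not λ Fp → [ (λ p<P′ → <⇒≱ p<P′ (≤-trans (m≤m+n P′ k) (≤-trans gap (m≤m+n origin j))))
                          , (λ { (a , a<j , e) → <⇒≢ a<j (sym (+-cancelˡ-≡ origin j a e)) }) ]′ (ρ.below Fp)
        Rx : R S′ (x j) ≡ true
        Rx = ρ.free (free₀ j) λ a a<j xa≡xj → contradiction
          (trans (sym (∧-conicalʳ (ok (origin + a) (origin + j) (x a) (x j)) _ (row a<j j<L)))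
                 (cong not (dec-true (x j Fin.≟ x a) (sym xa≡xj)))) λ ()
        fit : ∀ y → F S′ y ≡ true → ok p y (x j) (φ S′ y) ≡ true
        fit y Fy = [ far , in-row ]′ (ρ.below Fy)
          where
          far : y < P′ → ok p y (x j) (φ S′ y) ≡ true
          far y<P′ = ¬-not λ bad → <⇒≱ (+-monoˡ-< k y<P′) (≤-trans (≤-trans gap (m≤m+n origin j)) (proj₁ (window k≤p p+k<n bad)))
          in-row : (∃ λ a → a < j × y ≡ origin + a) → ok p y (x j) (φ S′ y) ≡ true
          in-row (a , a<j , refl) = trans (ok-sym p (origin + a) (x j) _) (trans (cong (λ u → ok (origin + a) p u (x j)) (ρ.at a<j))
            (∧-conicalˡ (ok (origin + a) p (x a) (x j)) _ (row a<j j<L)))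
        S″ = extend S′ p<n Fp Rx fit
        at : ∀ {a} → a < suc j → φ S″ (origin + a) ≡ x a
        at {a} a<1+j = go (m≤n⇒m<n∨m≡n (s≤s⁻¹ a<1+j))
          where
          go : a < j ⊎ a ≡ j → φ S″ (origin + a) ≡ x a
          go (inj₁ a<j) = trans ([≔]-other (φ S′) p (x j) (<⇒≢ (+-monoʳ-< origin a<j))) (ρ.at a<j)
          go (inj₂ a≡j) = trans (cong (λ a → φ S″ (origin + a)) a≡j) (trans (proj₂ (extend-at S′ p<n Fp Rx fit)) (cong x (sym a≡j)))

      insert-row : ∀ j → j ≤ L → ∃ (Row j)
      insert-row zero    _   = S , record
        { extends = λ _ Fy → Fy , refl ; below = λ Fy → inj₁ (below₀ Fy) ; at = λ ()
        ; counts = λ W → +-identityʳ _ ; free = λ Rv _ → Rv }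
      insert-row (suc j) j<L = let S′ , ρ = insert-row j (<⇒≤ j<L) in row-step j<L S′ ρ

  module _ (L : ℕ) .{{_ : NonZero L}} (d : ℕ) where

    -- The degree is one more than that of the factorial of `count R` to which it is compared, since
    -- `fall-drift` loses one step of `L` to truncation.
    potential : (V → Bool) → ℕ
    potential R = sum λ t → fall L (2 + d) (count (R ∩ avoided t))

    module _ (S : Partial) (P′ : ℕ) (below : ∀ {y} → F S y ≡ true → y < P′) (end : P′ + k + L + k ≤ n)
      (σ : ℕ → Permutation n n) (pres : ∀ a i → R S (σ a ⟨$⟩ʳ i) ≡ R S i) (i : V) (Ri : R S i ≡ true)
      (compatible : ∀ {a b} → a < b → b < L → pairing (P′ + k) a b (σ a ⟨$⟩ʳ i) (σ b ⟨$⟩ʳ i) ≡ true) where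

      add-row : ∃ λ S′ → S ⊑ S′ × (∀ {y} → F S′ y ≡ true → y < P′ + k + L) × count (R S′) + L ≡ count (R S) ×
        (∀ t → count (R S′ ∩ avoided t) ≡ count (R S ∩ avoided t) ∸ hits (R S) L σ pres d (avoided t) i)
      add-row =
        let S′ , ρ = insert-row (P′ + k) S P′ L below ≤-refl end (λ a → σ a ⟨$⟩ʳ i) (λ a → trans (pres a i) Ri) compatible L ≤-refl
        in S′ , Row.extends ρ , below′ (Row.below ρ) , size (R S′) (Row.counts ρ) ,
           λ t → remaining (count (R S′ ∩ avoided t)) (hits (R S) L σ pres d (avoided t) i) (Row.counts ρ (avoided t))
        where
        remaining : ∀ a b {c} → a + b ≡ c → a ≡ c ∸ b
        remaining a b refl = sym (m+n∸n≡m a b)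
        below′ : ∀ {F : ℕ → Bool} → (∀ {y} → F y ≡ true → y < P′ ⊎ ∃ λ a → a < L × y ≡ P′ + k + a) → ∀ {y} → F y ≡ true → y < P′ + k + L
        below′ b {y} Fy = [ (λ y<P′ → <-≤-trans y<P′ (≤-trans (m≤m+n P′ k) (m≤m+n _ L)))
                          , (λ { (a , a<L , y≡) → subst (_< P′ + k + L) (sym y≡) (+-monoʳ-< (P′ + k) a<L) }) ]′ (b Fy)
        count-all : ∀ (Q : V → Bool) → count (Q ∩ λ _ → true) ≡ count Q
        count-all Q = sum-cong-≗ λ v → cong 𝟙 (∧-identityʳ (Q v))
        size : ∀ R′ → (∀ W → count (R′ ∩ W) + ∑< L (λ a → 𝟙 (W (σ a ⟨$⟩ʳ i))) ≡ count (R S ∩ W)) → count R′ + L ≡ count (R S)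
        size R′ counts = trans (cong₂ _+_ (sym (count-all R′)) (sym (trans (∑<-const L 1) (*-identityʳ L))))
                           (trans (counts (λ _ → true)) (count-all (R S)))

    add-segment : ∀ S P′ → (∀ {y} → F S y ≡ true → y < P′) → P′ + k + L + k ≤ n →
      (∀ t → 2 * (k * count (R S ∩ avoided t) + L) ≤ count (R S)) → 0 < count (R S) →
      ∃ λ S′ → S ⊑ S′ × (∀ {y} → F S′ y ≡ true → y < P′ + k + L) × count (R S′) + L ≡ count (R S) ×
        count (R S) * potential (R S′) ≤ (count (R S) ∸ (1 + d) * L) * potential (R S)
    add-segment S P′ below end sparse R>0 =
      let σ , pres , compatible = rows (P′ + k) (R S) L (m≤n+m k P′) end X′ few room
          i , Ri , le = choose-row (R S) L σ pres d avoided R>0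
          S′ , ext , below′ , size , counts = add-row S P′ below end σ pres i Ri (compatible i Ri)
      in S′ , ext , below′ , size , subst (λ s → count (R S) * s ≤ (count (R S) ∸ (1 + d) * L) * potential (R S))
           (sum-cong-≗ λ t → cong (fall L (2 + d)) (sym (counts t))) le
      where
      open ≤-Reasoning
      r = count (R S)
      instance
        2k≢0 : NonZero (2 * k)
        2k≢0 = m*n≢0 2 k {{_}} {{>-nonZero 0<k}}
      -- The largest value with `2 * (k * X′ + L) ≤ r`. The division turns the hypotheses on the
      -- individual triples into one uniform bound.
      X′ = (r ∸ 2 * L) / (2 * k)
      2L≤r : 2 * L ≤ r
      2L≤r = ≤-trans (*-monoʳ-≤ 2 (m≤n+m L (k * count (R S ∩ avoided t₀)))) (sparse t₀)
        where
        v = proj₁ (count-positive (R S) R>0)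
        0<n : 0 < n
        0<n = ≤-<-trans z≤n (Fin.toℕ<n v)
        t₀ = proj₁ (avoided-surjective 0<n 0<n v)
      expand : ∀ k c L → 2 * (k * c + L) ≡ c * (2 * k) + 2 * L
      expand = solve-∀
      few : ∀ {x y} → x < n → y < n → ∀ u → count (R S ∩ λ v → not (ok x y u v)) ≤ X′
      few {x} {y} x<n y<n u =
        let t , avoided≗ = avoided-surjective x<n y<n u
            c = count (R S ∩ avoided t)
        in begin
          count (R S ∩ λ v → not (ok x y u v))  ≡⟨ sum-cong-≗ (λ v → cong (λ b → 𝟙 (R S v ∧ b)) (avoided≗ v)) ⟨
          c                                     ≡⟨ m*n/n≡m c (2 * k) ⟨
          (c * (2 * k)) / (2 * k)               ≤⟨ /-monoˡ-≤ (2 * k) (m+n≤o⇒m≤o∸n (c * (2 * k))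
                                                     (≤-trans (≤-reflexive (sym (expand k c L))) (sparse t))) ⟩
          X′                                    ∎
      room : 2 * (k * X′ + L) ≤ r
      room = begin
        2 * (k * X′ + L)            ≡⟨ expand k X′ L ⟩
        X′ * (2 * k) + 2 * L        ≤⟨ +-monoˡ-≤ (2 * L) (m/n*n≤m (r ∸ 2 * L) (2 * k)) ⟩
        r ∸ 2 * L + 2 * L           ≡⟨ m∸n+n≡m 2L≤r ⟩
        r                           ∎

-- Otherwise fall L (e + 1) x ≥ ((a + 1) / A) ^ e * fall L e r with A = 12 k D,
-- but by the hypotheses it is at most N * n * (a / A) ^ e * fall L e r.
sparse-bound : ∀ L k D′ s {X n r₀ r x Φ₀ N} → let D = suc D′ ; a = 6 * D′ + 3 ; e = a * s in 0 < k →
  fall L (suc e) x * fall L e r₀ ≤ Φ₀ * fall L e r → Φ₀ ≤ N * n * fall L e X →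
  12 * k * D * X ≤ a * r₀ → e * L < r₀ → e * L < r → N * n < 2 ^ℕ s → 24 * k * D * (e * L) ≤ r →
  8 * k * D * x + r ≤ 4 * D * r
sparse-bound L k D′ s {X} {n} {r₀} {r} {x} {Φ₀} {N} 0<k potential initial density eL<r₀ eL<r N<2^s small =
  ≮⇒≥ λ dense → <⇒≱ N<2^s (*-cancelʳ-≤ (2 ^ℕ s) (N * n) c {{c≢0}} (main dense))
  where
  open ≤-Reasoning
  D = suc D′
  a = 6 * D′ + 3
  e = a * s
  A = 12 * k * D
  c = a ^ℕ e * (fall L e r * fall L e r₀)
  instance
    a≢0 : NonZero a
    a≢0 = >-nonZero (≤-trans (s≤s z≤n) (m≤n+m 3 (6 * D′)))
    A≢0 : NonZero A
    A≢0 = m*n≢0 (12 * k) D {{m*n≢0 12 k {{_}} {{>-nonZero 0<k}}}}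
  c≢0 : NonZero c
  c≢0 = m*n≢0 _ _ {{m^n≢0 a e}} {{m*n≢0 _ _ {{>-nonZero (fall-positive L e r eL<r)}} {{>-nonZero (fall-positive L e r₀ eL<r₀)}}}}
  a≤A : a ≤ A
  a≤A = begin
    6 * D′ + 3                    ≤⟨ m≤m+n _ (6 * D′ + 9) ⟩
    6 * D′ + 3 + (6 * D′ + 9)     ≡⟨ s₁ D′ ⟩
    12 * 1 * D                    ≤⟨ *-monoˡ-≤ D (*-monoʳ-≤ 12 0<k) ⟩
    12 * k * D                    ∎
    where
    s₁ : ∀ d → 6 * d + 3 + (6 * d + 9) ≡ 12 * 1 * suc d
    s₁ = solve-∀
  module _ (dense : 4 * D * r < 8 * k * D * x + r) where
    -- The assumed lower bound `(1 - 1/4D) r / 2k` on `x` exceeds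
    -- `suc a * r / A = (1 - 1/3D) r / 2k` by `r / 24kD`, which pays for the shift by `e * L`.
    large : suc a * r + A * (e * L) ≤ A * x
    large = *-cancelˡ-≤ 2 (+-cancelʳ-≤ (3 * r) _ _ (begin
      2 * (suc a * r + A * (e * L)) + 3 * r      ≡⟨ s₁ D′ r k (e * L) ⟩
      24 * k * D * (e * L) + (12 * D′ + 11) * r  ≤⟨ +-monoˡ-≤ _ small ⟩
      r + (12 * D′ + 11) * r                     ≡⟨ s₂ D′ r ⟩
      3 * (4 * D * r)                            ≤⟨ *-monoʳ-≤ 3 (<⇒≤ dense) ⟩
      3 * (8 * k * D * x + r)                    ≡⟨ s₃ k D′ x r ⟩
      2 * (A * x) + 3 * r                        ∎))
      where
      s₁ : ∀ d r k y → 2 * (suc (6 * d + 3) * r + 12 * k * suc d * y) + 3 * r ≡ 24 * k * suc d * y + (12 * d + 11) * r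
      s₁ = solve-∀
      s₂ : ∀ d r → r + (12 * d + 11) * r ≡ 3 * (4 * suc d * r)
      s₂ = solve-∀
      s₃ : ∀ k d x r → 3 * (8 * k * suc d * x + r) ≡ 2 * (12 * k * suc d * x) + 3 * r
      s₃ = solve-∀
    eL≤x : e * L ≤ x
    eL≤x = *-cancelˡ-≤ A (m+n≤o⇒n≤o (suc a * r) large)
    y = x ∸ e * L
    y+eL≡x : y + e * L ≡ x
    y+eL≡x = m∸n+n≡m eL≤x
    Ay : suc a * r ≤ A * y
    Ay = +-cancelʳ-≤ (A * (e * L)) _ _ (≤-trans large (≤-reflexive (trans (cong (A *_) (sym y+eL≡x)) (*-distribˡ-+ A y (e * L)))))
    y>0 : 0 < y
    y>0 = n≢0⇒n>0 λ y≡0 → <⇒≱ (≤-<-trans z≤n eL<r) (*-cancelˡ-≤ (suc a) (≤-trans Ay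
      (≤-reflexive (trans (cong (A *_) y≡0) (trans (*-zeroʳ A) (sym (*-zeroʳ (suc a))))))))
    -- Here `y` is the smallest factor of `fall L (suc e) x`, and already `y ≥ suc a * r / A`. With
    -- `e = a * s`, `doubling` extracts `2 ^ s` from `(suc a / a) ^ e`.
    growth : 2 ^ℕ s * a ^ℕ e * fall L e r ≤ A ^ℕ e * fall L (suc e) x
    growth = begin
      2 ^ℕ s * a ^ℕ e * fall L e r         ≤⟨ *-mono-≤ (doubling a s) (fall≤^ L e r) ⟩
      suc a ^ℕ e * r ^ℕ e                  ≡⟨ ^-distrib-* (suc a) r e ⟨
      (suc a * r) ^ℕ e                    ≤⟨ ^-monoˡ-≤ e Ay ⟩
      (A * y) ^ℕ e                        ≡⟨ ^-distrib-* A y e ⟩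
      A ^ℕ e * y ^ℕ e                      ≤⟨ *-monoʳ-≤ (A ^ℕ e) (^≤fall L e x y (≤-reflexive y+eL≡x)) ⟩
      A ^ℕ e * fall L e x                 ≤⟨ *-monoʳ-≤ (A ^ℕ e) (m≤m*n (fall L e x) y {{>-nonZero y>0}}) ⟩
      A ^ℕ e * (fall L e x * y)           ≡⟨ cong (A ^ℕ e *_) (fall-last L e x) ⟨
      A ^ℕ e * fall L (suc e) x           ∎
    main : 2 ^ℕ s * c ≤ N * n * c
    main = begin
      2 ^ℕ s * (a ^ℕ e * (fall L e r * fall L e r₀))      ≡⟨ s₁ (2 ^ℕ s) (a ^ℕ e) (fall L e r) (fall L e r₀) ⟩
      2 ^ℕ s * a ^ℕ e * fall L e r * fall L e r₀          ≤⟨ *-monoˡ-≤ (fall L e r₀) growth ⟩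
      A ^ℕ e * fall L (suc e) x * fall L e r₀            ≡⟨ *-assoc (A ^ℕ e) _ _ ⟩
      A ^ℕ e * (fall L (suc e) x * fall L e r₀)          ≤⟨ *-monoʳ-≤ (A ^ℕ e) potential ⟩
      A ^ℕ e * (Φ₀ * fall L e r)                         ≤⟨ *-monoʳ-≤ (A ^ℕ e) (*-monoˡ-≤ (fall L e r) initial) ⟩
      A ^ℕ e * (N * n * fall L e X * fall L e r)         ≡⟨ s₂ (A ^ℕ e) (N * n) (fall L e X) (fall L e r) ⟩
      N * n * fall L e r * (A ^ℕ e * fall L e X)         ≤⟨ *-monoʳ-≤ (N * n * fall L e r) (fall-scale L e a≤A density) ⟩
      N * n * fall L e r * (a ^ℕ e * fall L e r₀)        ≡⟨ s₃ (N * n) (fall L e r) (a ^ℕ e) (fall L e r₀) ⟩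
      N * n * (a ^ℕ e * (fall L e r * fall L e r₀))      ∎
      where
      s₁ : ∀ a b c d → a * (b * (c * d)) ≡ a * b * c * d
      s₁ = solve-∀
      s₂ : ∀ a b c d → a * (b * c * d) ≡ b * d * (a * c)
      s₂ = solve-∀
      s₃ : ∀ a b c d → a * b * (c * d) ≡ a * (c * (b * d))
      s₃ = solve-∀

-- Covering most positions by segments

module Covering {n k X : ℕ} (𝒫 : Pattern n k X) (0<k : 0 < k) (D′ : ℕ) (L : ℕ) .{{_ : NonZero L}} (d s : ℕ)
  (1+d≡ : suc d ≡ (6 * D′ + 3) * s) (many : n * (n * n) * n < 2 ^ℕ s)
  (S₀ : Core.Partial 𝒫) (P₀ T ρ : ℕ)
  (below₀ : ∀ {y} → Core.Partial.F S₀ y ≡ true → y < P₀) (end : P₀ + T * (k + L) + k ≤ n)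
  (enough : T * L + ρ ≤ count (Core.Partial.R S₀))
  (density : 12 * k * suc D′ * X ≤ (6 * D′ + 3) * count (Core.Partial.R S₀))
  (ρ-d : 24 * k * suc D′ * (suc d * L) ≤ ρ) (ρ-L : 8 * suc D′ * L ≤ ρ) (ρ>d : suc d * L < ρ) where

  open Pattern 𝒫
  open Core 𝒫
  open Partial
  open Segments 𝒫 0<k

  private
    D = suc D′
    r₀ = count (R S₀)

  -- `drift` says, without division, that the potential divided by `fall L (suc d)` of the number of
  -- free vertices has not grown since `S₀`.
  record Progress (τ : ℕ) (S : Partial) : Set where
    field
      extends : S₀ ⊑ S
      below   : ∀ {y} → F S y ≡ true → y < P₀ + τ * (k + L)
      size    : count (R S) + τ * L ≡ r₀
      drift   : potential L d (R S) * fall L (suc d) r₀ ≤ potential L d (R S₀) * fall L (suc d) (count (R S))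

  -- The leading factor is bounded crudely by `n`; the other `suc d` match the degree in which `X`
  -- is compared with `r₀`.
  initial : potential L d (R S₀) ≤ n * (n * n) * n * fall L (suc d) X
  initial = ≤-trans (sum≤* (λ t → fall L (2 + d) (count (R S₀ ∩ avoided t))) λ t → *-mono-≤ (count≤n (R S₀ ∩ avoided t))
      (fall-mono L (suc d) (≤-trans (m∸n≤m _ L) (sparse t))))
    (≤-reflexive (sym (*-assoc (n * (n * n)) n _)))
    where
    sparse : ∀ t → count (R S₀ ∩ avoided t) ≤ X
    sparse t = missing-on (R S₀) (toℕ (proj₁ (remQuot {n} (n * n) t))) (toℕ (proj₁ (remQuot {n} n (proj₂ (remQuot {n} (n * n) t)))))
                 (proj₂ (remQuot {n} n (proj₂ (remQuot {n} (n * n) t))))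

  stays-large : ∀ {τ S} → τ ≤ T → Progress τ S → ρ ≤ count (R S)
  stays-large {τ} {S} τ≤T π = +-cancelʳ-≤ (τ * L) ρ _ (begin
    ρ + τ * L          ≤⟨ +-monoʳ-≤ ρ (*-monoˡ-≤ L τ≤T) ⟩
    ρ + T * L          ≡⟨ +-comm ρ _ ⟩
    T * L + ρ          ≤⟨ enough ⟩
    r₀                 ≡⟨ Progress.size π ⟨
    count (R S) + τ * L ∎)
    where open ≤-Reasoning

  -- After multiplication by `4 * D`, the bound of `sparse-bound` has a margin of `r`, and by `ρ-L`
  -- this margin covers the term `8 * D * L` coming from distinctness.
  stays-sparse : ∀ {τ S} → τ ≤ T → Progress τ S → ∀ t → 2 * (k * count (R S ∩ avoided t) + L) ≤ count (R S)
  stays-sparse {τ} {S} τ≤T π t = *-cancelˡ-≤ (4 * D) (begin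
    4 * D * (2 * (k * x + L))       ≡⟨ s₁ D k x L ⟩
    8 * k * D * x + 8 * D * L       ≤⟨ +-monoʳ-≤ _ (≤-trans ρ-L ρ≤r) ⟩
    8 * k * D * x + r               ≤⟨ sparse-bound L k D′ s {X} {n} {r₀} {r} {x} {potential L d (R S₀)} {n * (n * n)} 0<k
                                        (at-e (λ e → fall L (suc e) x * fall L e r₀ ≤ potential L d (R S₀) * fall L e r)
                                          (≤-trans (*-monoˡ-≤ (fall L (suc d) r₀) (term≤sum (λ t → fall L (2 + d) (count (R S ∩ avoided t))) t))
                                                   (Progress.drift π)))
                                        (at-e (λ e → potential L d (R S₀) ≤ n * (n * n) * n * fall L e X) initial)
                                        density
                                        (at-e (λ e → e * L < r₀) (<-≤-trans ρ>d (≤-trans (m≤n+m ρ _) enough)))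
                                        (at-e (λ e → e * L < r) (<-≤-trans ρ>d ρ≤r)) many
                                        (at-e (λ e → 24 * k * D * (e * L) ≤ r) (≤-trans ρ-d ρ≤r)) ⟩
    4 * D * r                       ∎)
    where
    open ≤-Reasoning
    x = count (R S ∩ avoided t)
    r = count (R S)
    ρ≤r : ρ ≤ r
    ρ≤r = stays-large {τ} {S} τ≤T π
    at-e : (P : ℕ → Set) → P (suc d) → P ((6 * D′ + 3) * s)
    at-e P = subst P 1+d≡
    s₁ : ∀ D k x L → 4 * D * (2 * (k * x + L)) ≡ 8 * k * D * x + 8 * D * L
    s₁ = solve-∀

  private
    assemble : ∀ {τ S S′} → Progress τ S → 0 < count (R S) → S ⊑ S′ → (∀ {y} → F S′ y ≡ true → y < P₀ + τ * (k + L) + k + L) →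
      count (R S′) + L ≡ count (R S) →
      count (R S) * potential L d (R S′) ≤ (count (R S) ∸ (1 + d) * L) * potential L d (R S) → Progress (suc τ) S′
    assemble {τ} {S} {S′} π r>0 ext below′ size le = record
      { extends = ⊑-trans {S₀} {S} {S′} (Progress.extends π) ext
      ; below   = λ {y} Fy → subst (y <_) (s₁ P₀ τ k L) (below′ Fy)
      ; size    = trans (sym (+-assoc (count (R S′)) L _)) (trans (cong (_+ τ * L) size) (Progress.size π))
      ; drift   = drift (count (R S)) (count (R S′)) (potential L d (R S)) (potential L d (R S′)) size r>0 le (Progress.drift π) }
      where
      open ≤-Reasoning
      s₁ : ∀ P τ k L → P + τ * (k + L) + k + L ≡ P + suc τ * (k + L)
      s₁ = solve-∀
      drift : ∀ r r′ p p′ → r′ + L ≡ r → 0 < r → r * p′ ≤ (r ∸ (1 + d) * L) * p →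
              p * fall L (suc d) r₀ ≤ potential L d (R S₀) * fall L (suc d) r → p′ * fall L (suc d) r₀ ≤ potential L d (R S₀) * fall L (suc d) r′
      drift r r′ p p′ r≡ r>0 le le′ = *-cancelˡ-≤ r {{>-nonZero r>0}} (begin
        r * (p′ * f₀)                        ≡⟨ *-assoc r p′ f₀ ⟨
        r * p′ * f₀                          ≤⟨ *-monoˡ-≤ f₀ le ⟩
        m * p * f₀                           ≡⟨ *-assoc m p f₀ ⟩
        m * (p * f₀)                         ≤⟨ *-monoʳ-≤ m le′ ⟩
        m * (Φ₀ * fall L (suc d) r)          ≡⟨ s₂ m Φ₀ _ ⟩
        -- Both products equal `fall L (2 + d) r`, with its last or its first factor split off.
        Φ₀ * (fall L (suc d) r * m)          ≡⟨ cong (Φ₀ *_) (fall-last L (suc d) r) ⟨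
        Φ₀ * (r * fall L (suc d) (r ∸ L))    ≡⟨ cong (λ q → Φ₀ * (r * fall L (suc d) q)) (trans (cong (_∸ L) (sym r≡)) (m+n∸n≡m r′ L)) ⟩
        Φ₀ * (r * fall L (suc d) r′)         ≡⟨ s₃ Φ₀ r _ ⟩
        r * (Φ₀ * fall L (suc d) r′)         ∎)
        where
        m = r ∸ (1 + d) * L
        f₀ = fall L (suc d) r₀
        Φ₀ = potential L d (R S₀)
        s₂ : ∀ a b c → a * (b * c) ≡ b * (c * a)
        s₂ = solve-∀
        s₃ : ∀ a b c → a * (b * c) ≡ b * (a * c)
        s₃ = solve-∀

  segments : ∀ τ → τ ≤ T → ∃ (Progress τ)
  segments zero    _   = S₀ , record
    { extends = λ _ Fy → Fy , refl
    ; below   = λ {y} Fy → subst (y <_) (sym (+-identityʳ P₀)) (below₀ Fy)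
    ; size    = +-identityʳ r₀
    ; drift   = ≤-refl }
  segments (suc τ) τ<T =
    let S , π = segments τ (<⇒≤ τ<T)
        r>0 = ≤-<-trans z≤n (<-≤-trans ρ>d (stays-large (<⇒≤ τ<T) π))
        S′ , ext , below′ , size , le = add-segment L d S (P₀ + τ * (k + L)) (Progress.below π) inside (stays-sparse (<⇒≤ τ<T) π) r>0
    in S′ , assemble π r>0 ext below′ size le
    where
    s₁ : ∀ P τ k L → P + τ * (k + L) + k + L + k ≡ P + suc τ * (k + L) + k
    s₁ = solve-∀
    inside : P₀ + τ * (k + L) + k + L + k ≤ n
    inside = ≤-trans (≤-reflexive (s₁ P₀ τ k L)) (≤-trans (+-monoˡ-≤ k (+-monoʳ-≤ P₀ (*-monoˡ-≤ (k + L) τ<T))) end)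

-- Combining gadgets, segments and absorption

CompleteEmbedding : ∀ {n k X} → Pattern n k X → Set
CompleteEmbedding {n} 𝒫 = ∃ λ (f : ℕ → Fin n) →
  (∀ {x y} → x < n → y < n → f x ≡ f y → x ≡ y) × (∀ {x y} → x < n → y < n → Pattern.ok 𝒫 x y (f x) (f y) ≡ true)

module _ {n k X : ℕ} (𝒫 : Pattern n k X) (2≤k : 2 ≤ k) (0<n : 0 < n) (D′ : ℕ)
  (dense : suc D′ * (2 * k * X) + n ≤ suc D′ * n) (a h g : ℕ) .{{_ : NonZero a}}
  (1+a≡ : suc a ≡ 2 * (2 * suc D′) ^ℕ suc (2 * k)) (g≡ : g ≡ a * (2 * h)) (room : 2 * suc D′ * (g * suc (2 * k)) ≤ n)
  (gw<n : g * suc (2 * k) < n) (tests≤ : n * (n * n ^ℕ (2 * k)) ≤ 2 ^ℕ h)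
  (L : ℕ) .{{_ : NonZero L}} (d s : ℕ) (1+d≡ : suc d ≡ (6 * D′ + 3) * s) (many : n * (n * n) * n < 2 ^ℕ s)
  (T ρ : ℕ) (end : g * suc (2 * k) + T * (k + L) + k ≤ n) (large : T * L + ρ + g * suc (2 * k) ≤ n)
  (ρ-d : 24 * k * suc D′ * (suc d * L) ≤ ρ) (ρ-L : 8 * suc D′ * L ≤ ρ) (ρ>d : suc d * L < ρ)
  (few-left : n ≤ h + T * L + g * suc (2 * k)) where

  open Pattern 𝒫
  open Core 𝒫
  open Partial
  open Absorbers 𝒫 2≤k 0<n (suc D′) dense g room gw<n
  open Absorption 𝒫 2≤k 0<n (suc D′) dense g room gw<n

  private
    0<k : 0 < k
    0<k = ≤-trans (s≤s z≤n) 2≤k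

    -- This is `(1 - 1/2D) ^ 2 ≥ 1 - 1/D`: one factor accounts for the vertices taken by the
    -- gadgets, the other is the density `a / A` from which the covering starts. The surplus is the
    -- term `3 * n`.
    density : ∀ r₀ → r₀ + g * w ≡ n → 12 * k * suc D′ * X ≤ (6 * D′ + 3) * r₀
    density r₀ size = *-cancelˡ-≤ (2 * suc D′) (begin
      2 * suc D′ * (12 * k * suc D′ * X)           ≡⟨ s₁ D′ k X ⟩
      12 * suc D′ * (suc D′ * (2 * k * X))         ≤⟨ *-monoʳ-≤ (12 * suc D′) (+-cancelʳ-≤ n _ _ (≤-trans dense (≤-reflexive (+-comm n (D′ * n))))) ⟩
      12 * suc D′ * (D′ * n)                       ≤⟨ m≤m+n _ (3 * n) ⟩
      12 * suc D′ * (D′ * n) + 3 * n               ≡⟨ s₂ D′ n ⟩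
      (6 * D′ + 3) * (suc (2 * D′) * n)            ≤⟨ *-monoʳ-≤ (6 * D′ + 3) r₀≥ ⟩
      (6 * D′ + 3) * (2 * suc D′ * r₀)             ≡⟨ s₃ (6 * D′ + 3) (2 * suc D′) r₀ ⟩
      2 * suc D′ * ((6 * D′ + 3) * r₀)             ∎)
      where
      open ≤-Reasoning
      s₁ : ∀ d k X → 2 * suc d * (12 * k * suc d * X) ≡ 12 * suc d * (suc d * (2 * k * X))
      s₁ = solve-∀
      s₂ : ∀ d n → 12 * suc d * (d * n) + 3 * n ≡ (6 * d + 3) * (suc (2 * d) * n)
      s₂ = solve-∀
      s₃ : ∀ a b c → a * (b * c) ≡ b * (a * c)
      s₃ = solve-∀
      s₄ : ∀ d n → suc (2 * d) * n + n ≡ 2 * suc d * n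
      s₄ = solve-∀
      r₀≥ : suc (2 * D′) * n ≤ 2 * suc D′ * r₀
      r₀≥ = +-cancelʳ-≤ n _ _ (begin
        suc (2 * D′) * n + n                       ≡⟨ s₄ D′ n ⟩
        2 * suc D′ * n                             ≡⟨ cong (2 * suc D′ *_) size ⟨
        2 * suc D′ * (r₀ + g * w)                  ≡⟨ *-distribˡ-+ (2 * suc D′) r₀ (g * w) ⟩
        2 * suc D′ * r₀ + 2 * suc D′ * (g * w)     ≤⟨ +-monoʳ-≤ (2 * suc D′ * r₀) room ⟩
        2 * suc D′ * r₀ + n                        ∎)

    finish : ∀ {S₀ S} → Gadgets a g S₀ → S₀ ⊑ S → count (R S) + T * L ≡ count (R S₀) → Absorbing (φ S₀) (λ _ → false) h S
    finish {S₀} {S} G ext size = record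
      { filled     = λ y< → proj₁ (ext _ (Gadgets.filled G y<))
      ; neighbours = λ i<g s<2k → proj₂ (ext _ (Gadgets.filled G (in-block i<g (skip≤ s<2k))))
      ; unused     = λ i<g _ → proj₂ (ext _ (Gadgets.filled G (in-block i<g (m≤m+n k _))))
      ; budget     = subst (λ z → z + count (R S) ≤ h) (sym (trans (∑<-const g 0) (*-zeroʳ g)))
          (+-cancelʳ-≤ (T * L + g * w) _ _ (≤-trans
            (≤-reflexive (trans (sym (+-assoc (count (R S)) _ _)) (trans (cong (_+ g * w) size) (Gadgets.size G))))
            (≤-trans few-left (≤-reflexive (+-assoc h _ _))))) }

  complete-embedding : CompleteEmbedding 𝒫
  complete-embedding =
    let S₀ , G = gadgets a 1+a≡ g ≤-refl
        S , π = Covering.segments 𝒫 0<k D′ L d s 1+d≡ many S₀ (g * w) T ρ (Gadgets.below G) end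
                  (+-cancelʳ-≤ (g * w) _ _ (≤-trans large (≤-reflexive (sym (Gadgets.size G)))))
                  (density (count (R S₀)) (Gadgets.size G)) ρ-d ρ-L ρ>d T ≤-refl
    in absorb (φ S₀) h (many-hits a h 1+a≡ g≡ tests≤ G) (count (R S)) (λ _ → false) S
         (finish G (Covering.Progress.extends π) (Covering.Progress.size π)) refl

-- Choice of the constants

module Constants (k D′ : ℕ) (2≤k : 2 ≤ k) where

  -- With z = n / K, every test is hit by at least E * z gadgets, and the gadgets
  -- fill at most n / 2D positions by the choice of J.  Gaps of length k between
  -- segments of length L make up a 1/J share of the positions, which is
  -- about E′ * z of them, and at least Q * z vertices stay free until the end.
  D w M a J′ J L a₂ Q E′ E K e : ℕ
  D  = suc D′
  w  = suc (2 * k)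
  M  = (2 * D) ^ℕ w
  a  = pred (2 * M)
  J′ = 16 * D * M * w
  J  = suc J′
  L  = k * J′
  a₂ = 6 * D′ + 3
  Q  = 24 * k * D * (a₂ * L)
  E′ = 2 * Q
  E  = suc E′
  K  = J * E′
  e  = 2 + 2 * k

  instance
    k≢0 : NonZero k
    k≢0 = >-nonZero (≤-trans (s≤s z≤n) 2≤k)
    M≢0 : NonZero M
    M≢0 = m^n≢0 (2 * D) w {{_}}
    2M≢0 : NonZero (2 * M)
    2M≢0 = m*n≢0 2 M
    J′≢0 : NonZero J′
    J′≢0 = m*n≢0 (16 * D * M) w {{m*n≢0 (16 * D) M}}
    L≢0 : NonZero L
    L≢0 = m*n≢0 k J′
    a₂≢0 : NonZero a₂
    a₂≢0 = >-nonZero (≤-trans (s≤s z≤n) (m≤n+m 3 (6 * D′)))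
    Q≢0 : NonZero Q
    Q≢0 = m*n≢0 (24 * k * D) (a₂ * L) {{m*n≢0 (24 * k) D {{m*n≢0 24 k}}}} {{m*n≢0 a₂ L}}
    E′≢0 : NonZero E′
    E′≢0 = m*n≢0 2 Q
    K≢0 : NonZero K
    K≢0 = m*n≢0 J E′
    Λ≢0 : NonZero (k + L)
    Λ≢0 = >-nonZero (≤-trans (>-nonZero⁻¹ k) (m≤m+n k L))

  1+a≡2M : suc a ≡ 2 * M
  1+a≡2M = suc-pred (2 * M)

  a≢0 : NonZero a
  a≢0 = >-nonZero (s≤s⁻¹ (≤-trans (*-monoʳ-≤ 2 (>-nonZero⁻¹ M)) (≤-reflexive (sym 1+a≡2M))))

  -- The first summand gives `n ^ e < 2 ^ z`. The second bounds the rounding losses in `few-left`;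
  -- they are covered by the one extra `z` in `h = (1 + E′) * z`.
  z₀ : ℕ
  z₀ = suc (proj₁ (polynomial≤2^ K e)) + (k + E′ + (k + L))

  module _ (n : ℕ) (large : K * z₀ ≤ n) where

    open ≤-Reasoning

    z h g T ρ : ℕ
    z = n / K
    h = E * z
    g = a * (2 * h)
    T = (n ∸ (g * w + k)) / (k + L)
    ρ = Q * z

    z≥ : z₀ ≤ z
    z≥ = subst (_≤ z) (trans (cong (_/ K) (*-comm K z₀)) (m*n/n≡m z₀ K)) (/-monoˡ-≤ K large)

    z>0 : 0 < z
    z>0 = ≤-trans (s≤s z≤n) z≥

    Kz≤n : K * z ≤ n
    Kz≤n = ≤-trans (≤-reflexive (*-comm K z)) (m/n*n≤m n K)

    n<K[1+z] : n < K * suc z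
    n<K[1+z] = begin-strict
      n                  ≡⟨ m≡m%n+[m/n]*n n K ⟩
      n % K + z * K      <⟨ +-monoˡ-< (z * K) (m%n<n n K) ⟩
      suc z * K          ≡⟨ *-comm (suc z) K ⟩
      K * suc z          ∎

    n>0 : 0 < n
    n>0 = ≤-trans (*-mono-≤ (>-nonZero⁻¹ K) z>0) Kz≤n

    -- The exponent is that of the number of tests. As it is at least 4, the same estimate serves
    -- the covering, where `n ^ 3` sets and a crude factor `n` must be beaten.
    n^e<2^z : n ^ℕ e < 2 ^ℕ z
    n^e<2^z = <-≤-trans (^-monoˡ-< e n<K[1+z]) (proj₂ (polynomial≤2^ K e) z (≤-trans (≤-trans (n≤1+n _) (m≤m+n _ (k + E′ + (k + L)))) z≥))

    tests≤ : n * (n * n ^ℕ (2 * k)) ≤ 2 ^ℕ h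
    tests≤ = ≤-trans (<⇒≤ n^e<2^z) (^-monoʳ-≤ 2 (m≤n*m z E))

    many : n * (n * n) * n < 2 ^ℕ z
    many = ≤-<-trans (≤-trans (≤-reflexive (s₁ n)) (^-monoʳ-≤ n {{>-nonZero n>0}} (+-monoʳ-≤ 2 (≤-trans 2≤k (m≤m+n k _))))) n^e<2^z
      where
      s₁ : ∀ n → n * (n * n) * n ≡ n * (n * (n * (n * 1)))
      s₁ = solve-∀

    -- The left side is at most `8 * D * M * w * E * z`. With `E ≤ 2 * E′` this explains the factor
    -- 16 in `J′`.
    room : 2 * D * (g * w) ≤ n
    room = begin
      2 * D * (a * (2 * h) * w)             ≤⟨ *-monoʳ-≤ (2 * D) (*-monoˡ-≤ w (*-monoˡ-≤ (2 * h) a≤2M)) ⟩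
      2 * D * (2 * M * (2 * (E * z)) * w)   ≡⟨ s₁ D M E z w ⟩
      8 * D * M * w * E * z                 ≤⟨ *-monoˡ-≤ z (*-monoʳ-≤ (8 * D * M * w) E≤2E′) ⟩
      8 * D * M * w * (2 * E′) * z          ≡⟨ s₂ D M w E′ z ⟩
      J′ * E′ * z                           ≤⟨ *-monoˡ-≤ z (*-monoˡ-≤ E′ (n≤1+n J′)) ⟩
      K * z                                 ≤⟨ Kz≤n ⟩
      n                                     ∎
      where
      a≤2M : a ≤ 2 * M
      a≤2M = ≤-trans (n≤1+n a) (≤-reflexive 1+a≡2M)
      E≤2E′ : E ≤ 2 * E′
      E≤2E′ = ≤-trans (+-monoˡ-≤ E′ (>-nonZero⁻¹ E′)) (≤-reflexive (cong (E′ +_) (sym (+-identityʳ E′))))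
      s₁ : ∀ D M E z w → 2 * D * (2 * M * (2 * (E * z)) * w) ≡ 8 * D * M * w * E * z
      s₁ = solve-∀
      s₂ : ∀ D M w E z → 8 * D * M * w * (2 * E) * z ≡ 16 * D * M * w * E * z
      s₂ = solve-∀

    2gw≤n : 2 * (g * w) ≤ n
    2gw≤n = ≤-trans (*-monoˡ-≤ (g * w) (*-monoʳ-≤ 2 {1} {D} (s≤s z≤n))) room

    gw<n : g * w < n
    gw<n = ≰⇒> λ n≤gw → <⇒≱ (m<m+n n n>0) (≤-trans (+-mono-≤ n≤gw n≤gw) (≤-trans (≤-reflexive (cong (g * w +_) (sym (+-identityʳ (g * w))))) 2gw≤n))

    k+gw≤n : g * w + k ≤ n
    k+gw≤n = *-cancelˡ-≤ 2 (begin
      2 * (g * w + k)            ≡⟨ *-distribˡ-+ 2 (g * w) k ⟩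
      2 * (g * w) + 2 * k        ≤⟨ +-mono-≤ 2gw≤n 2k≤n ⟩
      n + n                      ≡⟨ cong (n +_) (+-identityʳ n) ⟨
      2 * n                      ∎)
      where
      k≤z : k ≤ z
      k≤z = ≤-trans (≤-trans (m≤m+n k E′) (m≤m+n _ (k + L))) (≤-trans (m≤n+m (k + E′ + (k + L)) (suc (proj₁ (polynomial≤2^ K e)))) z≥)
      2k≤n : 2 * k ≤ n
      2k≤n = begin
        2 * k       ≤⟨ *-mono-≤ (≤-trans (*-monoʳ-≤ 2 (>-nonZero⁻¹ Q)) (m≤n*m E′ J)) k≤z ⟩
        K * z       ≤⟨ Kz≤n ⟩
        n           ∎

    TΛ≤ : T * (k + L) ≤ n ∸ (g * w + k)
    TΛ≤ = m/n*n≤m (n ∸ (g * w + k)) (k + L)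

    end : g * w + T * (k + L) + k ≤ n
    end = begin
      g * w + T * (k + L) + k              ≡⟨ s₁ (g * w) _ k ⟩
      g * w + k + T * (k + L)              ≤⟨ +-monoʳ-≤ (g * w + k) TΛ≤ ⟩
      g * w + k + (n ∸ (g * w + k))        ≡⟨ m+[n∸m]≡n k+gw≤n ⟩
      n                                    ∎
      where
      s₁ : ∀ a b c → a + b + c ≡ a + c + b
      s₁ = solve-∀

    -- Since `k + L = k * J`, one has `J * L = J′ * (k + L)`, so segments occupy a `J′ / J` share of
    -- what they span. Multiplying by `2 * J` frees `2 * n`: one `n` pays for the gadgets'
    -- positions, the other for `2 * J * ρ = K * z`, which is why `E′ = 2 * Q`.
    TL+ρ : T * L + ρ + g * w ≤ n
    TL+ρ = *-cancelˡ-≤ (2 * J) (begin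
      2 * J * (T * (k * J′) + Q * z + P)                  ≡⟨ s₁ J′ T k (Q * z) P ⟩
      2 * J′ * (P + T * (k + k * J′)) + 2 * J * (Q * z) + 2 * P ≤⟨ +-mono-≤ (+-mono-≤ (*-monoʳ-≤ (2 * J′) (≤-trans (m≤m+n _ k) end)) Kz′) 2gw≤n ⟩
      2 * J′ * n + n + n                                  ≡⟨ s₂ J′ n ⟩
      2 * J * n                                           ∎)
      where
      P = g * w
      s₁ : ∀ J′ T k q P → 2 * suc J′ * (T * (k * J′) + q + P) ≡ 2 * J′ * (P + T * (k + k * J′)) + 2 * suc J′ * q + 2 * P
      s₁ = solve-∀
      s₂ : ∀ J′ n → 2 * J′ * n + n + n ≡ 2 * suc J′ * n
      s₂ = solve-∀
      s₃ : ∀ J Q z → 2 * J * (Q * z) ≡ J * (2 * Q) * z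
      s₃ = solve-∀
      Kz′ : 2 * J * (Q * z) ≤ n
      Kz′ = ≤-trans (≤-reflexive (s₃ J Q z)) Kz≤n

    instance
      z≢0 : NonZero z
      z≢0 = >-nonZero z>0
      a₂z≢0 : NonZero (a₂ * z)
      a₂z≢0 = m*n≢0 a₂ z

    d : ℕ
    d = pred (a₂ * z)

    1+d≡ : suc d ≡ a₂ * z
    1+d≡ = suc-pred (a₂ * z)

    ρ-d : 24 * k * D * (suc d * L) ≤ ρ
    ρ-d = ≤-reflexive (trans (cong (λ e → 24 * k * D * (e * L)) 1+d≡) (s₁ (24 * k * D) a₂ z L))
      where
      s₁ : ∀ a b c d → a * (b * c * d) ≡ a * (b * d) * c
      s₁ = solve-∀

    ρ-L : 8 * D * L ≤ ρ
    ρ-L = begin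
      8 * D * L               ≤⟨ *-monoˡ-≤ L (*-monoˡ-≤ D (≤-trans (m≤m+n 8 16) (m≤m*n 24 k))) ⟩
      24 * k * D * L          ≤⟨ *-monoʳ-≤ (24 * k * D) (m≤n*m L a₂) ⟩
      Q                       ≤⟨ m≤m*n Q z ⟩
      ρ                       ∎

    ρ>d : suc d * L < ρ
    ρ>d = begin-strict
      suc d * L                        <⟨ m<n*m (suc d * L) {{m*n≢0 (suc d) L}} (24 * k * D) 1<24kD ⟩
      24 * k * D * (suc d * L)         ≤⟨ ρ-d ⟩
      ρ                                ∎
      where
      1<24kD : 1 < 24 * k * D
      1<24kD = ≤-trans (≤-trans (m≤m+n 2 22) (m≤m*n 24 k)) (m≤m*n (24 * k) D)
      m<n*m : ∀ m → .{{NonZero m}} → ∀ n → 1 < n → m < n * m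
      m<n*m m n 1<n = subst (_< n * m) (*-identityˡ m) (*-monoˡ-< m 1<n)

    -- The gaps contain `T * k` positions, a `1 / J` share of at most `n`, hence at most
    -- `E′ * suc z`. The remaining losses are constant: the unspanned end and the remainder of the
    -- division defining `T`.
    few-left : n ≤ h + T * L + g * w
    few-left = begin
      n                                                  ≡⟨ m+[n∸m]≡n k+gw≤n ⟨
      P + k + m                                          ≡⟨ cong (P + k +_) (m≡m%n+[m/n]*n m (k + L)) ⟩
      P + k + (m % (k + L) + T * (k + L))                ≤⟨ +-monoʳ-≤ (P + k) (+-monoˡ-≤ _ (<⇒≤ (m%n<n m (k + L)))) ⟩
      P + k + (k + L + T * (k + L))                      ≡⟨ s₁ P k L T ⟩
      T * k + k + (k + L) + T * L + P                    ≤⟨ +-monoˡ-≤ P (+-monoˡ-≤ (T * L) (+-monoˡ-≤ (k + L) (+-monoˡ-≤ k Tk≤))) ⟩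
      E′ * suc z + k + (k + L) + T * L + P               ≡⟨ s₂ E′ z k L (T * L) P ⟩
      k + E′ + (k + L) + E′ * z + T * L + P              ≤⟨ +-monoˡ-≤ P (+-monoˡ-≤ (T * L) (+-monoˡ-≤ (E′ * z)
                                                              (≤-trans (m≤n+m (k + E′ + (k + L)) (suc (proj₁ (polynomial≤2^ K e)))) z≥))) ⟩
      h + T * L + P                                      ∎
      where
      P = g * w
      m = n ∸ (g * w + k)
      s₁ : ∀ P k L T → P + k + (k + L + T * (k + L)) ≡ T * k + k + (k + L) + T * L + P
      s₁ = solve-∀
      s₂ : ∀ E z k L q P → E * suc z + k + (k + L) + q + P ≡ k + E + (k + L) + E * z + q + P
      s₂ = solve-∀
      s₃ : ∀ J′ T k → suc J′ * (T * k) ≡ T * (k + k * J′)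
      s₃ = solve-∀
      Tk≤ : T * k ≤ E′ * suc z
      Tk≤ = *-cancelˡ-≤ J (begin
        J * (T * k)              ≡⟨ s₃ J′ T k ⟩
        T * (k + k * J′)         ≤⟨ TΛ≤ ⟩
        m                        ≤⟨ m∸n≤m n (g * w + k) ⟩
        n                        ≤⟨ <⇒≤ n<K[1+z] ⟩
        K * suc z                ≡⟨ *-assoc J E′ (suc z) ⟩
        J * (E′ * suc z)         ∎)

    embedding : ∀ {X} (𝒫 : Pattern n k X) → D * (2 * k * X) + n ≤ D * n → CompleteEmbedding 𝒫
    embedding 𝒫 dense = complete-embedding 𝒫 2≤k n>0 D′ dense a h g {{a≢0}} 1+a≡2M refl room gw<n tests≤
      L d z 1+d≡ many T ρ end TL+ρ ρ-d ρ-L ρ>d few-left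

-- From the minimum degree to a bound on non-neighbours

length-filter-tabulate : ∀ {n} {A : Set} {P : A → Set} (P? : Decidable P) (f : Fin n → A) →
                         length (filter P? (tabulate f)) ≡ count (λ i → does (P? (f i)))
length-filter-tabulate {zero}  P? f = refl
length-filter-tabulate {suc n} P? f with does (P? (f zero))
... | true  = cong suc (length-filter-tabulate P? (f ∘ suc))
... | false = length-filter-tabulate P? (f ∘ suc)

degree-complement : ∀ {n} (G : Graph n) v → degree G v + count (λ u → not (does (Graph._~?_ G v u))) ≡ n
degree-complement {n} G v = begin
  degree G v + count (not ∘ nbr)           ≡⟨ cong (_+ count (not ∘ nbr)) (length-filter-tabulate (Graph._~?_ G v) (λ u → u)) ⟩
  count nbr + count (not ∘ nbr)            ≡⟨ count-split (λ _ → true) nbr ⟩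
  sum {n} (λ _ → 1)                        ≡⟨ sum-const n 1 ⟩
  n * 1                                    ≡⟨ *-identityʳ n ⟩
  n                                        ∎
  where
  open ≡-Reasoning
  nbr : Fin n → Bool
  nbr u = does (Graph._~?_ G v u)

δ≤degree : ∀ {n m} (𝐆 : Fin m → Graph n) i v → δ 𝐆 ≤ degree (𝐆 i) v
δ≤degree {n} 𝐆 i v = ≤-trans
  (lookup (min≤xs n (List.map (minDegree ∘ 𝐆) (allFin _))) (∈-map⁺ (minDegree ∘ 𝐆) (∈-allFin i)))
  (lookup (min≤xs n (List.map (degree (𝐆 i)) (allFin n))) (∈-map⁺ (degree (𝐆 i)) (∈-allFin v)))

non-neighbours≤ : ∀ {n m} (𝐆 : Fin m → Graph n) i v → count (λ u → not (does (Graph._~?_ (𝐆 i) v u))) ≤ n ∸ δ 𝐆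
non-neighbours≤ {n} 𝐆 i v = m+n≤o⇒m≤o∸n _ (begin
  count nbrᶜ + δ 𝐆                  ≤⟨ +-monoʳ-≤ (count nbrᶜ) (δ≤degree 𝐆 i v) ⟩
  count nbrᶜ + degree (𝐆 i) v       ≡⟨ +-comm (count nbrᶜ) _ ⟩
  degree (𝐆 i) v + count nbrᶜ       ≡⟨ degree-complement (𝐆 i) v ⟩
  n                                 ∎)
  where
  open ≤-Reasoning
  nbrᶜ : Fin n → Bool
  nbrᶜ u = not (does (Graph._~?_ (𝐆 i) v u))

-- Adding `suc D′ * n` to both sides cancels the only negative term, so that the inequality can be
-- stated in the natural numbers. Here `suc j` plays the role of `2 * k`.
clear-denominators : ∀ j p D′ n d →
  ((ℚᵘ.1ℚᵘ ℚᵘ.+ ℚᵘ.- mkℚᵘ (pos 1) j) ℚᵘ.+ mkℚᵘ (pos (suc p)) D′) ℚᵘ.* mkℚᵘ (pos n) 0 ℚᵘ.≤ mkℚᵘ (pos d) 0 →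
  (suc j * suc D′ + suc p * suc j) * n ≤ suc j * suc D′ * d + suc D′ * n
clear-denominators j p D′ n d (*≤* le) = ℤ.drop‿+≤+ (subst₂ ℤ._≤_ lhs rhs (ℤ.+-monoˡ-≤ (pos (suc D′) ℤ.* pos n) le))
  where
  s₁ : ∀ K K′ D P N → K′ ≡ K →
       ((pos 1 ℤ.* K ℤ.+ (ℤ.- pos 1) ℤ.* pos 1) ℤ.* D ℤ.+ P ℤ.* K′) ℤ.* N ℤ.* pos 1 ℤ.+ D ℤ.* N ≡ (K ℤ.* D ℤ.+ P ℤ.* K) ℤ.* N
  s₁ K K′ D P N refl = go K D P N
    where
    go : ∀ K D P N → ((pos 1 ℤ.* K ℤ.+ (ℤ.- pos 1) ℤ.* pos 1) ℤ.* D ℤ.+ P ℤ.* K) ℤ.* N ℤ.* pos 1 ℤ.+ D ℤ.* N ≡ (K ℤ.* D ℤ.+ P ℤ.* K) ℤ.* N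
    go = ℤ-Solver.solve-∀
  lhs = trans (s₁ (pos (suc j)) (pos (1 * suc j)) (pos (suc D′)) (pos (suc p)) (pos n) (cong pos (*-identityˡ (suc j)))) (trans
    (cong (ℤ._* pos n) (trans (cong₂ ℤ._+_ (sym (ℤ.pos-* (suc j) (suc D′))) (sym (ℤ.pos-* (suc p) (suc j))))
      (sym (ℤ.pos-+ (suc j * suc D′) (suc p * suc j)))))
    (sym (ℤ.pos-* (suc j * suc D′ + suc p * suc j) n)))
  rhs : pos d ℤ.* pos (1 * suc j * suc D′ * 1) ℤ.+ pos (suc D′) ℤ.* pos n ≡ pos (suc j * suc D′ * d + suc D′ * n)
  rhs = trans (cong₂ ℤ._+_ (sym (ℤ.pos-* d (1 * suc j * suc D′ * 1))) (sym (ℤ.pos-* (suc D′) n)))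
    (trans (sym (ℤ.pos-+ (d * (1 * suc j * suc D′ * 1)) (suc D′ * n))) (cong (λ x → pos (x + suc D′ * n)) (s₂ (suc j) (suc D′) d)))
    where
    s₂ : ∀ K D d → d * (1 * K * D * 1) ≡ K * D * d
    s₂ = solve-∀

-- The hypothesis on δ only enters through the denominator of a positive
-- rational r = p / (1 + D′) below α.
cleared : ∀ k .{{_ : NonZero k}} p D′ .(coprime : Coprime (suc p) (suc D′)) n d →
  (1-1/2k k ℚ.+ mkℚ (pos (suc p)) D′ coprime) ℚ.* fromℕ n ℚ.≤ fromℕ d →
  (2 * k * suc D′ + suc p * (2 * k)) * n ≤ 2 * k * suc D′ * d + suc D′ * n
cleared k p D′ coprime n d le = subst (λ K → (K * suc D′ + suc p * K) * n ≤ K * suc D′ * d + suc D′ * n) (suc-pred (2 * k) {{2k≢0}})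
  (clear-denominators (pred (2 * k)) p D′ n d
    (transfer (ℚ._/_ (pos 1) (2 * k) {{2k≢0}}) (mkℚ (pos (suc p)) D′ coprime) (fromℕ n) (fromℕ d)
      (toℚᵘ-/ (pos 1) (2 * k) {{2k≢0}}) (toℚᵘ-/ (pos n) 1) (toℚᵘ-/ (pos d) 1) le))
  where
  2k≢0 : NonZero (2 * k)
  2k≢0 = m*n≢0 2 k
  toℚᵘ-/ : ∀ i m .{{_ : NonZero m}} → toℚᵘ (i ℚ./ m) ≃ mkℚᵘ i (pred m)
  toℚᵘ-/ i (suc j) = ℚ.toℚᵘ-fromℚᵘ (mkℚᵘ i j)
  transfer : ∀ x q N E {xᵘ nᵘ eᵘ} → toℚᵘ x ≃ xᵘ → toℚᵘ N ≃ nᵘ → toℚᵘ E ≃ eᵘ →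
    (ℚ.1ℚ ℚ.- x ℚ.+ q) ℚ.* N ℚ.≤ E → ((ℚᵘ.1ℚᵘ ℚᵘ.+ ℚᵘ.- xᵘ) ℚᵘ.+ toℚᵘ q) ℚᵘ.* nᵘ ℚᵘ.≤ eᵘ
  transfer x q N E x≃ N≃ E≃ le = ℚᵘ.≤-respʳ-≃ E≃ (ℚᵘ.≤-respˡ-≃ homo (ℚ.toℚᵘ-mono-≤ le))
    where
    homo = ℚᵘ.≃-trans (ℚ.toℚᵘ-homo-* (ℚ.1ℚ ℚ.- x ℚ.+ q) N)
      (ℚᵘ.*-cong (ℚᵘ.≃-trans (ℚ.toℚᵘ-homo-+ (ℚ.1ℚ ℚ.- x) q)
        (ℚᵘ.+-congˡ (toℚᵘ q) (ℚᵘ.≃-trans (ℚ.toℚᵘ-homo-+ ℚ.1ℚ (ℚ.- x))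
          (ℚᵘ.+-congʳ ℚᵘ.1ℚᵘ (ℚᵘ.≃-trans (ℚ.toℚᵘ-homo‿- x) (ℚᵘ.-‿cong x≃)))))) N≃)

dense-bound : ∀ k .{{_ : NonZero k}} (α : ℝ) → Positive α →
  ∃ λ D′ → ∀ n m (𝐆 : Fin m → Graph n) → δ 𝐆 ≥⟨ 1-1/2k k + α ⟩· n → suc D′ * (2 * k * (n ∸ δ 𝐆)) + n ≤ suc D′ * n
dense-bound k α α>0 = go (Equivalence.to (ℝ.L-round α 0ℚ) α>0)
  where
  open ≤-Reasoning
  bound : ∀ p D′ n d → d ≤ n → (2 * k * suc D′ + suc p * (2 * k)) * n ≤ 2 * k * suc D′ * d + suc D′ * n → suc D′ * (2 * k * (n ∸ d)) + n ≤ suc D′ * n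
  bound p D′ n d d≤n le = +-cancelʳ-≤ (2 * k * suc D′ * d) _ _ (begin
    suc D′ * (2 * k * (n ∸ d)) + n + 2 * k * suc D′ * d      ≡⟨ s₂ (suc D′) k (n ∸ d) n d ⟩
    -- Of the numerator only `suc p * (2 * k) ≥ 1` is retained.
    2 * k * suc D′ * ((n ∸ d) + d) + 1 * n                   ≤⟨ +-mono-≤ (≤-reflexive (cong (2 * k * suc D′ *_) (m∸n+n≡m d≤n)))
                                                                  (*-monoˡ-≤ n (*-mono-≤ {1} {suc p} {1} {2 * k} (s≤s z≤n) (>-nonZero⁻¹ (2 * k) {{m*n≢0 2 k}}))) ⟩
    2 * k * suc D′ * n + suc p * (2 * k) * n                 ≡⟨ *-distribʳ-+ n (2 * k * suc D′) _ ⟨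
    (2 * k * suc D′ + suc p * (2 * k)) * n                   ≤⟨ le ⟩
    2 * k * suc D′ * d + suc D′ * n                          ≡⟨ +-comm (2 * k * suc D′ * d) _ ⟩
    suc D′ * n + 2 * k * suc D′ * d                          ∎)
    where
    s₂ : ∀ D k X n d → D * (2 * k * X) + n + 2 * k * D * d ≡ 2 * k * D * (X + d) + 1 * n
    s₂ = solve-∀

  go : (∃ λ r → 0ℚ ℚ.< r × ℝ.L α r) →
    ∃ λ D′ → ∀ n m (𝐆 : Fin m → Graph n) → δ 𝐆 ≥⟨ 1-1/2k k + α ⟩· n → suc D′ * (2 * k * (n ∸ δ 𝐆)) + n ≤ suc D′ * n
  go (mkℚ (pos zero)  D′ c , ℚ.*<* 0<r , _) = contradiction 0<r λ { (ℤ.+<+ ()) }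
  go (mkℚ (negsuc p) D′ c , ℚ.*<* 0<r , _) = contradiction 0<r λ ()
  go (mkℚ (pos (suc p)) D′ c , _ , r<α) = D′ , λ n m 𝐆 hyp →
    bound p D′ n (δ 𝐆) (min≤⊤ n (List.map (minDegree ∘ 𝐆) (allFin m))) (cleared k p D′ c n (δ 𝐆) (hyp (mkℚ (pos (suc p)) D′ c) r<α))

-- The coloured power of the cycle as a pattern

module _ {n : ℕ} .{{_ : NonZero n}} (k : ℕ) where

  -- Adding `n` before subtracting `k` avoids truncation when `k ≤ n`.
  neighbour : ℕ → ℕ → ℕ
  neighbour x s = (n + x ∸ k + skip k s) % n

  neighbour-left : ∀ {x s} → k ≤ x → x < n → s < k → neighbour x s ≡ x ∸ k + s
  neighbour-left {x} {s} k≤x x<n s<k = begin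
    (n + x ∸ k + skip k s) % n ≡⟨ cong (λ z → (n + x ∸ k + z) % n) (skip-< s<k) ⟩
    (n + x ∸ k + s) % n        ≡⟨ cong (λ z → (z + s) % n) (+-∸-assoc n k≤x) ⟩
    (n + (x ∸ k) + s) % n      ≡⟨ cong (_% n) (solve n (x ∸ k) s) ⟩
    (x ∸ k + s + n) % n        ≡⟨ [m+n]%n≡m%n (x ∸ k + s) n ⟩
    (x ∸ k + s) % n            ≡⟨ m<n⇒m%n≡m (<-trans (<-≤-trans (+-monoʳ-< (x ∸ k) s<k) (≤-reflexive (m∸n+n≡m k≤x))) x<n) ⟩
    x ∸ k + s                  ∎
    where
    open ≡-Reasoning
    solve : ∀ a b c → a + b + c ≡ b + c + a
    solve = solve-∀

  module _ (k≤n : k ≤ n) where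

    private
      back : ∀ x → n + x ∸ k + k ≡ n + x
      back x = m∸n+n≡m (≤-trans k≤n (m≤m+n n x))

    neighbour-right : ∀ {x j} → x + suc j < n → neighbour x (k + j) ≡ x + suc j
    neighbour-right {x} {j} x+1+j<n = begin
      (n + x ∸ k + skip k (k + j)) % n   ≡⟨ cong (λ z → (n + x ∸ k + z) % n) (skip-≥ (m≤m+n k j)) ⟩
      (n + x ∸ k + suc (k + j)) % n      ≡⟨ cong (_% n) (solve (n + x ∸ k) k j) ⟩
      (n + x ∸ k + k + suc j) % n        ≡⟨ cong (λ z → (z + suc j) % n) (back x) ⟩
      (n + x + suc j) % n                ≡⟨ cong (_% n) (solve′ n x (suc j)) ⟩
      (x + suc j + n) % n                ≡⟨ [m+n]%n≡m%n (x + suc j) n ⟩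
      (x + suc j) % n                    ≡⟨ m<n⇒m%n≡m x+1+j<n ⟩
      x + suc j                          ∎
      where
      open ≡-Reasoning
      solve : ∀ a k j → a + suc (k + j) ≡ a + k + suc j
      solve = solve-∀
      solve′ : ∀ a b c → a + b + c ≡ b + c + a
      solve′ = solve-∀

    -- The equation is the congruence `y ≡ x + c - k` modulo `n`, with a multiple of `n` on either
    -- side instead of differences. The offset `c = k` would give `y = x`, and every other one is a
    -- value of `skip`.
    offset-neighbour : ∀ {x y c i j} → x < n → y < n → y ≢ x → c ≤ 2 * k → y + k + i * n ≡ x + c + j * n →
                       ∃ λ s → s < 2 * k × neighbour x s ≡ y
    offset-neighbour {x} {y} {c} {i} {j} x<n y<n y≢x c≤2k eq =
      let s , s<2k , skip≡c = skip-surjective c≢k c≤2k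
      in s , s<2k , trans (cong (λ z → (n + x ∸ k + z) % n) skip≡c) at-c
      where
      open ≡-Reasoning
      c≢k : c ≢ k
      c≢k refl = y≢x (begin
        y                  ≡⟨ m<n⇒m%n≡m y<n ⟨
        y % n              ≡⟨ [m+kn]%n≡m%n y i n ⟨
        (y + i * n) % n    ≡⟨ cong (_% n) (+-cancelʳ-≡ k _ _ (trans (solve y (i * n) k) (trans eq (solve x k (j * n))))) ⟩
        (x + j * n) % n    ≡⟨ [m+kn]%n≡m%n x j n ⟩
        x % n              ≡⟨ m<n⇒m%n≡m x<n ⟩
        x                  ∎)
        where
        solve : ∀ a b c → a + b + c ≡ a + c + b
        solve = solve-∀
      at-c : (n + x ∸ k + c) % n ≡ y
      at-c = begin
        (n + x ∸ k + c) % n            ≡⟨ [m+kn]%n≡m%n (n + x ∸ k + c) j n ⟨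
        (n + x ∸ k + c + j * n) % n    ≡⟨ cong (_% n) (+-cancelʳ-≡ k _ _ (begin
          n + x ∸ k + c + j * n + k      ≡⟨ s₁ (n + x ∸ k) c (j * n) k ⟩
          n + x ∸ k + k + c + j * n      ≡⟨ cong (λ z → z + c + j * n) (back x) ⟩
          n + x + c + j * n              ≡⟨ s₂ n x c (j * n) ⟩
          n + (x + c + j * n)            ≡⟨ cong (n +_) eq ⟨
          n + (y + k + i * n)            ≡⟨ s₃ n y k i ⟩
          y + suc i * n + k              ∎)) ⟩
        (y + suc i * n) % n            ≡⟨ [m+kn]%n≡m%n y (suc i) n ⟩
        y % n                          ≡⟨ m<n⇒m%n≡m y<n ⟩
        y                              ∎
        where
        s₁ : ∀ a b c d → a + b + c + d ≡ a + d + b + c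
        s₁ = solve-∀
        s₂ : ∀ a b c d → a + b + c + d ≡ a + (b + c + d)
        s₂ = solve-∀
        s₃ : ∀ n y k i → n + (y + k + i * n) ≡ y + suc i * n + k
        s₃ = solve-∀

next-offset : ∀ {n} {x y : Fin n} → Next x y → ∃ λ i → toℕ y + i * n ≡ suc (toℕ x)
next-offset {n} {x} {y} (inj₁ y≡1+x) = 0 , trans (+-identityʳ (toℕ y)) y≡1+x
next-offset {n} {x} {y} (inj₂ (1+x≡n , y≡0)) = 1 , trans (cong₂ _+_ y≡0 (+-identityʳ n)) (sym 1+x≡n)

-- A walk of length ℓ in the cycle moves by c − ℓ modulo n, where 0 ≤ c ≤ 2 ℓ.
walk-offset : ∀ {n} ℓ {x y : Fin n} → Walk (C n) ℓ x y →
  ∃ λ c → c ≤ 2 * ℓ × ∃₂ λ i j → toℕ y + ℓ + i * n ≡ toℕ x + c + j * n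
walk-offset zero refl = 0 , z≤n , 0 , 0 , refl
walk-offset {n} (suc ℓ) {x} {y} (z , (_ , inj₁ x→z) , w) =
  let c , c≤ , i , j , eq = walk-offset ℓ w
      a , eq′ = next-offset x→z
  in 2 + c , ≤-trans (+-monoʳ-≤ 2 c≤) (≤-reflexive (sym (*-suc 2 ℓ))) , a + i , j , (begin
    toℕ y + suc ℓ + (a + i) * n                ≡⟨ s₁ (toℕ y) ℓ a i n ⟩
    suc (toℕ y + ℓ + i * n) + a * n            ≡⟨ cong (λ q → suc q + a * n) eq ⟩
    suc (toℕ z + c + j * n) + a * n            ≡⟨ s₂ (toℕ z) c (j * n) (a * n) ⟩
    suc (toℕ z + a * n) + c + j * n            ≡⟨ cong (λ q → suc q + c + j * n) eq′ ⟩
    suc (suc (toℕ x)) + c + j * n              ≡⟨ s₃ (toℕ x) c (j * n) ⟩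
    toℕ x + (2 + c) + j * n                    ∎)
  where
  open ≡-Reasoning
  s₁ : ∀ y ℓ a i n → y + suc ℓ + (a + i) * n ≡ suc (y + ℓ + i * n) + a * n
  s₁ = solve-∀
  s₂ : ∀ z c u v → suc (z + c + u) + v ≡ suc (z + v) + c + u
  s₂ = solve-∀
  s₃ : ∀ x c u → suc (suc x) + c + u ≡ x + (2 + c) + u
  s₃ = solve-∀
walk-offset {n} (suc ℓ) {x} {y} (z , (_ , inj₂ z→x) , w) =
  let c , c≤ , i , j , eq = walk-offset ℓ w
      a , eq′ = next-offset z→x
  in c , ≤-trans c≤ (*-monoʳ-≤ 2 (n≤1+n ℓ)) , i , j + a , (begin
    toℕ y + suc ℓ + i * n                      ≡⟨ cong (_+ i * n) (+-suc (toℕ y) ℓ) ⟩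
    suc (toℕ y + ℓ + i * n)                    ≡⟨ cong suc eq ⟩
    suc (toℕ z + c + j * n)                    ≡⟨⟩
    suc (toℕ z) + c + j * n                    ≡⟨ cong (λ q → q + c + j * n) eq′ ⟨
    toℕ x + a * n + c + j * n                  ≡⟨ s₁ (toℕ x) a n c j ⟩
    toℕ x + c + (j + a) * n                    ∎)
  where
  open ≡-Reasoning
  s₁ : ∀ x a n c j → x + a * n + c + j * n ≡ x + c + (j + a) * n
  s₁ = solve-∀

power-walk : ∀ {n} k → 0 < k → {x y : Fin n} → Adj (C n ^ k) x y → ∃ λ ℓ → ℓ ≤ k × Walk (C n) ℓ x y
power-walk k 0<k (inj₁ e) = 1 , 0<k , _ , e , refl
power-walk k 0<k (inj₂ (d , _ , d≤k , w , _)) = d , d≤k , w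

-- A walk of length `ℓ ≤ k` moves by `c - ℓ`, which is `(c + (k - ℓ)) - k`. This places every edge
-- of the power in the common window of radius `k`.
power-neighbour : ∀ {n} .{{_ : NonZero n}} k → 0 < k → k ≤ n → {x y : Fin n} → Adj (C n ^ k) x y →
  ∃ λ s → s < 2 * k × neighbour {n} k (toℕ x) s ≡ toℕ y
power-neighbour {n} k 0<k k≤n {x} {y} e =
  let ℓ , ℓ≤k , w = power-walk k 0<k e
      c , c≤2ℓ , i , j , eq = walk-offset ℓ w
  in offset-neighbour k k≤n {c = c + (k ∸ ℓ)} {i} {j} (Fin.toℕ<n x) (Fin.toℕ<n y)
       (λ y≡x → Graph.~-irrefl (C n ^ k) (sym (Fin.toℕ-injective y≡x)) e)
       (bound c≤2ℓ ℓ≤k) (begin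
         toℕ y + k + i * n                 ≡⟨ cong (λ q → toℕ y + q + i * n) (m+[n∸m]≡n ℓ≤k) ⟨
         toℕ y + (ℓ + (k ∸ ℓ)) + i * n     ≡⟨ s₁ (toℕ y) ℓ (k ∸ ℓ) (i * n) ⟩
         toℕ y + ℓ + i * n + (k ∸ ℓ)       ≡⟨ cong (_+ (k ∸ ℓ)) eq ⟩
         toℕ x + c + j * n + (k ∸ ℓ)       ≡⟨ s₁ (toℕ x) c (k ∸ ℓ) (j * n) ⟨
         toℕ x + (c + (k ∸ ℓ)) + j * n     ∎)
  where
  open ≡-Reasoning
  s₁ : ∀ a b c d → a + (b + c) + d ≡ a + b + d + c
  s₁ = solve-∀
  bound : ∀ {c ℓ} → c ≤ 2 * ℓ → ℓ ≤ k → c + (k ∸ ℓ) ≤ 2 * k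
  bound {c} {ℓ} c≤ ℓ≤k = ≤-trans (+-mono-≤ c≤ (m≤m+n (k ∸ ℓ) (k ∸ ℓ))) (≤-reflexive (trans (s₂ ℓ (k ∸ ℓ)) (cong (2 *_) (m+[n∸m]≡n ℓ≤k))))
    where
    s₂ : ∀ ℓ p → 2 * ℓ + (p + p) ≡ 2 * (ℓ + p)
    s₂ = solve-∀

module _ {n m : ℕ} .{{_ : NonZero n}} {H : Graph n} (χ : EdgeColouring H m) (𝐆 : Fin m → Graph n) where

  open EdgeColouring χ

  private
    colour-unique : ∀ {x y} (e e′ : Adj H x y) → colour e ≡ colour e′
    colour-unique e e′ = trans (symmetric e (Graph.~-sym H e)) (sym (symmetric e′ (Graph.~-sym H e)))

    -- The decision is an argument because the colour depends on the proof of adjacency that it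
    -- contains; the properties then follow by cases on it.
    allowed : ∀ {x y} → Dec (Adj H x y) → Fin n → Fin n → Bool
    allowed (yes e) u v = does (Graph._~?_ (𝐆 (colour e)) u v)
    allowed (no  _) u v = true

    does-sym : ∀ (G : Graph n) u v → does (Graph._~?_ G u v) ≡ does (Graph._~?_ G v u)
    does-sym G u v with Graph._~?_ G u v | Graph._~?_ G v u
    ... | yes _ | yes _ = refl
    ... | no  _ | no  _ = refl
    ... | yes e | no ¬e = contradiction (Graph.~-sym G e) ¬e
    ... | no ¬e | yes e = contradiction (Graph.~-sym G e) ¬e

    allowed-sym : ∀ {x y} (d : Dec (Adj H x y)) (d′ : Dec (Adj H y x)) u v → allowed d u v ≡ allowed d′ v u
    allowed-sym (yes e) (yes e′) u v = trans (cong (λ c → does (Graph._~?_ (𝐆 c) u v)) (symmetric e e′)) (does-sym (𝐆 (colour e′)) u v)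
    allowed-sym (no  _) (no  _)  u v = refl
    allowed-sym (yes e) (no ¬e)  u v = contradiction (Graph.~-sym H e) ¬e
    allowed-sym (no ¬e) (yes e)  u v = contradiction (Graph.~-sym H e) ¬e

    allowed-refl : ∀ {x} (d : Dec (Adj H x x)) u v → allowed d u v ≡ true
    allowed-refl (yes e) u v = contradiction e (Graph.~-irrefl H refl)
    allowed-refl (no  _) u v = refl

    none-missing : count {n} (λ _ → false) ≤ n ∸ δ 𝐆
    none-missing = ≤-trans (≤-reflexive (trans (sum-const n 0) (*-zeroʳ n))) z≤n

    allowed-missing : ∀ {x y} (d : Dec (Adj H x y)) u → count (λ v → not (allowed d u v)) ≤ n ∸ δ 𝐆
    allowed-missing (yes e) u = non-neighbours≤ 𝐆 (colour e) u
    allowed-missing (no  _) u = none-missing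

    allowed-false : ∀ {x y} (d : Dec (Adj H x y)) u v → allowed d u v ≡ false → Adj H x y
    allowed-false (yes e) u v _ = e

    allowed-true : ∀ {x y} (d : Dec (Adj H x y)) {u v} → allowed d u v ≡ true → (e : Adj H x y) → Adj (𝐆 (colour e)) u v
    allowed-true (no ¬e)  _ e = contradiction e ¬e
    allowed-true (yes e′) {u} {v} ok e = subst (λ c → Adj (𝐆 c) u v) (colour-unique e′ e) (adjacent (Graph._~?_ (𝐆 (colour e′)) u v) ok)
      where
      adjacent : ∀ {P : Set} (d : Dec P) → does d ≡ true → P
      adjacent (yes p) _ = p

    -- Positions outside the cycle carry no constraint, which extends the pattern to all natural
    -- numbers.
    okAt : ∀ {x y} → Dec (x < n) → Dec (y < n) → Fin n → Fin n → Bool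
    okAt (yes x<n) (yes y<n) u v = allowed (Graph._~?_ H (fromℕ< x<n) (fromℕ< y<n)) u v
    okAt (yes _)   (no  _)   u v = true
    okAt (no  _)   _         u v = true

    okAt-sym : ∀ {x y} (a : Dec (x < n)) (b : Dec (y < n)) u v → okAt a b u v ≡ okAt b a v u
    okAt-sym (yes x<n) (yes y<n) u v =
      allowed-sym (Graph._~?_ H (fromℕ< x<n) (fromℕ< y<n)) (Graph._~?_ H (fromℕ< y<n) (fromℕ< x<n)) u v
    okAt-sym (yes _) (no  _) u v = refl
    okAt-sym (no  _) (yes _) u v = refl
    okAt-sym (no  _) (no  _) u v = refl

    okAt-refl : ∀ {x} (a : Dec (x < n)) u v → okAt a a u v ≡ true
    okAt-refl (yes x<n) u v = allowed-refl (Graph._~?_ H (fromℕ< x<n) (fromℕ< x<n)) u v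
    okAt-refl (no  _) u v = refl

    okAt-missing : ∀ {x y} (a : Dec (x < n)) (b : Dec (y < n)) u → count (λ v → not (okAt a b u v)) ≤ n ∸ δ 𝐆
    okAt-missing (yes x<n) (yes y<n) u = allowed-missing (Graph._~?_ H (fromℕ< x<n) (fromℕ< y<n)) u
    okAt-missing (yes _)   (no  _)   u = none-missing
    okAt-missing (no  _)   _         u = none-missing

  module _ {k : ℕ} (k≤n : k ≤ n)
    (near : ∀ {x y} → Adj H x y → ∃ λ s → s < 2 * k × neighbour {n} k (toℕ x) s ≡ toℕ y) where

    private
      okAt-near : ∀ {x y} (a : Dec (x < n)) (b : Dec (y < n)) u v → okAt a b u v ≡ false → ∃ λ s → s < 2 * k × neighbour {n} k x s ≡ y
      okAt-near (yes x<n) (yes y<n) u v bad =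
        subst₂ (λ x y → ∃ λ s → s < 2 * k × neighbour {n} k x s ≡ y) (Fin.toℕ-fromℕ< x<n) (Fin.toℕ-fromℕ< y<n)
          (near (allowed-false (Graph._~?_ H (fromℕ< x<n) (fromℕ< y<n)) u v bad))

    pattern-of : Pattern n k (n ∸ δ 𝐆)
    pattern-of = record
      { ok       = λ x y → okAt (x <? n) (y <? n)
      ; ok-sym   = λ x y → okAt-sym (x <? n) (y <? n)
      ; ok-refl  = λ x → okAt-refl (x <? n)
      ; missing  = λ x y → okAt-missing (x <? n) (y <? n)
      ; nb       = neighbour k
      ; near     = λ {x} {y} → okAt-near (x <? n) (y <? n) _ _
      ; nb-left  = neighbour-left k
      ; nb-right = λ _ → neighbour-right k k≤n
      }

    coloured-copy : CompleteEmbedding pattern-of → ColouredCopy H χ 𝐆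
    coloured-copy (f , f-inj , f-ok) = record
      { φ         = f ∘ toℕ
      ; injective = λ {x} {y} e → Fin.toℕ-injective (f-inj (Fin.toℕ<n x) (Fin.toℕ<n y) e)
      ; edges     = λ {x} {y} → okAt-edge (toℕ x <? n) (toℕ y <? n) (f-ok (Fin.toℕ<n x) (Fin.toℕ<n y)) }
      where
      okAt-edge : ∀ {x y u v} (a : Dec (toℕ x < n)) (b : Dec (toℕ y < n)) → okAt a b u v ≡ true →
                  (e : Adj H x y) → Adj (𝐆 (colour e)) u v
      okAt-edge {x} {y} {u} {v} (yes x<n) (yes y<n) ok =
        subst₂ (λ x y → (e : Adj H x y) → Adj (𝐆 (colour e)) u v) (Fin.fromℕ<-toℕ x x<n) (Fin.fromℕ<-toℕ y y<n)
          (allowed-true (Graph._~?_ H (fromℕ< x<n) (fromℕ< y<n)) ok)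
      okAt-edge {x} (no x≮n) _ _ = contradiction (Fin.toℕ<n x) x≮n
      okAt-edge {y = y} (yes _) (no y≮n) _ = contradiction (Fin.toℕ<n y) y≮n

theorem1p2 : (k : ℕ) .{{_ : NonZero k}} → 2 ≤ k →
    (α : ℝ) → Positive α →
    ∃ λ (n₀ : ℕ) → (n : ℕ) → n₀ ≤ n →
    (m : ℕ) (𝐆 : Fin m → Graph n) → δ 𝐆 ≥⟨ 1-1/2k k + α ⟩· n →
    (χ : EdgeColouring (C n ^ k) m) →
    ColouredCopy (C n ^ k) χ 𝐆
theorem1p2 k 2≤k α α>0 = K * z₀ , λ n n≥ m 𝐆 dense χ →
  let instance
        n≢0 : NonZero n
        n≢0 = >-nonZero (n>0 n n≥)
      k≤n = ≤-trans (m≤n+m k _) (k+gw≤n n n≥)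
      near = power-neighbour k (≤-trans (s≤s z≤n) 2≤k) k≤n
  in coloured-copy χ 𝐆 k≤n near (embedding n n≥ (pattern-of χ 𝐆 k≤n near) (proj₂ (dense-bound k α α>0) n m 𝐆 dense))
  where open Constants k (proj₁ (dense-bound k α α>0)) 2≤k
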